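{- In the Farzan–Munro model of group representation, there is a representation of Z-groups such that, for every finite Z-group $G$, the multiplication operation can be performed using $\mathcal{O}(1)$ space (words) in $\mathcal{O}(1)$ time. The constants in the $\mathcal{O}$-notation are absolute (independent of $G$).
   Context: A Z-group is a finite group all of whose Sylow subgroups are cyclic. Farzan–Munro model: computation is on a random access machine in which a word is large enough to hold the value of the order $n$ of the input group (words have $\mathcal{O}(\log n)$ bits); random access and arithmetic, logic and comparison operations on words take $\mathcal{O}(1)$ time, and bit-reversal of a word is also available as a native $\mathcal{O}(1)$-time operation. A representation of a class of groups consists of the following. (i) A compression algorithm, which takes a group $G$ of the class and outputs a compressed form of $G$. (ii) A labeling, which (based on the compression) represents each element of $G$ by a label. (iii) A query processing unit, which stores the compressed form of $G$ and, given the labels of two elements $x,y\in G$, returns the label of the product $xy$. Compression and labeling are carried out by an "outside user", who also supplies the labels of the elements to be multiplied to the query processing unit; the time and space used for compression and labeling are not counted. The space of the representation is the number of words used by the query processing unit, and the query time is the worst-case time it uses to answer a multiplication query. -}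

module Defs where

open import Algebra.Bundles using (Group)
open import Data.Bool using (Bool; not; _∧_; _∨_; _xor_; if_then_else_)
open import Data.Fin using (Fin; toℕ; fromℕ<; opposite; finToFun; funToFin)
open import Data.Fin.Properties using (2↔Bool)
open import Data.Fin.Subset using (Subset; _∈_; ∣_∣)
open import Data.Integer using (ℤ; +_; -[1+_])
open import Data.List using (List; head; drop)
open import Data.Maybe using (Maybe; just; nothing; _>>=_)
open import Data.Nat using (ℕ; zero; suc; _+_; _*_; _∸_; _^_; _≤_; _<_; _<?_; _≡ᵇ_; _<ᵇ_)
open import Data.Nat.Divisibility using (_∣_)
open import Data.Nat.DivMod using (_/_; _%_; _mod_)
open import Data.Nat.Logarithm using (⌊log₂_⌋)
open import Data.Nat.Primality using (Prime)
open import Data.Nat.Properties using (m^n≢0)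
open import Data.Product using (∃; ∃₂; _×_; _,_; proj₁)
open import Data.Vec using (Vec; lookup; _[_]≔_; _++_)
open import Function using (Inverse; _∘_)
open import Level using (Level; _⊔_) renaming (suc to lsuc)
open import Relation.Binary.PropositionalEquality using (_≡_; setoid)
open import Relation.Nullary using (¬_; yes; no)

import Algebra.Definitions.RawMonoid as RawMonoidDefs

private
  variable
    c ℓ z : Level
    w s : ℕ

record FiniteGroup (c ℓ : Level) : Set (lsuc (c ⊔ ℓ)) where
  field
    group       : Group c ℓ
    order       : ℕ
    enumeration : Inverse (Group.setoid group) (setoid (Fin order))

  open Group group public
  open RawMonoidDefs rawMonoid using () renaming (_×_ to _times_)

  index : Carrier → Fin order
  index = Inverse.to enumeration

  power : Carrier → ℤ → Carrier
  power g (+ n)    = n times g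
  power g -[1+ n ] = (suc n times g) ⁻¹

  -- Subsets of the group are subsets of its enumeration, so that ∣_∣ is
  -- the number of elements.
  record IsSubgroup (H : Subset order) : Set c where
    field
      ε-closed  : index ε ∈ H
      ∙-closed  : ∀ x y → index x ∈ H → index y ∈ H → index (x ∙ y) ∈ H
      ⁻¹-closed : ∀ x → index x ∈ H → index (x ⁻¹) ∈ H

  record IsSylow (p : ℕ) (H : Subset order) : Set c where
    field
      isSubgroup : IsSubgroup H
      exponent   : ℕ
      card       : ∣ H ∣ ≡ p ^ exponent
      divides    : p ^ exponent ∣ order
      maximal    : ¬ (p ^ suc exponent ∣ order)

  IsCyclic : Subset order → Set (c ⊔ ℓ)
  IsCyclic H = ∃ λ g → index g ∈ H × (∀ x → index x ∈ H → ∃ λ k → x ≈ power g k)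

IsZGroup : FiniteGroup c ℓ → Set (c ⊔ ℓ)
IsZGroup G = ∀ p → Prime p → ∀ H → IsSylow p H → IsCyclic H
  where open FiniteGroup G

-- The word length, as a function of the order n of the input group.  The
-- outer suc keeps the O(log n) bound meaningful at n = 1.
record WordLength : Set where
  field
    bits      : ℕ → ℕ
    holds     : ∀ n → n < 2 ^ bits n
    constant  : ℕ
    O[log]    : ∀ n → bits n ≤ constant * suc ⌊log₂ n ⌋

record Word (w : ℕ) : Set where
  constructor word
  field
    value : Fin (2 ^ w)

⟦_⟧ : Word w → ℕ
⟦ word i ⟧ = toℕ i

wrap : ∀ w → ℕ → Word w
wrap w n = word ((n mod (2 ^ w)) {{m^n≢0 2 w}})

-- Most significant bit first.
toBits : Word w → Fin w → Bool
toBits (word i) = Inverse.to 2↔Bool ∘ finToFun i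

fromBits : (Fin w → Bool) → Word w
fromBits f = word (funToFin (Inverse.from 2↔Bool ∘ f))

-- Division by zero is given an arbitrary value rather than a fault.
quotient remainder : ℕ → ℕ → ℕ
quotient  a zero    = 0
quotient  a (suc b) = a / suc b
remainder a zero    = a
remainder a (suc b) = a % suc b

data UnOp : Set where
  complement bitReversal : UnOp

data BinOp : Set where
  add sub mul div rem and or xor shiftLeft shiftRight equal less : BinOp

evalUn : UnOp → Word w → Word w
evalUn complement  a = fromBits (not ∘ toBits a)
evalUn bitReversal a = fromBits (toBits a ∘ opposite)

evalBin : BinOp → Word w → Word w → Word w
evalBin {w} op a b = go op
  where
  m = ⟦ a ⟧
  n = ⟦ b ⟧
  bitwise : (Bool → Bool → Bool) → Word w
  bitwise f = fromBits λ i → f (toBits a i) (toBits b i)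
  go : BinOp → Word w
  go add        = wrap w (m + n)
  go sub        = wrap w (m + (2 ^ w ∸ n))
  go mul        = wrap w (m * n)
  go div        = wrap w (quotient m n)
  go rem        = wrap w (remainder m n)
  go and        = bitwise _∧_
  go or         = bitwise _∨_
  go xor        = bitwise _xor_
  go shiftLeft  = wrap w (m * 2 ^ n)
  go shiftRight = wrap w (quotient m (2 ^ n))
  go equal      = wrap w (if m ≡ᵇ n then 1 else 0)
  go less       = wrap w (if m <ᵇ n then 1 else 0)

-- indirect a is the cell whose address is the content of cell a.
data Location : Set where
  direct indirect : ℕ → Location

data Operand : Set where
  literal : ℕ → Operand
  at      : Location → Operand

data Instruction : Set where
  move       : Location → Operand → Instruction
  unary      : UnOp → Location → Operand → Instruction
  binary     : BinOp → Location → Operand → Operand → Instruction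
  jumpIfZero : Operand → ℕ → Instruction
  halt       : Instruction

Program : Set
Program = List Instruction

-- A machine with s cells; any access outside them is a fault.
Memory : ℕ → ℕ → Set
Memory w s = Vec (Word w) s

cell : ℕ → Maybe (Fin s)
cell {s} a with a <? s
... | yes a<s = just (fromℕ< a<s)
... | no  _   = nothing

locate : Memory w s → Location → Maybe (Fin s)
locate mem (direct a)   = cell a
locate mem (indirect a) = cell a >>= λ i → cell (⟦ lookup mem i ⟧)

fetch : Memory w s → Operand → Maybe (Word w)
fetch {w} mem (literal n) = just (wrap w n)
fetch     mem (at l)      = locate mem l >>= λ i → just (lookup mem i)

store : Memory w s → Location → Word w → Maybe (Memory w s)
store mem l v = locate mem l >>= λ i → just (mem [ i ]≔ v)

-- The program counter, with the memory.
State : ℕ → ℕ → Set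
State w s = ℕ × Memory w s

data Outcome (w s : ℕ) : Set where
  continue : State w s → Outcome w s
  halted   : Memory w s → Outcome w s

execute : Instruction → State w s → Maybe (Outcome w s)
execute (move l o) (pc , mem) =
  fetch mem o >>= λ a →
  store mem l a >>= λ mem′ →
  just (continue (suc pc , mem′))
execute (unary op l o) (pc , mem) =
  fetch mem o >>= λ a →
  store mem l (evalUn op a) >>= λ mem′ →
  just (continue (suc pc , mem′))
execute (binary op l o₁ o₂) (pc , mem) =
  fetch mem o₁ >>= λ a →
  fetch mem o₂ >>= λ b →
  store mem l (evalBin op a b) >>= λ mem′ →
  just (continue (suc pc , mem′))
execute (jumpIfZero o target) (pc , mem) =
  fetch mem o >>= λ a →
  just (continue ((if ⟦ a ⟧ ≡ᵇ 0 then target else suc pc) , mem))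
execute halt (pc , mem) = just (halted mem)

step : Program → State w s → Maybe (Outcome w s)
step P (pc , mem) = head (drop pc P) >>= λ i → execute i (pc , mem)

-- P ⊢ σ ⇓[ t ] mem : from state σ the program halts after exactly t
-- instructions with final memory mem.
data _⊢_⇓[_]_ (P : Program) (σ : State w s) : ℕ → Memory w s → Set where
  stop : ∀ {mem} → step P σ ≡ just (halted mem) → P ⊢ σ ⇓[ 1 ] mem
  next : ∀ {σ′ t mem} → step P σ ≡ just (continue σ′) →
         P ⊢ σ′ ⇓[ t ] mem → P ⊢ σ ⇓[ suc t ] mem

-- The query processing unit holds the compressed form, then the labels of
-- x and y, then scratch cells of unspecified content.  It must leave the
-- compressed form intact, with the label of x ∙ y following it, so that
-- any number of queries can be answered in succession.
record Encoding (w : ℕ) (P : Program) (G : FiniteGroup c ℓ) : Set (c ⊔ ℓ) where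
  open FiniteGroup G
  field
    compressedSize  : ℕ
    compressed      : Vec (Word w) compressedSize
    labelSize       : ℕ
    label           : Carrier → Vec (Word w) labelSize
    label-cong      : ∀ {x y} → x ≈ y → label x ≡ label y
    label-injective : ∀ {x y} → label x ≡ label y → x ≈ y
    scratchSize     : ℕ
    multiply        : ∀ x y (scratch : Vec (Word w) scratchSize) →
      ∃₂ λ t rest →
        P ⊢ (0 , (compressed ++ label x) ++ (label y ++ scratch))
          ⇓[ t ] ((compressed ++ label (x ∙ y)) ++ rest)

  space : ℕ
  space = (compressedSize + labelSize) + (labelSize + scratchSize)

  time : Carrier → Carrier → Vec (Word w) scratchSize → ℕ
  time x y scratch = proj₁ (multiply x y scratch)

-- One program serves every group of the class.
record Representation (W : WordLength) (𝒞 : FiniteGroup c ℓ → Set z) :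
                      Set (lsuc (c ⊔ ℓ) ⊔ z) where
  field
    program : Program
    encode  : ∀ G → 𝒞 G →
              Encoding (WordLength.bits W (FiniteGroup.order G)) program G

  SpaceBoundedBy : ℕ → Set (lsuc (c ⊔ ℓ) ⊔ z)
  SpaceBoundedBy b = ∀ G (G∈𝒞 : 𝒞 G) → Encoding.space (encode G G∈𝒞) ≤ b

  QueryTimeBoundedBy : ℕ → Set (lsuc (c ⊔ ℓ) ⊔ z)
  QueryTimeBoundedBy b = ∀ G (G∈𝒞 : 𝒞 G) x y scratch →
                         Encoding.time (encode G G∈𝒞) x y scratch ≤ b

{-# OPTIONS --safe #-}
module Submission where

-- A Z-group is metacyclic: it has a cyclic normal subgroup ⟪ a ⟫ of order m with
-- cyclic quotient of order t generated by b, so every element is a ↑ i ∙ b ↑ j for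
-- unique i < m, j < t, and b ↑ j acts on a as the power ρ = r ^ j mod m.  Storing ρ
-- in the label spares the query the exponentiation; storing also ⌊ρ B² / m⌋, where
-- B² is about 2 ^ w, lets it reduce ρ x modulo m without double-word division, and
-- that quotient can itself be updated along with ρ.
--
-- Metacyclicity is derived from Frobenius' theorem (d divides the number of solutions
-- of x ^ d = 1, proved after Isaacs and Robinson) instead of transfer: with cyclic
-- Sylow subgroups the count is exactly d when d collects the largest primes of the
-- order, so the elements killed by the largest prime form a normal subgroup.  Hence a
-- maximal abelian normal subgroup F is its own centralizer.  F and G / F are then
-- abelian with cyclic Sylow subgroups, hence cyclic.

open import Algebra.Bundles using (Group)
open import Algebra.Structures using (IsGroup)
open import Data.Bool using (true; false; T; if_then_else_)
open import Data.Fin using (Fin; zero; suc; toℕ; fromℕ<; #_)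
open import Data.Fin.Properties using (any?; all?; pigeonhole; toℕ-fromℕ<; fromℕ<-toℕ; toℕ<n; toℕ-injective) renaming (_≟_ to _≟ᶠ_; suc-injective to sucᶠ-injective)
open import Data.Fin.Subset using (Subset) renaming (∣_∣ to ∣_∣ˢ; _∈_ to _∈ˢ_)
open import Data.Integer using (-[1+_]) renaming (+_ to nonneg)
open import Data.List using (List; []; _∷_; drop; length) renaming (_++_ to _++ˡ_)
open import Data.List.Relation.Unary.All using (_∷_)
open import Data.Maybe using (just)
open import Data.Nat using (ℕ; zero; suc; pred; _+_; _*_; _∸_; _^_; _≤_; _<_; _<?_; _<ᵇ_; z≤n; s≤s; NonZero; >-nonZero; >-nonZero⁻¹; ⌊_/2⌋; ⌈_/2⌉) renaming (_≟_ to _≟ⁿ_)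
open import Data.Nat.Coprimality using (Coprime; coprime-divisor; coprime-Bézout) renaming (sym to coprime-sym)
open import Data.Nat.Divisibility
open import Data.Nat.DivMod using (_/_; _%_; m≡m%n+[m/n]*n; m%n<n; m%n≤n; m%n%n≡m%n; m<n⇒m%n≡m; [m+kn]%n≡m%n; %-distribˡ-+; %-distribˡ-*; m<n*o⇒m/o<n)
open import Data.Nat.GCD using (gcd; gcd[m,n]∣m; gcd[m,n]∣n; gcd-greatest; c*gcd[m,n]≡gcd[cm,cn]; module Bézout)
open import Data.Nat.Induction using (<-rec)
open import Data.Nat.ListAction using (product)
open import Data.Nat.Primality using (Prime; prime?; euclidsLemma; ¬prime[0]; ¬prime[1]; prime⇒nonZero; prime⇒irreducible)
open import Data.Nat.Primality.Factorisation using (factorise)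
open import Data.Nat.Properties
open import Data.Nat.Tactic.RingSolver using (solve-∀)
open import Data.Product using (Σ; Σ-syntax; ∃; ∃₂; _×_; _,_; proj₁; proj₂)
open import Data.Sum using (_⊎_; inj₁; inj₂)
open import Data.Unit using (⊤; tt)
open import Data.Vec using (Vec; []; _∷_; lookup; _[_]≔_; _++_; head; tail; tabulate)
open import Data.Vec.Properties using (lookup⇒[]=; []=⇒lookup; lookup∘tabulate)
open import Function using (Inverse; _∘_; id)
open import Level using (Level)
open import Relation.Binary.PropositionalEquality hiding (J; setoid)
open import Relation.Nullary using (¬_; Dec; yes; no; does; contradiction)
open import Relation.Nullary.Decidable using (_×-dec_; _→-dec_; ¬?)
open import Relation.Unary using (Decidable)
open import Algebra.Properties.CommutativeMonoid.Sum +-0-commutativeMonoid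
  using (sum; sum-cong-≗; ∑-distrib-+; ∑-comm; sum-replicate-zero)
import Algebra.Properties.Group
import Algebra.Properties.Monoid.Mult
open import Defs

-- The exact count is applied to `C / F`, where `C` is the centralizer of an abelian normal subgroup
-- `F`: the elements killed by the largest prime of its order form a subgroup cut out by a
-- conjugation-invariant condition, and `F` grows by it while staying abelian. Frobenius' and
-- Sylow's theorems are both proved by induction through sections of the group, so quotients are
-- renumbered as groups on initial segments. The machine poses a separate obstacle: a word is only
-- known to exceed the order of the group, and multiplication returns the low word alone. A product
-- of two residues modulo m can overflow, and so could a sum if m were close to the word size. Sums
-- are saved by 2 m ≤ n, available unless the group is cyclic, in which case ⟪a⟫ is taken trivial.
-- Products are saved because a difference of two wrapped numbers is exact as soon as the true
-- difference fits. The half-word base is B = 2 ^ ⌊w/2⌋, so that B² is at least half of 2 ^ w, hence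
-- at least m, while half-word products still fit.

-- Counting decidable subsets of finite sets

module Counting where
  private
    variable
      a b n : ℕ

  indicator : {P : Set} → Dec P → ℕ
  indicator (yes _) = 1
  indicator (no _)  = 0

  indicator-yes : {P : Set} (P? : Dec P) → P → indicator P? ≡ 1
  indicator-yes (yes _) _ = refl
  indicator-yes (no ¬p) p = contradiction p ¬p

  indicator-no : {P : Set} (P? : Dec P) → ¬ P → indicator P? ≡ 0
  indicator-no (yes p) ¬p = contradiction p ¬p
  indicator-no (no _)  _  = refl

  indicator-mono : {P Q : Set} (P? : Dec P) (Q? : Dec Q) → (P → Q) → indicator P? ≤ indicator Q?
  indicator-mono (yes p) Q? f = ≤-reflexive (sym (indicator-yes Q? (f p)))
  indicator-mono (no _)  Q? f = z≤n

  indicator-cong : {P Q : Set} (P? : Dec P) (Q? : Dec Q) → (P → Q) → (Q → P) →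
                   indicator P? ≡ indicator Q?
  indicator-cong P? Q? f g = ≤-antisym (indicator-mono P? Q? f) (indicator-mono Q? P? g)

  sum-*ʳ : (f : Fin n → ℕ) (k : ℕ) → sum (λ x → f x * k) ≡ sum f * k
  sum-*ʳ {zero}  f k = refl
  sum-*ʳ {suc n} f k = trans (cong (f zero * k +_) (sum-*ʳ (f ∘ suc) k)) (sym (*-distribʳ-+ k (f zero) _))

  opaque
    count : {P : Fin n → Set} → Decidable P → ℕ
    count P? = sum (λ x → indicator (P? x))

  opaque
    unfolding count

    count-cong : {P Q : Fin n → Set} (P? : Decidable P) (Q? : Decidable Q) →
                 (∀ x → P x → Q x) → (∀ x → Q x → P x) → count P? ≡ count Q?
    count-cong P? Q? f g = sum-cong-≗ λ x → indicator-cong (P? x) (Q? x) (f x) (g x)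

    count-split : {P Q : Fin n → Set} (P? : Decidable P) (Q? : Decidable Q) →
                  count P? ≡ count (λ x → P? x ×-dec Q? x) + count (λ x → P? x ×-dec ¬? (Q? x))
    count-split P? Q? = trans (sum-cong-≗ pointwise) (∑-distrib-+ (λ x → indicator (P? x ×-dec Q? x)) _)
      where
      pointwise : ∀ x → indicator (P? x) ≡
                  indicator (P? x ×-dec Q? x) + indicator (P? x ×-dec ¬? (Q? x))
      pointwise x with P? x | Q? x
      ... | yes _ | yes _ = refl
      ... | yes _ | no  _ = refl
      ... | no  _ | _     = refl

    count-none : {P : Fin n → Set} (P? : Decidable P) → (∀ x → ¬ P x) → count P? ≡ 0
    count-none {n} P? ¬P = trans (sum-cong-≗ λ x → indicator-no (P? x) (¬P x)) (sum-replicate-zero n)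

    count-pos : {P : Fin n → Set} (P? : Decidable P) {x : Fin n} → P x → 1 ≤ count P?
    count-pos P? {zero}  px = ≤-trans (≤-reflexive (sym (indicator-yes (P? zero) px))) (m≤m+n _ _)
    count-pos P? {suc x} px = ≤-trans (count-pos (P? ∘ suc) px) (m≤n+m _ (indicator (P? zero)))

    count-all : {P : Fin n → Set} (P? : Decidable P) → (∀ x → P x) → count P? ≡ n
    count-all {zero}  P? all = refl
    count-all {suc n} P? all = cong₂ _+_ (indicator-yes (P? zero) (all zero)) (count-all (P? ∘ suc) (all ∘ suc))

    count-unique : {P : Fin n → Set} (P? : Decidable P) {x : Fin n} → P x → (∀ y → P y → x ≡ y) → count P? ≡ 1
    count-unique P? {zero} px uniq =
      cong₂ _+_ (indicator-yes (P? zero) px) (count-none (P? ∘ suc) λ y py → contradiction (uniq (suc y) py) λ ())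
    count-unique P? {suc x} px uniq =
      cong₂ _+_ (indicator-no (P? zero) λ p0 → contradiction (uniq zero p0) λ ())
                (count-unique (P? ∘ suc) px λ y py → suc-inj (uniq (suc y) py))
      where
      suc-inj : {x y : Fin n} → suc x ≡ suc y → x ≡ y
      suc-inj refl = refl

    -- Both sides are the number of pairs in `R`, summed by rows and by columns; the hypothesis that
    -- `R` lies in `P` × `Q` makes all other rows and columns empty.
    double-count : {P : Fin a → Set} {Q : Fin b → Set} {R : Fin a → Fin b → Set}
      (P? : Decidable P) (Q? : Decidable Q) (R? : ∀ x y → Dec (R x y)) {k l : ℕ} →
      (∀ x y → R x y → P x × Q y) →
      (∀ x → P x → count (R? x) ≡ k) →
      (∀ y → Q y → count (λ x → R? x y) ≡ l) →
      count P? * k ≡ count Q? * l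
    double-count {a} {b} P? Q? R? {k} {l} R⊆P×Q rows columns = begin
      count P? * k                                  ≡⟨ sum-*ʳ (λ x → indicator (P? x)) k ⟨
      sum (λ x → indicator (P? x) * k)              ≡⟨ sum-cong-≗ row ⟩
      sum (λ x → sum (λ y → indicator (R? x y)))    ≡⟨ ∑-comm (λ x y → indicator (R? x y)) ⟩
      sum (λ y → sum (λ x → indicator (R? x y)))    ≡⟨ sum-cong-≗ column ⟨
      sum (λ y → indicator (Q? y) * l)              ≡⟨ sum-*ʳ (λ y → indicator (Q? y)) l ⟩
      count Q? * l                                  ∎
      where
      open ≡-Reasoning
      row : ∀ x → indicator (P? x) * k ≡ count (R? x)
      row x with P? x
      ... | yes px = trans (*-identityˡ k) (sym (rows x px))
      ... | no ¬px = sym (count-none (R? x) λ y r → ¬px (proj₁ (R⊆P×Q x y r)))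
      column : ∀ y → indicator (Q? y) * l ≡ count (λ x → R? x y)
      column y with Q? y
      ... | yes qy = trans (*-identityˡ l) (sym (columns y qy))
      ... | no ¬qy = sym (count-none (λ x → R? x y) λ x r → ¬qy (proj₂ (R⊆P×Q x y r)))

  count-⊆-≡ : {P Q : Fin n → Set} (P? : Decidable P) (Q? : Decidable Q) →
              (∀ x → P x → Q x) → count Q? ≤ count P? → ∀ x → Q x → P x
  count-⊆-≡ P? Q? P⊆Q #Q≤#P x qx with P? x
  ... | yes px = px
  ... | no ¬px = contradiction #Q≤#P (<⇒≱ (begin-strict
    count P?                     ≡⟨ count-cong P? (λ x → Q? x ×-dec P? x) (λ x px → P⊆Q x px , px) (λ _ → proj₂) ⟩
    count (λ x → Q? x ×-dec P? x) <⟨ m<m+n _ (count-pos (λ x → Q? x ×-dec ¬? (P? x)) (qx , ¬px)) ⟩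
    count (λ x → Q? x ×-dec P? x) + count (λ x → Q? x ×-dec ¬? (P? x)) ≡⟨ count-split Q? P? ⟨
    count Q?                     ∎))
    where open ≤-Reasoning

  count-bijection : {P : Fin a → Set} {Q : Fin b → Set} (P? : Decidable P) (Q? : Decidable Q)
    (f : Fin a → Fin b) (g : Fin b → Fin a) →
    (∀ x → P x → Q (f x)) → (∀ y → Q y → P (g y)) →
    (∀ x → P x → g (f x) ≡ x) → (∀ y → Q y → f (g y) ≡ y) →
    count P? ≡ count Q?
  count-bijection P? Q? f g f-maps g-maps gf fg = begin
    count P?     ≡⟨ *-identityʳ _ ⟨
    count P? * 1 ≡⟨ double-count P? Q? (λ x y → P? x ×-dec (Q? y ×-dec (f x ≟ᶠ y)))
                      (λ _ _ (px , qy , _) → px , qy)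
                      (λ x px → count-unique _ (px , f-maps x px , refl) λ _ (_ , _ , fx≡y) → fx≡y)
                      (λ y qy → count-unique _ (g-maps y qy , qy , fg y qy)
                         λ x (px , _ , fx≡y) → trans (cong g (sym fx≡y)) (gf x px)) ⟩
    count Q? * 1 ≡⟨ *-identityʳ _ ⟩
    count Q?     ∎
    where open ≡-Reasoning

  -- Removing the class of one element leaves a smaller set whose classes are unchanged, so
  -- induction on the size applies. The equivalence laws are demanded inside `S` only: the relation
  -- used on `Layer` is not symmetric outside it.
  partition-∣ : {S : Fin n → Set} {R : Fin n → Fin n → Set}
    (S? : Decidable S) (R? : ∀ x y → Dec (R x y)) (k : ℕ) →
    (∀ x → S x → R x x) →
    (∀ x y → S x → S y → R x y → R y x) →
    (∀ x y z → S x → S y → S z → R x y → R y z → R x z) →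
    (∀ x → S x → k ∣ count (λ y → S? y ×-dec R? x y)) →
    k ∣ count S?
  partition-∣ {n} {S₀} {R} S₀? R? k = λ r s t d → <-rec Goal go (count S₀?) S₀? refl r s t d
    where
    Goal : ℕ → Set₁
    Goal m = {S : Fin n → Set} (S? : Decidable S) → count S? ≡ m →
      (∀ x → S x → R x x) →
      (∀ x y → S x → S y → R x y → R y x) →
      (∀ x y z → S x → S y → S z → R x y → R y z → R x z) →
      (∀ x → S x → k ∣ count (λ y → S? y ×-dec R? x y)) →
      k ∣ count S?
    go : ∀ m → (∀ {m′} → m′ < m → Goal m′) → Goal m
    go m rec {S} S? refl r s t d with any? S?
    ... | no ¬∃S = subst (k ∣_) (sym (count-none S? λ x sx → ¬∃S (x , sx))) (k ∣0)
    ... | yes (x , sx) =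
      subst (k ∣_) (sym (count-split S? (R? x))) (∣m∣n⇒∣m+n (d x sx)
        (rec smaller S′? refl (λ y → r y ∘ proj₁) (λ y z (sy , _) (sz , _) → s y z sy sz)
          (λ u v w (su , _) (sv , _) (sw , _) → t u v w su sv sw)
          λ y (sy , ¬xy) → subst (k ∣_)
            (count-cong (λ z → S? z ×-dec R? y z) (λ z → S′? z ×-dec R? y z)
              (λ z (sz , yz) → (sz , λ xz → ¬xy (t x z y sx sz sy xz (s y z sy sz yz))) , yz)
              (λ z ((sz , _) , yz) → sz , yz))
            (d y sy)))
      where
      S′? = λ y → S? y ×-dec ¬? (R? x y)
      smaller : count S′? < count S?
      smaller = subst (count S′? <_) (sym (count-split S? (R? x)))
        (m<n+m _ (count-pos (λ y → S? y ×-dec R? x y) (sx , r x sx)))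

open Counting

-- Prime powers, coprimality and bounded search

module Arithmetic where
  private
    variable
      a b c d e k m n p q r s : ℕ

  prime≥2 : Prime p → 2 ≤ p
  prime≥2 {zero}        pr = contradiction pr ¬prime[0]
  prime≥2 {suc zero}    pr = contradiction pr ¬prime[1]
  prime≥2 {suc (suc p)} pr = s≤s (s≤s z≤n)

  ^-pos : 1 ≤ m → ∀ k → 1 ≤ m ^ k
  ^-pos {suc m} _ k = >-nonZero⁻¹ (suc m ^ k) {{m^n≢0 (suc m) k}}

  *-pos⁻¹ˡ : 1 ≤ m * n → 1 ≤ m
  *-pos⁻¹ˡ {suc m} _ = s≤s z≤n

  *-pos⁻¹ʳ : ∀ m → 1 ≤ m * n → 1 ≤ n
  *-pos⁻¹ʳ {n} m h = *-pos⁻¹ˡ {n} {m} (subst (1 ≤_) (*-comm m n) h)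

  ^-mono-∣ : ∀ p {i j} → i ≤ j → p ^ i ∣ p ^ j
  ^-mono-∣ p {i} {j} i≤j = divides (p ^ (j ∸ i)) (begin
    p ^ j                   ≡⟨ cong (p ^_) (m∸n+n≡m i≤j) ⟨
    p ^ (j ∸ i + i)         ≡⟨ ^-distribˡ-+-* p (j ∸ i) i ⟩
    p ^ (j ∸ i) * p ^ i     ∎)
    where open ≡-Reasoning

  prime-coprime : Prime p → ¬ p ∣ s → Coprime p s
  prime-coprime pr p∤s {i} (i∣p , i∣s) with prime⇒irreducible pr i∣p
  ... | inj₁ i≡1  = i≡1
  ... | inj₂ refl = contradiction i∣s p∤s

  prime^-coprime : Prime p → ¬ p ∣ s → ∀ k → Coprime (p ^ k) s
  prime^-coprime pr p∤s zero (i∣1 , _) = ∣1⇒≡1 i∣1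
  prime^-coprime pr p∤s (suc k) {i} (i∣p^ , i∣s) = prime^-coprime pr p∤s k
    (coprime-divisor (λ (j∣i , j∣p) → prime-coprime pr p∤s (j∣p , ∣-trans j∣i i∣s)) i∣p^ , i∣s)

  coprime-*-∣ : Coprime a b → a ∣ c → b ∣ c → a * b ∣ c
  coprime-*-∣ {a} {b} cop (divides q refl) b∣c =
    subst (_∣ q * a) (*-comm b a) (*-monoˡ-∣ a (coprime-divisor {b} {a} (λ (x , y) → cop (y , x)) (subst (b ∣_) (*-comm q a) b∣c)))

  prime-power-part : Prime p → 1 ≤ n → ∃₂ λ i s → n ≡ p ^ i * s × ¬ p ∣ s
  prime-power-part {p} pr = <-rec (λ n → 1 ≤ n → ∃₂ λ i s → n ≡ p ^ i * s × ¬ p ∣ s) go _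
    where
    go : ∀ n → (∀ {m} → m < n → 1 ≤ m → _) → 1 ≤ n → _
    go n rec 1≤n with p ∣? n
    ... | no p∤n = 0 , n , sym (+-identityʳ n) , p∤n
    ... | yes (divides q refl) with rec {q} (m<m*n q p {{>-nonZero (*-pos⁻¹ˡ 1≤n)}} (prime≥2 pr)) (*-pos⁻¹ˡ 1≤n)
    ...   | i , s , q≡ , p∤s = suc i , s , trans (cong (_* p) q≡) (swap (p ^ i) s p) , p∤s
      where
      swap : ∀ x s p → x * s * p ≡ p * x * s
      swap = solve-∀

  ^-∣-unit : Prime p → ¬ p ∣ s → s ∣ p ^ k → s ≡ 1
  ^-∣-unit {k = k} pr p∤s s∣ = prime^-coprime pr p∤s k (s∣ , ∣-refl)

  ^-∣-exponent : Prime p → ¬ p ∣ s → p ^ e ∣ p ^ k * s → e ≤ k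
  ^-∣-exponent {e = zero} pr p∤s h = z≤n
  ^-∣-exponent {p} {s} {suc e} {zero} pr p∤s h =
    contradiction (∣-trans (m∣m*n (p ^ e)) (subst (p ^ suc e ∣_) (+-identityʳ s) h)) p∤s
  ^-∣-exponent {p} {s} {suc e} {suc k} pr p∤s h =
    s≤s (^-∣-exponent {e = e} pr p∤s (*-cancelˡ-∣ p {{prime⇒nonZero pr}} (subst (p * p ^ e ∣_) (*-assoc p (p ^ k) s) h)))

  ∣-^ : Prime p → d ∣ p ^ k → ∃ λ i → d ≡ p ^ i × i ≤ k
  ∣-^ {p} {zero} {k} pr d∣ = contradiction (0∣⇒≡0 d∣) (m<n⇒n≢0 (^-pos (≤-trans (s≤s z≤n) (prime≥2 pr)) k))
  ∣-^ {p} {suc d} {k} pr d∣ with prime-power-part {p} {suc d} pr (s≤s z≤n)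
  ... | i , s , d≡ , p∤s with ^-∣-unit {k = k} pr p∤s (∣-trans (divides (p ^ i) d≡) d∣)
  ...   | refl = i , trans d≡ (*-identityʳ _) ,
    ^-∣-exponent {e = i} {k} pr p∤s (∣-trans (divides 1 (trans d≡ (*-comm (p ^ i) 1))) (subst (suc d ∣_) (sym (*-identityʳ _)) d∣))

  ∣-^-full : Prime p → d ∣ p ^ suc e → ¬ d ∣ p ^ e → d ≡ p ^ suc e
  ∣-^-full {p} {d} {e} pr d∣ d∤ with ∣-^ {k = suc e} pr d∣
  ... | i , refl , i≤1+e with m≤n⇒m<n∨m≡n i≤1+e
  ...   | inj₁ (s≤s i≤e) = contradiction (^-mono-∣ p i≤e) d∤
  ...   | inj₂ refl = refl

  -- s t ≡ 1 (mod q), with both sides moved so that no subtraction occurs.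
  modular-inverse : 1 ≤ q → Coprime s q → ∃ λ t → ∃₂ λ k l → s * t + q * k ≡ 1 + q * l
  modular-inverse {suc q} {s} _ cop with coprime-Bézout cop
  ... | Bézout.+- x y eq = x , 0 , y , (begin
    s * x + suc q * 0   ≡⟨ lemma s x q ⟩
    x * s               ≡⟨ eq ⟨
    1 + y * suc q       ≡⟨ cong suc (*-comm y (suc q)) ⟩
    1 + suc q * y       ∎)
    where
    open ≡-Reasoning
    lemma : ∀ s x q → s * x + suc q * 0 ≡ x * s
    lemma = solve-∀
  -- Here `x * s` is -1 modulo `suc q`; since `q` is -1 as well, `x * q` is an inverse, and no
  -- negative number occurs.
  ... | Bézout.-+ x y eq = x * q , 1 , y * q , (begin
    s * (x * q) + suc q * 1 ≡⟨ lemma s x q ⟩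
    1 + (1 + x * s) * q     ≡⟨ cong (λ z → 1 + z * q) eq ⟩
    1 + y * suc q * q       ≡⟨ lemma′ y q ⟩
    1 + suc q * (y * q)     ∎)
    where
    open ≡-Reasoning
    lemma : ∀ s x q → s * (x * q) + suc q * 1 ≡ 1 + (1 + x * s) * q
    lemma = solve-∀
    lemma′ : ∀ y q → 1 + y * suc q * q ≡ 1 + suc q * (y * q)
    lemma′ = solve-∀

  prime-divisor : 2 ≤ n → ∃ λ p → Prime p × p ∣ n
  prime-divisor {suc zero} (s≤s ())
  prime-divisor {suc (suc n)} _ with factorise (suc (suc n))
  ... | record { factors = [] ; isFactorisation = () }
  ... | record { factors = p ∷ ps ; isFactorisation = eq ; factorsPrime = pr ∷ _ } =
    p , pr , divides (product ps) (trans eq (*-comm p _))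

  greatest : {P : ℕ → Set} → Decidable P → ∀ b → (∀ k → P k → k ≤ b) → ∃ P → ∃ λ k → P k × (∀ j → P j → j ≤ k)
  greatest P? b bound ∃P with P? b
  ... | yes pb = b , pb , bound
  greatest P? zero bound (k , pk) | no ¬p0 with bound k pk
  ... | z≤n = contradiction pk ¬p0
  greatest {P} P? (suc b) bound ∃P | no ¬pb = greatest P? b bound′ ∃P
    where
    bound′ : ∀ k → P k → k ≤ b
    bound′ k pk with m≤n⇒m<n∨m≡n (bound k pk)
    ... | inj₁ (s≤s k≤b) = k≤b
    ... | inj₂ refl = contradiction pk ¬pb

  greatest-prime-divisor : 2 ≤ n → ∃ λ p → (Prime p × p ∣ n) × (∀ q → Prime q × q ∣ n → q ≤ p)
  greatest-prime-divisor {n} 2≤n =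
    greatest (λ p → prime? p ×-dec (p ∣? n)) n
      (λ p (_ , p∣n) → ∣⇒≤ {{>-nonZero (≤-trans (s≤s z≤n) 2≤n)}} p∣n) (prime-divisor 2≤n)

  least : {P : ℕ → Set} → Decidable P → ∀ b → P b → ∃ λ k → P k × (∀ j → P j → k ≤ j)
  least {P} P? = <-rec (λ b → P b → ∃ λ k → P k × (∀ j → P j → k ≤ j)) go
    where
    go : ∀ b → (∀ {c} → c < b → P c → ∃ λ k → P k × (∀ j → P j → k ≤ j)) → P b → _
    go b rec pb with anyUpTo? P? b
    ... | yes (c , c<b , pc) = rec c<b pc
    ... | no none = b , pb , λ j pj → ≮⇒≥ λ j<b → none (j , j<b , pj)

  -- A common prime divisor `l` would satisfy `l < p` as a divisor of `pred p` and `p ≤ l` as a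
  -- divisor of `s`.
  pred-coprime : Prime p → (∀ l → Prime l → l ∣ s → p ≤ l) → 1 ≤ s → Coprime (pred p) s
  pred-coprime {p} {s} pr large 1≤s {i} (i∣ , i∣s) with 2 ≤? i
  ... | no i<2 = i≡1 (≮⇒≥ i<2) i∣s
    where
    i≡1 : ∀ {i} → i ≤ 1 → i ∣ s → i ≡ 1
    i≡1 {zero} _ 0∣s = contradiction (0∣⇒≡0 0∣s) (m<n⇒n≢0 1≤s)
    i≡1 {suc zero} _ _ = refl
    i≡1 {suc (suc i)} (s≤s ()) _
  ... | yes 2≤i with prime-divisor 2≤i
  ...   | l , prl , l∣i = contradiction (large l prl (∣-trans l∣i i∣s)) (<⇒≱ (l<p (prime≥2 pr) (∣-trans l∣i i∣)))
    where
    l<p : ∀ {p} → 2 ≤ p → l ∣ pred p → l < p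
    l<p {suc (suc p)} _ l∣ = s≤s (∣⇒≤ l∣)
    l<p {suc zero} (s≤s ()) _

  coprime-* : Coprime a c → Coprime b c → Coprime (a * b) c
  coprime-* a⊥c b⊥c {i} (i∣ab , i∣c) =
    b⊥c (coprime-divisor (λ (j∣i , j∣a) → a⊥c (j∣a , ∣-trans j∣i i∣c)) i∣ab , i∣c)

open Arithmetic

-- Groups on Fin n

record FinGroup (n : ℕ) : Set where
  infixl 7 _∙_
  field
    _∙_     : Fin n → Fin n → Fin n
    ε       : Fin n
    _⁻¹     : Fin n → Fin n
    isGroup : IsGroup _≡_ _∙_ ε _⁻¹

  group : Group _ _
  group = record { isGroup = isGroup }

  open IsGroup isGroup public using (assoc; identityˡ; identityʳ; inverseˡ; inverseʳ)

module GroupTheory {n : ℕ} (G : FinGroup n) where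
  open FinGroup G public using (_∙_; ε; _⁻¹; assoc; identityˡ; identityʳ; inverseˡ; inverseʳ)
  open Algebra.Properties.Group (FinGroup.group G) public
    using (∙-cancelˡ; ∙-cancelʳ; ⁻¹-involutive; ⁻¹-anti-homo-∙; ε⁻¹≈ε; inverseʳ-unique; \\-leftDividesʳ; \\-leftDividesˡ; //-rightDividesʳ; //-rightDividesˡ)
  open Algebra.Properties.Monoid.Mult (Group.monoid (FinGroup.group G)) public
    using () renaming (×-homo-+ to ↑-homo-+; ×-assocˡ to ↑-assocˡ)
  open Algebra.Properties.Monoid.Mult (Group.monoid (FinGroup.group G)) using () renaming (_×_ to _times_)

  infixr 8 _↑_
  opaque
    _↑_ : Fin n → ℕ → Fin n
    x ↑ k = k times x

  Commute : Fin n → Fin n → Set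
  Commute x y = x ∙ y ≡ y ∙ x

  1≤n : 1 ≤ n
  1≤n = ≤-trans (s≤s z≤n) (toℕ<n ε)

  opaque
    unfolding _↑_

    ↑-zero : ∀ x → x ↑ 0 ≡ ε
    ↑-zero x = refl

    ↑-suc : ∀ x k → x ↑ suc k ≡ x ∙ x ↑ k
    ↑-suc x k = refl

    ↑-+ : ∀ x i j → x ↑ (i + j) ≡ x ↑ i ∙ x ↑ j
    ↑-+ = ↑-homo-+

    ↑-* : ∀ x i j → (x ↑ i) ↑ j ≡ x ↑ (i * j)
    ↑-* x i j = trans (↑-assocˡ x j i) (cong (x ↑_) (*-comm j i))

    ↑-1 : ∀ x → x ↑ 1 ≡ x
    ↑-1 = identityʳ

  ε↑ : ∀ k → ε ↑ k ≡ ε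
  ε↑ zero = ↑-zero ε
  ε↑ (suc k) = trans (↑-suc ε k) (trans (identityˡ _) (ε↑ k))

  open ≡-Reasoning

  commute-∙ : ∀ {x y z} → Commute x y → Commute x z → Commute x (y ∙ z)
  commute-∙ {x} {y} {z} xy xz = begin
    x ∙ (y ∙ z) ≡⟨ assoc x y z ⟨
    x ∙ y ∙ z   ≡⟨ cong (_∙ z) xy ⟩
    y ∙ x ∙ z   ≡⟨ assoc y x z ⟩
    y ∙ (x ∙ z) ≡⟨ cong (y ∙_) xz ⟩
    y ∙ (z ∙ x) ≡⟨ assoc y z x ⟨
    y ∙ z ∙ x   ∎

  commute-ε : ∀ {x} → Commute x ε
  commute-ε = trans (identityʳ _) (sym (identityˡ _))

  commute-⁻¹ : ∀ {x y} → Commute x y → Commute x (y ⁻¹)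
  commute-⁻¹ {x} {y} xy = ∙-cancelˡ y _ _ (begin
    y ∙ (x ∙ y ⁻¹) ≡⟨ assoc y x (y ⁻¹) ⟨
    y ∙ x ∙ y ⁻¹   ≡⟨ cong (_∙ y ⁻¹) xy ⟨
    x ∙ y ∙ y ⁻¹   ≡⟨ //-rightDividesʳ y x ⟩
    x              ≡⟨ \\-leftDividesˡ y x ⟨
    y ∙ (y ⁻¹ ∙ x) ∎)

  commute-↑ : ∀ {x y} → Commute x y → ∀ k → Commute x (y ↑ k)
  commute-↑ {x} {y} xy zero = subst (Commute x) (sym (↑-zero y)) commute-ε
  commute-↑ {x} {y} xy (suc k) = subst (Commute x) (sym (↑-suc y k)) (commute-∙ xy (commute-↑ xy k))

  commute-↑↑ : ∀ x i j → Commute (x ↑ i) (x ↑ j)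
  commute-↑↑ x i j = trans (sym (↑-+ x i j)) (trans (cong (x ↑_) (+-comm i j)) (↑-+ x j i))

  ∙-↑ : ∀ {x y} → Commute x y → ∀ k → (x ∙ y) ↑ k ≡ x ↑ k ∙ y ↑ k
  ∙-↑ {x} {y} xy zero = trans (↑-zero _) (sym (trans (cong₂ _∙_ (↑-zero x) (↑-zero y)) (identityˡ ε)))
  ∙-↑ {x} {y} xy (suc k) = begin
    (x ∙ y) ↑ suc k           ≡⟨ ↑-suc _ k ⟩
    x ∙ y ∙ (x ∙ y) ↑ k       ≡⟨ cong (x ∙ y ∙_) (∙-↑ xy k) ⟩
    x ∙ y ∙ (x ↑ k ∙ y ↑ k)   ≡⟨ assoc (x ∙ y) (x ↑ k) (y ↑ k) ⟨
    x ∙ y ∙ x ↑ k ∙ y ↑ k     ≡⟨ cong (_∙ y ↑ k) (assoc x y (x ↑ k)) ⟩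
    x ∙ (y ∙ x ↑ k) ∙ y ↑ k   ≡⟨ cong (λ z → x ∙ z ∙ y ↑ k) (commute-↑ (sym xy) k) ⟩
    x ∙ (x ↑ k ∙ y) ∙ y ↑ k   ≡⟨ cong (_∙ y ↑ k) (assoc x (x ↑ k) y) ⟨
    x ∙ x ↑ k ∙ y ∙ y ↑ k     ≡⟨ assoc (x ∙ x ↑ k) y (y ↑ k) ⟩
    x ∙ x ↑ k ∙ (y ∙ y ↑ k)   ≡⟨ cong₂ _∙_ (↑-suc x k) (↑-suc y k) ⟨
    x ↑ suc k ∙ y ↑ suc k     ∎

  infixl 7 _◃_
  _◃_ : Fin n → Fin n → Fin n
  g ◃ x = g ∙ x ∙ g ⁻¹

  ◃-∙ : ∀ g x y → g ◃ (x ∙ y) ≡ g ◃ x ∙ (g ◃ y)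
  ◃-∙ g x y = begin
    g ∙ (x ∙ y) ∙ g ⁻¹              ≡⟨ cong (_∙ g ⁻¹) (assoc g x y) ⟨
    g ∙ x ∙ y ∙ g ⁻¹                ≡⟨ assoc (g ∙ x) y (g ⁻¹) ⟩
    g ∙ x ∙ (y ∙ g ⁻¹)              ≡⟨ cong (λ z → g ∙ x ∙ z) (\\-leftDividesʳ g (y ∙ g ⁻¹)) ⟨
    g ∙ x ∙ (g ⁻¹ ∙ (g ∙ (y ∙ g ⁻¹))) ≡⟨ assoc (g ∙ x) (g ⁻¹) _ ⟨
    g ∙ x ∙ g ⁻¹ ∙ (g ∙ (y ∙ g ⁻¹)) ≡⟨ cong (g ∙ x ∙ g ⁻¹ ∙_) (assoc g y (g ⁻¹)) ⟨
    g ∙ x ∙ g ⁻¹ ∙ (g ∙ y ∙ g ⁻¹)   ∎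

  ◃-ε : ∀ g → g ◃ ε ≡ ε
  ◃-ε g = trans (cong (_∙ g ⁻¹) (identityʳ g)) (inverseʳ g)

  ◃-↑ : ∀ g x k → (g ◃ x) ↑ k ≡ g ◃ (x ↑ k)
  ◃-↑ g x zero = trans (↑-zero _) (sym (trans (cong (g ◃_) (↑-zero x)) (◃-ε g)))
  ◃-↑ g x (suc k) = begin
    (g ◃ x) ↑ suc k       ≡⟨ ↑-suc _ k ⟩
    g ◃ x ∙ (g ◃ x) ↑ k   ≡⟨ cong (g ◃ x ∙_) (◃-↑ g x k) ⟩
    g ◃ x ∙ (g ◃ (x ↑ k)) ≡⟨ ◃-∙ g x (x ↑ k) ⟨
    g ◃ (x ∙ x ↑ k)       ≡⟨ cong (g ◃_) (↑-suc x k) ⟨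
    g ◃ (x ↑ suc k)       ∎

  ◃-◃ : ∀ g h x → g ◃ (h ◃ x) ≡ (g ∙ h) ◃ x
  ◃-◃ g h x = begin
    g ∙ (h ∙ x ∙ h ⁻¹) ∙ g ⁻¹   ≡⟨ cong (_∙ g ⁻¹) (assoc g (h ∙ x) (h ⁻¹)) ⟨
    g ∙ (h ∙ x) ∙ h ⁻¹ ∙ g ⁻¹   ≡⟨ assoc _ (h ⁻¹) (g ⁻¹) ⟩
    g ∙ (h ∙ x) ∙ (h ⁻¹ ∙ g ⁻¹) ≡⟨ cong₂ _∙_ (assoc g h x) (⁻¹-anti-homo-∙ g h) ⟨
    g ∙ h ∙ x ∙ (g ∙ h) ⁻¹      ∎

  ε-◃ : ∀ x → ε ◃ x ≡ x
  ε-◃ x = trans (cong₂ _∙_ (identityˡ x) ε⁻¹≈ε) (identityʳ x)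

  ⁻¹-◃ : ∀ g {x y} → g ◃ x ≡ y → g ⁻¹ ◃ y ≡ x
  ⁻¹-◃ g {x} refl = trans (◃-◃ (g ⁻¹) g x) (trans (cong (_◃ x) (inverseˡ g)) (ε-◃ x))

  ◃-⁻¹ : ∀ g x → g ◃ (g ⁻¹ ◃ x) ≡ x
  ◃-⁻¹ g x = trans (◃-◃ g (g ⁻¹) x) (trans (cong (_◃ x) (inverseʳ g)) (ε-◃ x))

  ◃⇒commute : ∀ {g x} → g ◃ x ≡ x → Commute g x
  ◃⇒commute {g} {x} eq = trans (sym (//-rightDividesˡ g (g ∙ x))) (cong (_∙ g) eq)

  commute⇒◃ : ∀ {g x} → Commute g x → g ◃ x ≡ x
  commute⇒◃ {g} {x} eq = trans (cong (_∙ g ⁻¹) eq) (//-rightDividesʳ g x)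

  -- Characterising the order by divisibility instead of minimality makes its uniqueness the
  -- antisymmetry of `∣` and lets orders be compared arithmetically.
  HasOrder : Fin n → ℕ → Set
  HasOrder x o = x ↑ o ≡ ε × (∀ k → x ↑ k ≡ ε → o ∣ k)

  ↑-∣ : ∀ {x o k} → x ↑ o ≡ ε → o ∣ k → x ↑ k ≡ ε
  ↑-∣ {x} {o} xo (divides q refl) = begin
    x ↑ (q * o)   ≡⟨ cong (x ↑_) (*-comm q o) ⟩
    x ↑ (o * q)   ≡⟨ ↑-* x o q ⟨
    (x ↑ o) ↑ q   ≡⟨ cong (_↑ q) xo ⟩
    ε ↑ q         ≡⟨ ε↑ q ⟩
    ε             ∎

  ↑-diff : ∀ x {i j} → i ≤ j → x ↑ i ≡ x ↑ j → x ↑ (j ∸ i) ≡ ε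
  ↑-diff x {i} {j} i≤j eq = ∙-cancelˡ (x ↑ i) _ _ (begin
    x ↑ i ∙ x ↑ (j ∸ i) ≡⟨ ↑-+ x i (j ∸ i) ⟨
    x ↑ (i + (j ∸ i))   ≡⟨ cong (x ↑_) (m+[n∸m]≡n i≤j) ⟩
    x ↑ j               ≡⟨ eq ⟨
    x ↑ i               ≡⟨ identityʳ _ ⟨
    x ↑ i ∙ ε           ∎)

  ↑-% : ∀ {x o} .{{_ : NonZero o}} → x ↑ o ≡ ε → ∀ k → x ↑ (k % o) ≡ x ↑ k
  ↑-% {x} {o} xo k = begin
    x ↑ (k % o)                     ≡⟨ identityʳ _ ⟨
    x ↑ (k % o) ∙ ε                 ≡⟨ cong (x ↑ (k % o) ∙_) (↑-∣ xo (n∣m*n (k / o))) ⟨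
    x ↑ (k % o) ∙ x ↑ (k / o * o)   ≡⟨ ↑-+ x (k % o) _ ⟨
    x ↑ (k % o + k / o * o)         ≡⟨ cong (x ↑_) (m≡m%n+[m/n]*n k o) ⟨
    x ↑ k                           ∎

  opaque
    order : ∀ x → ∃ λ o → 1 ≤ o × HasOrder x o
    -- Two of `n + 1` powers coincide, which bounds the search for the least positive period; any
    -- other period leaves a remainder that is again a period, hence zero.
    order x with pigeonhole (n<1+n n) (λ j → x ↑ toℕ j)
    ... | i , j , i<j , eq with least {P = λ k → x ↑ suc k ≡ ε} (λ k → x ↑ suc k ≟ᶠ ε) (pred (toℕ j ∸ toℕ i)) period
      where
      period : x ↑ suc (pred (toℕ j ∸ toℕ i)) ≡ ε
      period = trans (cong (x ↑_) (suc-pred _ {{>-nonZero (m<n⇒0<n∸m i<j)}})) (↑-diff x (<⇒≤ i<j) eq)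
    ...   | o , xo , minimal = suc o , s≤s z≤n , xo , divisor
      where
      divisor : ∀ k → x ↑ k ≡ ε → suc o ∣ k
      divisor k xk = m%n≡0⇒n∣m k (suc o) (zero? (k % suc o) (m%n<n k (suc o)) (trans (↑-% xo k) xk))
        where
        zero? : ∀ r → r < suc o → x ↑ r ≡ ε → r ≡ 0
        zero? zero _ _ = refl
        zero? (suc r) (s≤s r<o) xr = contradiction (minimal r xr) (<⇒≱ r<o)

  ord : Fin n → ℕ
  ord x = proj₁ (order x)

  1≤ord : ∀ x → 1 ≤ ord x
  1≤ord x = proj₁ (proj₂ (order x))

  ord-order : ∀ x → HasOrder x (ord x)
  ord-order x = proj₂ (proj₂ (order x))

  order-unique : ∀ {x o o′} → HasOrder x o → HasOrder x o′ → o ≡ o′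
  order-unique (xo , min) (xo′ , min′) = ∣-antisym (min _ xo′) (min′ _ xo)

  order-injective : ∀ {x o i j} → HasOrder x o → i < o → j < o → x ↑ i ≡ x ↑ j → i ≡ j
  order-injective {x} {o} {i} {j} (_ , min) i<o j<o eq = by-cases (≤-total i j)
    where
    ordered : ∀ {i j} → i ≤ j → j < o → x ↑ i ≡ x ↑ j → i ≡ j
    ordered {i} {j} i≤j j<o eq with j ∸ i in j∸i | min (j ∸ i) (↑-diff x i≤j eq)
    ... | zero  | _ = ≤-antisym i≤j (m∸n≡0⇒m≤n j∸i)
    ... | suc r | d = contradiction (≤-trans (∣⇒≤ d) (subst (_≤ j) j∸i (m∸n≤m j i))) (<⇒≱ j<o)
    by-cases : i ≤ j ⊎ j ≤ i → i ≡ j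
    by-cases (inj₁ i≤j) = ordered i≤j j<o eq
    by-cases (inj₂ j≤i) = sym (ordered j≤i i<o (sym eq))

  ↑-gcd : ∀ {x} i j → x ↑ i ≡ ε → x ↑ j ≡ ε → x ↑ gcd i j ≡ ε
  ↑-gcd {x} i j xi xj with order x
  ... | o , _ , xo , min = ↑-∣ xo (gcd-greatest (min i xi) (min j xj))

  order-↑ : ∀ {x} a c → 1 ≤ a → HasOrder x (a * c) → HasOrder (x ↑ a) c
  order-↑ {x} a c 1≤a (xac , min) = trans (↑-* x a c) xac ,
    λ k e → *-cancelˡ-∣ a {{>-nonZero 1≤a}} (min (a * k) (trans (sym (↑-* x a k)) e))

  -- If `(x ∙ y) ↑ k` is trivial, the `b`-th power removes `y` and gives `a ∣ k * b`, hence `a ∣ k`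
  -- by coprimality; symmetrically for `b`.
  order-∙ : ∀ {x y a b} → Commute x y → Coprime a b → HasOrder x a → HasOrder y b → HasOrder (x ∙ y) (a * b)
  order-∙ {x} {y} {a} {b} xy a⊥b (xa , xmin) (yb , ymin) = xyab , λ k e →
      coprime-*-∣ a⊥b
        (coprime-divisor a⊥b (subst (a ∣_) (*-comm k b) (xmin (k * b) (begin
          x ↑ (k * b)               ≡⟨ identityʳ _ ⟨
          x ↑ (k * b) ∙ ε           ≡⟨ cong (x ↑ (k * b) ∙_) (↑-∣ yb (n∣m*n k)) ⟨
          x ↑ (k * b) ∙ y ↑ (k * b) ≡⟨ ∙-↑ xy (k * b) ⟨
          (x ∙ y) ↑ (k * b)         ≡⟨ ↑-∣ e (m∣m*n b) ⟩
          ε                         ∎))))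
        (coprime-divisor (λ (p , q) → a⊥b (q , p)) (subst (b ∣_) (*-comm k a) (ymin (k * a) (begin
          y ↑ (k * a)               ≡⟨ identityˡ _ ⟨
          ε ∙ y ↑ (k * a)           ≡⟨ cong (_∙ y ↑ (k * a)) (↑-∣ xa (n∣m*n k)) ⟨
          x ↑ (k * a) ∙ y ↑ (k * a) ≡⟨ ∙-↑ xy (k * a) ⟨
          (x ∙ y) ↑ (k * a)         ≡⟨ ↑-∣ e (m∣m*n a) ⟩
          ε                         ∎))))
    where
    xyab : (x ∙ y) ↑ (a * b) ≡ ε
    xyab = trans (∙-↑ xy (a * b)) (trans (cong₂ _∙_ (↑-∣ xa (m∣m*n b)) (↑-∣ yb (n∣m*n a))) (identityˡ ε))

  order-prime-power : ∀ {x p e} → Prime p → x ↑ (p ^ suc e) ≡ ε → x ↑ (p ^ e) ≢ ε → HasOrder x (p ^ suc e)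
  order-prime-power {x} {p} {e} pr xpe+ xpe≢ with order x
  ... | o , _ , xo , min = subst (HasOrder x) (∣-^-full {e = e} pr (min _ xpe+) (λ o∣ → xpe≢ (↑-∣ xo o∣))) (xo , min)

  record Subgroup : Set₁ where
    field
      Mem  : Fin n → Set
      mem? : Decidable Mem
      ε∈   : Mem ε
      ∙∈   : ∀ {x y} → Mem x → Mem y → Mem (x ∙ y)
      ⁻¹∈  : ∀ {x} → Mem x → Mem (x ⁻¹)

    size : ℕ
    size = count mem?

    ↑∈ : ∀ {x} → Mem x → ∀ k → Mem (x ↑ k)
    ↑∈ x∈ zero = subst Mem (sym (↑-zero _)) ε∈
    ↑∈ x∈ (suc k) = subst Mem (sym (↑-suc _ k)) (∙∈ x∈ (↑∈ x∈ k))

    1≤size : 1 ≤ size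
    1≤size = count-pos mem? ε∈

  open Subgroup public using (Mem; mem?; size; 1≤size)

  translate-count : {P Q : Fin n → Set} (P? : Decidable P) (Q? : Decidable Q) (g : Fin n) →
    (∀ x → P x → Q (g ∙ x)) → (∀ x → Q x → P (g ⁻¹ ∙ x)) → count P? ≡ count Q?
  translate-count P? Q? g to from = count-bijection P? Q? (g ∙_) (g ⁻¹ ∙_) to from
    (λ x _ → \\-leftDividesʳ g x) (λ x _ → \\-leftDividesˡ g x)

  coset-count : (A : Subgroup) {Q : Fin n → Set} (Q? : Decidable Q) (g : Fin n) →
    (∀ {a} → Mem A a → Q (g ∙ a)) → (∀ {x} → Q x → Mem A (g ⁻¹ ∙ x)) → count Q? ≡ size A
  coset-count A Q? g to from = sym (translate-count (mem? A) Q? g (λ _ → to) (λ _ → from))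

  coset-sym : (A : Subgroup) → ∀ {x y} → Mem A (x ⁻¹ ∙ y) → Mem A (y ⁻¹ ∙ x)
  coset-sym A {x} {y} h = subst (Mem A) (trans (⁻¹-anti-homo-∙ (x ⁻¹) y) (cong (y ⁻¹ ∙_) (⁻¹-involutive x))) (⁻¹∈ h)
    where open Subgroup A using (⁻¹∈)

  coset-trans : (A : Subgroup) → ∀ {x y z} → Mem A (x ⁻¹ ∙ y) → Mem A (y ⁻¹ ∙ z) → Mem A (x ⁻¹ ∙ z)
  coset-trans A {x} {y} {z} h k = subst (Mem A) (begin
    x ⁻¹ ∙ y ∙ (y ⁻¹ ∙ z)   ≡⟨ assoc (x ⁻¹) y _ ⟩
    x ⁻¹ ∙ (y ∙ (y ⁻¹ ∙ z)) ≡⟨ cong (x ⁻¹ ∙_) (\\-leftDividesˡ y z) ⟩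
    x ⁻¹ ∙ z                ∎) (∙∈ h k)
    where open Subgroup A using (∙∈)

  coset-refl : (A : Subgroup) → ∀ x → Mem A (x ⁻¹ ∙ x)
  coset-refl A x = subst (Mem A) (sym (inverseˡ x)) ε∈
    where open Subgroup A using (ε∈)

  lagrange : (A B : Subgroup) → (∀ {x} → Mem A x → Mem B x) → size A ∣ size B
  lagrange A B A⊆B = partition-∣ (mem? B) (λ x y → mem? A (x ⁻¹ ∙ y)) (size A)
    (λ x _ → coset-refl A x) (λ _ _ _ _ → coset-sym A) (λ _ _ _ _ _ _ → coset-trans A)
    λ x x∈ → ∣-reflexive (sym (coset-count A _ x
      (λ a∈ → ∙∈ x∈ (A⊆B a∈) , subst (Mem A) (sym (\\-leftDividesʳ x _)) a∈) proj₂))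
    where open Subgroup B using (∙∈)

  whole : Subgroup
  whole = record { Mem = λ _ → ⊤ ; mem? = λ _ → yes tt ; ε∈ = tt ; ∙∈ = λ _ _ → tt ; ⁻¹∈ = λ _ → tt }

  size-whole : size whole ≡ n
  size-whole = count-all (mem? whole) λ _ → tt

  lagrange-whole : (A : Subgroup) → size A ∣ n
  lagrange-whole A = subst (size A ∣_) size-whole (lagrange A whole λ _ → tt)

  trivial : Subgroup
  trivial = record
    { Mem = _≡ ε ; mem? = _≟ᶠ ε ; ε∈ = refl
    ; ∙∈ = λ x y → trans (cong₂ _∙_ x y) (identityˡ ε) ; ⁻¹∈ = λ x → trans (cong _⁻¹ x) ε⁻¹≈ε }

  size-trivial : size trivial ≡ 1
  size-trivial = count-unique (mem? trivial) refl λ _ → sym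

  module _ {x : Fin n} where
    private
      instance
        _ = >-nonZero (1≤ord x)

    ⟪⟫-intro : ∀ k → ∃ λ (i : Fin (ord x)) → x ↑ toℕ i ≡ x ↑ k
    ⟪⟫-intro k = fromℕ< (m%n<n k (ord x)) ,
      trans (cong (x ↑_) (toℕ-fromℕ< (m%n<n k (ord x)))) (↑-% (proj₁ (ord-order x)) k)

    -- Inverses are themselves natural powers, so cyclic subgroups need no negative exponents.
    ↑-inverse : ∀ k → (x ↑ k) ⁻¹ ≡ x ↑ (k * pred (ord x))
    ↑-inverse k = sym (inverseʳ-unique _ _ (begin
      x ↑ k ∙ x ↑ (k * pred (ord x)) ≡⟨ ↑-+ x k _ ⟨
      x ↑ (k + k * pred (ord x))     ≡⟨ cong (x ↑_) (*-suc k (pred (ord x))) ⟨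
      x ↑ (k * suc (pred (ord x)))   ≡⟨ cong (λ o → x ↑ (k * o)) (suc-pred (ord x)) ⟩
      x ↑ (k * ord x)                ≡⟨ ↑-∣ (proj₁ (ord-order x)) (n∣m*n k) ⟩
      ε                              ∎))

  -- Exponents range below the order so that membership is decided by finite search.
  ⟪_⟫ : Fin n → Subgroup
  ⟪ x ⟫ = record
    { Mem  = λ g → ∃ λ (i : Fin (ord x)) → x ↑ toℕ i ≡ g
    ; mem? = λ g → any? λ i → x ↑ toℕ i ≟ᶠ g
    ; ε∈   = let k , eq = ⟪⟫-intro 0 in k , trans eq (↑-zero x)
    ; ∙∈   = λ { (i , refl) (j , refl) → let k , eq = ⟪⟫-intro (toℕ i + toℕ j) in
                                         k , trans eq (↑-+ x (toℕ i) (toℕ j)) }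
    ; ⁻¹∈  = λ { (i , refl) → let k , eq = ⟪⟫-intro (toℕ i * pred (ord x)) in
                              k , trans eq (sym (↑-inverse (toℕ i))) }
    }

  ↑∈⟪⟫ : ∀ x k → Mem ⟪ x ⟫ (x ↑ k)
  ↑∈⟪⟫ x k = ⟪⟫-intro k

  ∈⟪⟫ : ∀ {x g} → Mem ⟪ x ⟫ g → ∃ λ k → g ≡ x ↑ k
  ∈⟪⟫ (i , eq) = toℕ i , sym eq

  size-⟪⟫ : ∀ {x o} → HasOrder x o → size ⟪ x ⟫ ≡ o
  size-⟪⟫ {x} ho with order-unique (ord-order x) ho
  ... | refl = sym (begin
    ord x                           ≡⟨ count-all U? (λ _ → tt) ⟨
    count U?                        ≡⟨ *-identityʳ _ ⟨
    count U? * 1                    ≡⟨ double-count U? (mem? ⟪ x ⟫) (λ i g → x ↑ toℕ i ≟ᶠ g)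
                                         (λ i g eq → tt , i , eq)
                                         (λ i _ → count-unique (x ↑ toℕ i ≟ᶠ_) refl λ _ eq → eq)
                                         (λ { g (i , refl) → count-unique (λ j → x ↑ toℕ j ≟ᶠ x ↑ toℕ i) {i} refl
                                            λ j eq → toℕ-injective (order-injective ho (toℕ<n i) (toℕ<n j) (sym eq)) }) ⟩
    count (mem? ⟪ x ⟫) * 1          ≡⟨ *-identityʳ _ ⟩
    size ⟪ x ⟫                        ∎)
    where
    U? : Decidable {A = Fin (ord x)} (λ _ → ⊤)
    U? _ = yes tt

  order-∣ : ∀ {x o} → HasOrder x o → o ∣ n
  order-∣ {x} ho = subst (_∣ n) (size-⟪⟫ ho) (lagrange-whole ⟪ x ⟫)

  ↑-n : ∀ x → x ↑ n ≡ ε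
  ↑-n x = ↑-∣ (proj₁ (ord-order x)) (order-∣ (ord-order x))

  ⟪⟫-⊆ : (A : Subgroup) → ∀ {x} → Mem A x → ∀ {g} → Mem ⟪ x ⟫ g → Mem A g
  ⟪⟫-⊆ A x∈ (i , refl) = ↑∈ x∈ (toℕ i)
    where open Subgroup A using (↑∈)

-- Quotients of subgroups, renumbered as finite groups

record Enumeration {n : ℕ} (P : Fin n → Set) : Set where
  field
    cardinality    : ℕ
    to             : ∀ x → P x → Fin cardinality
    from           : Fin cardinality → Fin n
    from∈          : ∀ i → P (from i)
    from-to        : ∀ x (px : P x) → from (to x px) ≡ x
    from-injective : ∀ {i j} → from i ≡ from j → i ≡ j

enumerate : ∀ {n} {P : Fin n → Set} → Decidable P → Enumeration P
enumerate {zero} P? = record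
  { cardinality = 0 ; to = λ () ; from = λ () ; from∈ = λ () ; from-to = λ () ; from-injective = λ { {()} } }
enumerate {suc n} {P} P? with P? zero | enumerate {n} {P ∘ suc} (P? ∘ suc)
... | yes p0 | E = record
  { cardinality    = suc cardinality
  ; to             = λ { zero _ → zero ; (suc x) px → suc (to x px) }
  ; from           = λ { zero → zero ; (suc i) → suc (from i) }
  ; from∈          = λ { zero → p0 ; (suc i) → from∈ i }
  ; from-to        = λ { zero _ → refl ; (suc x) px → cong suc (from-to x px) }
  ; from-injective = λ { {zero} {zero} _ → refl ; {suc i} {suc j} eq → cong suc (from-injective (sucᶠ-injective eq)) }
  }
  where open Enumeration E
... | no ¬p0 | E = record
  { cardinality    = cardinality
  ; to             = λ { zero p0 → contradiction p0 ¬p0 ; (suc x) px → to x px }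
  ; from           = suc ∘ from
  ; from∈          = from∈
  ; from-to        = λ { zero p0 → contradiction p0 ¬p0 ; (suc x) px → cong suc (from-to x px) }
  ; from-injective = from-injective ∘ sucᶠ-injective
  }
  where open Enumeration E

module Representatives {n : ℕ} (R : Fin n → Fin n → Set) (R? : ∀ x y → Dec (R x y))
  (R-refl : ∀ x → R x x) (R-sym : ∀ {x y} → R x y → R y x) (R-trans : ∀ {x y z} → R x y → R y z → R x z) where

  opaque
    -- Taking the least related element makes the choice depend on the class alone, so that cosets
    -- can be compared by propositional equality.
    least-related : ∀ x → ∃ λ r → R x r × (∀ y → R x y → toℕ r ≤ toℕ y)
    least-related x with least {P = λ k → ∃ λ y → toℕ y ≡ k × R x y} (λ k → any? λ y → toℕ y ≟ⁿ k ×-dec R? x y)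
                               (toℕ x) (x , refl , R-refl x)
    ... | _ , (r , refl , xr) , minimal = r , xr , λ y xy → minimal (toℕ y) (y , refl , xy)

  rep : Fin n → Fin n
  rep x = proj₁ (least-related x)

  rep-related : ∀ x → R x (rep x)
  rep-related x = proj₁ (proj₂ (least-related x))

  rep-cong : ∀ {x y} → R x y → rep x ≡ rep y
  rep-cong {x} {y} xy = toℕ-injective (≤-antisym
    (proj₂ (proj₂ (least-related x)) (rep y) (R-trans xy (rep-related y)))
    (proj₂ (proj₂ (least-related y)) (rep x) (R-trans (R-sym xy) (rep-related x))))

module _ {n : ℕ} (G : FinGroup n) where
  open GroupTheory G

  -- The quotient C / N, renumbered as a group on an initial segment; π is
  -- meaningful on C only.
  record Section (C N : Subgroup) : Set where
    field
      index  : ℕ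
      H      : FinGroup index
    open FinGroup H using () renaming (_∙_ to _∙ᴴ_)
    field
      π      : Fin n → Fin index
      ι      : Fin index → Fin n
      ι∈     : ∀ h → Mem C (ι h)
      π-ι    : ∀ h → π (ι h) ≡ h
      π-∙    : ∀ {x y} → Mem C x → Mem C y → π (x ∙ y) ≡ π x ∙ᴴ π y
      π-≡⇒   : ∀ {x y} → Mem C x → Mem C y → π x ≡ π y → Mem N (x ⁻¹ ∙ y)
      π-≡⇐   : ∀ {x y} → Mem C x → Mem C y → Mem N (x ⁻¹ ∙ y) → π x ≡ π y

  module _ (C N : Subgroup) (N⊆C : ∀ {x} → Mem N x → Mem C x)
           (N⊲C : ∀ {c x} → Mem C c → Mem N x → Mem N (c ◃ x)) where
    private
      module C = Subgroup C
      module N = Subgroup N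
      open Representatives (λ x y → Mem N (x ⁻¹ ∙ y)) (λ x y → mem? N (x ⁻¹ ∙ y))
             (coset-refl N) (coset-sym N) (coset-trans N)

      coset⇒C : ∀ {x y} → C.Mem x → N.Mem (x ⁻¹ ∙ y) → C.Mem y
      coset⇒C {x} {y} x∈ h = subst C.Mem (\\-leftDividesˡ x y) (C.∙∈ x∈ (N⊆C h))

      cosets : Enumeration (λ x → Mem C x × rep x ≡ x)
      cosets = enumerate λ x → mem? C x ×-dec (rep x ≟ᶠ x)
      open Enumeration cosets using (cardinality; from; from∈; from-injective; from-to) renaming (to to toE)

      π : Fin n → Fin cardinality
      π∈ : ∀ x → Mem C x → Fin cardinality
      π∈ x x∈ = toE (rep x) (coset⇒C x∈ (rep-related x) , sym (rep-cong (rep-related x)))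
      π x with mem? C x
      ... | yes x∈ = π∈ x x∈
      ... | no  _  = π∈ ε C.ε∈

      from-π : ∀ {x} → Mem C x → from (π x) ≡ rep x
      from-π {x} x∈ with mem? C x
      ... | yes x∈′ = from-to (rep x) _
      ... | no x∉ = contradiction x∈ x∉

      π-cong : ∀ {x y} → Mem C x → Mem C y → Mem N (x ⁻¹ ∙ y) → π x ≡ π y
      π-cong x∈ y∈ h = from-injective (trans (from-π x∈) (trans (rep-cong h) (sym (from-π y∈))))

      π-from : ∀ h → π (from h) ≡ h
      π-from h = from-injective (trans (from-π (proj₁ (from∈ h))) (proj₂ (from∈ h)))

      from-π-coset : ∀ {x} → Mem C x → Mem N (x ⁻¹ ∙ from (π x))
      from-π-coset {x} x∈ = subst (λ r → Mem N (x ⁻¹ ∙ r)) (sym (from-π x∈)) (rep-related x)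

      infixl 7 _∙ᴴ_
      _∙ᴴ_ : Fin cardinality → Fin cardinality → Fin cardinality
      h ∙ᴴ k = π (from h ∙ from k)

      from∈C : ∀ h → Mem C (from h)
      from∈C h = proj₁ (from∈ h)

      -- (x y)⁻¹ (x n y m) = (y⁻¹ n y) m
      coset-∙ : ∀ {x y x′ y′} → Mem C y → Mem N (x ⁻¹ ∙ x′) → Mem N (y ⁻¹ ∙ y′) →
                Mem N ((x ∙ y) ⁻¹ ∙ (x′ ∙ y′))
      coset-∙ {x} {y} {x′} {y′} y∈ hx hy = subst (Mem N) eq (N.∙∈ (N⊲C (C.⁻¹∈ y∈) hx) hy)
        where
        open ≡-Reasoning
        eq : y ⁻¹ ◃ (x ⁻¹ ∙ x′) ∙ (y ⁻¹ ∙ y′) ≡ (x ∙ y) ⁻¹ ∙ (x′ ∙ y′)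
        eq = begin
          y ⁻¹ ∙ (x ⁻¹ ∙ x′) ∙ (y ⁻¹) ⁻¹ ∙ (y ⁻¹ ∙ y′) ≡⟨ assoc _ _ _ ⟩
          y ⁻¹ ∙ (x ⁻¹ ∙ x′) ∙ ((y ⁻¹) ⁻¹ ∙ (y ⁻¹ ∙ y′)) ≡⟨ cong (y ⁻¹ ∙ (x ⁻¹ ∙ x′) ∙_) (\\-leftDividesʳ (y ⁻¹) y′) ⟩
          y ⁻¹ ∙ (x ⁻¹ ∙ x′) ∙ y′                      ≡⟨ cong (_∙ y′) (assoc (y ⁻¹) (x ⁻¹) x′) ⟨
          y ⁻¹ ∙ x ⁻¹ ∙ x′ ∙ y′                        ≡⟨ cong (λ z → z ∙ x′ ∙ y′) (⁻¹-anti-homo-∙ x y) ⟨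
          (x ∙ y) ⁻¹ ∙ x′ ∙ y′                         ≡⟨ assoc _ x′ y′ ⟩
          (x ∙ y) ⁻¹ ∙ (x′ ∙ y′)                       ∎

      π-homo : ∀ {x y} → Mem C x → Mem C y → π (x ∙ y) ≡ π x ∙ᴴ π y
      π-homo x∈ y∈ = π-cong (C.∙∈ x∈ y∈) (C.∙∈ (from∈C _) (from∈C _))
        (coset-∙ y∈ (from-π-coset x∈) (from-π-coset y∈))

      πˡ : ∀ {x} → Mem C x → ∀ h → π x ∙ᴴ h ≡ π (x ∙ from h)
      πˡ x∈ h = trans (cong (π _ ∙ᴴ_) (sym (π-from h))) (sym (π-homo x∈ (from∈C h)))

      πʳ : ∀ h {x} → Mem C x → h ∙ᴴ π x ≡ π (from h ∙ x)
      πʳ h x∈ = trans (cong (_∙ᴴ π _) (sym (π-from h))) (sym (π-homo (from∈C h) x∈))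

      quotient-group : FinGroup cardinality
      quotient-group = record
        { _∙_ = _∙ᴴ_ ; ε = π ε ; _⁻¹ = λ h → π (from h ⁻¹)
        ; isGroup = record
          { isMonoid = record
            { isSemigroup = record
              { isMagma = record { isEquivalence = isEquivalence ; ∙-cong = cong₂ _∙ᴴ_ }
              ; assoc = λ h k l → trans (πˡ (C.∙∈ (from∈C h) (from∈C k)) l)
                  (trans (cong π (assoc _ _ _)) (sym (πʳ h (C.∙∈ (from∈C k) (from∈C l))))) }
            ; identity = (λ h → trans (πˡ C.ε∈ h) (trans (cong π (identityˡ _)) (π-from h)))
                       , (λ h → trans (πʳ h C.ε∈) (trans (cong π (identityʳ _)) (π-from h))) }
          ; inverse = (λ h → trans (πˡ (C.⁻¹∈ (from∈C h)) h) (cong π (inverseˡ _)))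
                    , (λ h → trans (πʳ h (C.⁻¹∈ (from∈C h))) (cong π (inverseʳ _)))
          ; ⁻¹-cong = cong (λ h → π (from h ⁻¹)) } }

    opaque
      section : Section C N
      section = record
        { index = cardinality ; H = quotient-group ; π = π ; ι = from ; ι∈ = from∈C
        ; π-ι = π-from ; π-∙ = π-homo
        ; π-≡⇒ = λ {x} {y} x∈ y∈ eq → coset-trans N (from-π-coset x∈)
            (coset-sym N (subst (λ h → Mem N (y ⁻¹ ∙ from h)) (sym eq) (from-π-coset y∈)))
        ; π-≡⇐ = π-cong }

  module SectionProperties {C N : Subgroup} (Q : Section C N) (N⊆C : ∀ {x} → Mem N x → Mem C x) where
    open Section Q public
    open GroupTheory H public using () renaming
      ( _∙_ to _∙ᴴ_ ; ε to εᴴ ; _⁻¹ to _⁻¹ᴴ ; _↑_ to _↑ᴴ_ ; Subgroup to Subgroupᴴ ; HasOrder to HasOrderᴴ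
      ; module Subgroup to Subgroupᴴ)
    private
      module C = Subgroup C
      module N = Subgroup N
      module ᴴ = GroupTheory H

    π-ε : π ε ≡ εᴴ
    π-ε = ᴴ.∙-cancelˡ (π ε) _ _ (trans (sym (π-∙ C.ε∈ C.ε∈)) (trans (cong π (identityˡ ε)) (sym (ᴴ.identityʳ _))))

    π-⁻¹ : ∀ {x} → Mem C x → π (x ⁻¹) ≡ π x ⁻¹ᴴ
    π-⁻¹ {x} x∈ = ᴴ.inverseʳ-unique (π x) (π (x ⁻¹))
      (trans (sym (π-∙ x∈ (C.⁻¹∈ x∈))) (trans (cong π (inverseʳ x)) π-ε))

    π-↑ : ∀ {x} → Mem C x → ∀ k → π (x ↑ k) ≡ π x ↑ᴴ k
    π-↑ {x} x∈ zero = trans (cong π (↑-zero x)) (trans π-ε (sym (ᴴ.↑-zero (π x))))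
    π-↑ {x} x∈ (suc k) = begin
      π (x ↑ suc k)       ≡⟨ cong π (↑-suc x k) ⟩
      π (x ∙ x ↑ k)       ≡⟨ π-∙ x∈ (C.↑∈ x∈ k) ⟩
      π x ∙ᴴ π (x ↑ k)    ≡⟨ cong (π x ∙ᴴ_) (π-↑ x∈ k) ⟩
      π x ∙ᴴ π x ↑ᴴ k     ≡⟨ ᴴ.↑-suc (π x) k ⟨
      π x ↑ᴴ suc k        ∎
      where open ≡-Reasoning

    kernel⇒ : ∀ {x} → Mem C x → π x ≡ εᴴ → Mem N x
    kernel⇒ {x} x∈ eq = subst (Mem N) (trans (cong (_∙ x) ε⁻¹≈ε) (identityˡ x))
      (π-≡⇒ C.ε∈ x∈ (trans π-ε (sym eq)))

    kernel⇐ : ∀ {x} → Mem N x → π x ≡ εᴴ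
    kernel⇐ {x} x∈ = trans (sym (π-≡⇐ C.ε∈ (N⊆C x∈)
      (subst (Mem N) (sym (trans (cong (_∙ x) ε⁻¹≈ε) (identityˡ x))) x∈))) π-ε

    lift : ∀ {x} → Mem C x → ∀ {y} → Mem C y → π x ≡ π y → ∃ λ z → Mem N z × y ≡ x ∙ z
    lift {x} x∈ {y} y∈ eq = x ⁻¹ ∙ y , π-≡⇒ x∈ y∈ eq , sym (\\-leftDividesˡ x y)

    fibre-count : ∀ h → count (λ x → mem? C x ×-dec (π x ≟ᶠ h)) ≡ size N
    fibre-count h = coset-count N _ (ι h)
      (λ a∈ → C.∙∈ (ι∈ h) (N⊆C a∈) , trans (π-∙ (ι∈ h) (N⊆C a∈))
         (trans (cong₂ _∙ᴴ_ (π-ι h) (kernel⇐ a∈)) (ᴴ.identityʳ h)))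
      λ (x∈ , eq) → π-≡⇒ (ι∈ h) x∈ (trans (π-ι h) (sym eq))

    pullback-count : {P : Fin index → Set} (P? : Decidable P) →
      count (λ x → mem? C x ×-dec P? (π x)) ≡ count P? * size N
    pullback-count P? = trans (sym (*-identityʳ _)) (double-count _ P?
      (λ x h → P? h ×-dec (mem? C x ×-dec (π x ≟ᶠ h)))
      (λ { x h (ph , x∈ , refl) → (x∈ , ph) , ph })
      (λ x (x∈ , px) → count-unique _ (px , x∈ , refl) λ h (_ , _ , eq) → eq)
      λ h ph → trans (count-cong _ (λ x → mem? C x ×-dec (π x ≟ᶠ h)) (λ _ → proj₂) (λ _ → ph ,_)) (fibre-count h))

    pullback : Subgroupᴴ → Subgroup
    pullback K = record
      { Mem  = λ x → Mem C x × K.Mem (π x)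
      ; mem? = λ x → mem? C x ×-dec K.mem? (π x)
      ; ε∈   = C.ε∈ , subst K.Mem (sym π-ε) K.ε∈
      ; ∙∈   = λ (x∈ , πx) (y∈ , πy) → C.∙∈ x∈ y∈ , subst K.Mem (sym (π-∙ x∈ y∈)) (K.∙∈ πx πy)
      ; ⁻¹∈  = λ (x∈ , πx) → C.⁻¹∈ x∈ , subst K.Mem (sym (π-⁻¹ x∈)) (K.⁻¹∈ πx) }
      where module K = Subgroupᴴ K

    size-pullback : (K : Subgroupᴴ) → size (pullback K) ≡ Subgroupᴴ.size K * size N
    size-pullback K = pullback-count (Subgroupᴴ.mem? K)

    size-section : size C ≡ index * size N
    size-section = begin
      size C                   ≡⟨ count-cong _ (mem? (pullback ᴴ.whole)) (λ _ x∈ → x∈ , _) (λ _ → proj₁) ⟩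
      size (pullback ᴴ.whole)  ≡⟨ size-pullback ᴴ.whole ⟩
      ᴴ.size ᴴ.whole * size N  ≡⟨ cong (_* size N) ᴴ.size-whole ⟩
      index * size N           ∎
      where open ≡-Reasoning

-- Solutions of `x ↑ d ≡ ε`

module Torsion {n : ℕ} (G : FinGroup n) where
  open GroupTheory G
  open ≡-Reasoning

  torsion : ℕ → ℕ
  torsion d = count λ x → x ↑ d ≟ᶠ ε

  ⟪⟫-commute : ∀ {x a b} → Mem ⟪ x ⟫ a → Mem ⟪ x ⟫ b → Commute a b
  ⟪⟫-commute {x} (i , refl) (j , refl) = commute-↑↑ x (toℕ i) (toℕ j)

  self∈⟪⟫ : ∀ x → Mem ⟪ x ⟫ x
  self∈⟪⟫ x = subst (Mem ⟪ x ⟫) (↑-1 x) (↑∈⟪⟫ x 1)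

  ↑-swap : ∀ x i j → (x ↑ i) ↑ j ≡ (x ↑ j) ↑ i
  ↑-swap x i j = trans (↑-* x i j) (trans (cong (x ↑_) (*-comm i j)) (sym (↑-* x j i)))

  -- The exponent `t` is an inverse of `s` modulo `q`, so one `t` serves all elements killed by `q`.
  root : ∀ {s q} → 1 ≤ q → Coprime s q → ∃ λ t → ∀ g → g ↑ q ≡ ε → (g ↑ t) ↑ s ≡ g
  root {s} {q} 1≤q s⊥q with modular-inverse 1≤q s⊥q
  ... | t , k , l , eq = t , λ g gq → begin
    (g ↑ t) ↑ s                   ≡⟨ ↑-swap g t s ⟩
    (g ↑ s) ↑ t                   ≡⟨ ↑-* g s t ⟩
    g ↑ (s * t)                   ≡⟨ identityʳ _ ⟨
    g ↑ (s * t) ∙ ε               ≡⟨ cong (g ↑ (s * t) ∙_) (↑-∣ gq (m∣m*n k)) ⟨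
    g ↑ (s * t) ∙ g ↑ (q * k)     ≡⟨ ↑-+ g (s * t) (q * k) ⟨
    g ↑ (s * t + q * k)           ≡⟨ cong (g ↑_) eq ⟩
    g ↑ (1 + q * l)               ≡⟨ ↑-+ g 1 (q * l) ⟩
    g ↑ 1 ∙ g ↑ (q * l)           ≡⟨ cong₂ _∙_ (↑-1 g) (↑-∣ gq (m∣m*n l)) ⟩
    g ∙ ε                         ≡⟨ identityʳ g ⟩
    g                             ∎

  coprime-kill : ∀ {g s q} → Coprime s q → g ↑ s ≡ ε → g ↑ q ≡ ε → g ≡ ε
  coprime-kill {g} {s} {q} s⊥q gs gq = trans (sym (↑-1 g)) (↑-∣ (proj₁ (ord-order g))
    (∣-reflexive (s⊥q (proj₂ (ord-order g) s gs , proj₂ (ord-order g) q gq))))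

  centralizer : Fin n → Subgroup
  centralizer y = record
    { Mem  = λ c → Commute y c
    ; mem? = λ c → y ∙ c ≟ᶠ c ∙ y
    ; ε∈   = commute-ε
    ; ∙∈   = commute-∙
    ; ⁻¹∈  = commute-⁻¹ }

  -- Both sides count the pairs `(c , x)` with `c ◃ y ≡ x ↑ s`. For fixed `c`, conjugation by `c`
  -- carries the `s`-th roots of `y` to those of `c ◃ y`; for fixed `x`, the admissible `c` form a
  -- coset of the centralizer of `y`.
  conjugate-root-count : ∀ y s →
    count (λ x → any? λ c → c ◃ y ≟ᶠ x ↑ s) * size (centralizer y) ≡ n * count (λ x → x ↑ s ≟ᶠ y)
  conjugate-root-count y s = sym (trans (cong (_* count (λ x → x ↑ s ≟ᶠ y)) (sym size-whole))
    (double-count (mem? whole) (λ x → any? λ c → c ◃ y ≟ᶠ x ↑ s) (λ c x → c ◃ y ≟ᶠ x ↑ s)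
      (λ c x eq → tt , c , eq)
      (λ c _ → count-bijection _ _ (c ⁻¹ ◃_) (c ◃_)
        (λ x eq → trans (◃-↑ (c ⁻¹) x s) (⁻¹-◃ c eq))
        (λ x eq → trans (cong (c ◃_) (sym eq)) (sym (◃-↑ c x s)))
        (λ x _ → ◃-⁻¹ c x)
        (λ x _ → ⁻¹-◃ c refl))
      λ x (c , eq) → coset-count (centralizer y) _ c
        (λ {d} d∈ → trans (sym (◃-◃ c d y)) (trans (cong (c ◃_) (commute⇒◃ (sym d∈))) eq))
        λ {d} eq′ → sym (◃⇒commute (trans (sym (◃-◃ (c ⁻¹) d y)) (⁻¹-◃ c (trans eq (sym eq′)))))))

  module PrimeLayer {p : ℕ} (pr : Prime p) (e s : ℕ) (p∤s : ¬ p ∣ s) where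

    s⊥p^ : ∀ k → Coprime s (p ^ k)
    s⊥p^ k = coprime-sym (prime^-coprime pr p∤s k)

    -- With `d = p ^ e * s`, these are the solutions for the exponent `p * d` that are lost on
    -- passing to `d`; they are the ones for which `x ↑ s` has the full order `p ^ suc e`.
    Layer : Fin n → Set
    Layer x = x ↑ (p ^ suc e * s) ≡ ε × x ↑ (p ^ e * s) ≢ ε

    layer? : Decidable Layer
    layer? x = (x ↑ (p ^ suc e * s) ≟ᶠ ε) ×-dec ¬? (x ↑ (p ^ e * s) ≟ᶠ ε)

    ↑s↑ : ∀ x k → (x ↑ s) ↑ k ≡ x ↑ (k * s)
    ↑s↑ x k = trans (↑-* x s k) (cong (x ↑_) (*-comm s k))

    p-part-order : ∀ {x} → Layer x → HasOrder (x ↑ s) (p ^ suc e)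
    p-part-order {x} (x1 , x≢) = order-prime-power {e = e} pr (trans (↑s↑ x _) x1) λ eq → x≢ (trans (sym (↑s↑ x _)) eq)

    1≤p^ : ∀ k → 1 ≤ p ^ k
    1≤p^ = ^-pos (≤-trans (s≤s z≤n) (prime≥2 pr))

    private
      -- Inside the layer this means: same component of order prime to `p`, and `p`-components
      -- generating the same cyclic group.
      Related : Fin n → Fin n → Set
      Related x x′ = Mem ⟪ x ↑ s ⟫ (x ⁻¹ ∙ x′)

      related? : ∀ x x′ → Dec (Related x x′)
      related? x x′ = mem? ⟪ x ↑ s ⟫ (x ⁻¹ ∙ x′)

      ⟪↑⟫⊆ : ∀ {x k g} → Mem ⟪ x ↑ k ⟫ g → Mem ⟪ x ⟫ g
      ⟪↑⟫⊆ {x} {k} = ⟪⟫-⊆ ⟪ x ⟫ (↑∈⟪⟫ x k)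

      related⇒∈⟪⟫ : ∀ {x x′} → Related x x′ → Mem ⟪ x ⟫ x′
      related⇒∈⟪⟫ {x} {x′} h = subst (Mem ⟪ x ⟫) (\\-leftDividesˡ x x′) (Subgroup.∙∈ ⟪ x ⟫ (self∈⟪⟫ x) (⟪↑⟫⊆ h))

      ∙-↑ᶜ : ∀ {x a b} → Mem ⟪ x ⟫ a → Mem ⟪ x ⟫ b → ∀ k → (a ∙ b) ↑ k ≡ a ↑ k ∙ b ↑ k
      ∙-↑ᶜ a∈ b∈ = ∙-↑ (⟪⟫-commute a∈ b∈)

      same⊇ : ∀ {x x′} → Related x x′ → ∀ {g} → Mem ⟪ x′ ↑ s ⟫ g → Mem ⟪ x ↑ s ⟫ g
      same⊇ {x} {x′} h = ⟪⟫-⊆ ⟪ x ↑ s ⟫ (subst (Mem ⟪ x ↑ s ⟫)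
        (trans (sym (∙-↑ᶜ (self∈⟪⟫ x) (⟪↑⟫⊆ h) s)) (cong (_↑ s) (\\-leftDividesˡ x x′)))
        (K.∙∈ (self∈⟪⟫ _) (K.↑∈ h s)))
        where module K = Subgroup ⟪ x ↑ s ⟫

      same⊆ : ∀ {x x′} → Layer x → Layer x′ → Related x x′ → ∀ {g} → Mem ⟪ x ↑ s ⟫ g → Mem ⟪ x′ ↑ s ⟫ g
      same⊆ {x} {x′} lx lx′ h = count-⊆-≡ (mem? ⟪ x′ ↑ s ⟫) (mem? ⟪ x ↑ s ⟫) (λ _ → same⊇ h)
        (≤-reflexive (trans (size-⟪⟫ (p-part-order lx)) (sym (size-⟪⟫ (p-part-order lx′))))) _

      -- With `w = x ↑ s`, the points of the coset of `x` modulo `⟪ w ⟫` already killed by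
      -- `p ^ e * s` form one coset of `⟪ w ↑ p ⟫`, the subgroup of those elements of `⟪ w ⟫` that
      -- `p ^ e` kills.
      class-outside : ∀ {x} → Layer x →
        count (λ y → related? x y ×-dec ¬? (layer? y)) ≡ p ^ e
      class-outside {x} lx = trans (coset-count ⟪ w ↑ p ⟫ _ x₀ to from) (size-⟪⟫ (order-↑ p (p ^ e) 1≤p w-order))
        where
        1≤p = ≤-trans (s≤s z≤n) (prime≥2 pr)
        w = x ↑ s
        module K = Subgroup ⟪ w ⟫
        w-order = p-part-order lx
        r = root (1≤p^ (suc e)) (s⊥p^ (suc e))
        kills : ∀ {g} → Mem ⟪ w ⟫ g → g ↑ (p ^ suc e) ≡ ε
        kills (i , refl) = trans (↑-swap w (toℕ i) _) (trans (cong (_↑ toℕ i) (proj₁ w-order)) (ε↑ (toℕ i)))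
        -- x₀ is the point of the coset of x whose s-th power is trivial.
        k₀ = (w ⁻¹) ↑ proj₁ r
        k₀∈ : Mem ⟪ w ⟫ k₀
        k₀∈ = K.↑∈ (K.⁻¹∈ (self∈⟪⟫ w)) _
        x₀ = x ∙ k₀
        x₀∈ : Mem ⟪ x ⟫ x₀
        x₀∈ = Subgroup.∙∈ ⟪ x ⟫ (self∈⟪⟫ x) (⟪↑⟫⊆ k₀∈)
        x₀s : x₀ ↑ s ≡ ε
        x₀s = trans (∙-↑ᶜ (self∈⟪⟫ x) (⟪↑⟫⊆ k₀∈) s)
          (trans (cong (w ∙_) (proj₂ r (w ⁻¹) (kills (K.⁻¹∈ (self∈⟪⟫ w))))) (inverseʳ w))
        to : ∀ {k} → Mem ⟪ w ↑ p ⟫ k → Related x (x₀ ∙ k) × ¬ Layer (x₀ ∙ k)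
        to {k} k∈ = subst (Mem ⟪ w ⟫) (sym (trans (cong (x ⁻¹ ∙_) (assoc x k₀ k)) (\\-leftDividesʳ x _)))
                      (K.∙∈ k₀∈ (⟪↑⟫⊆ k∈)) ,
          λ (_ , ≢ε) → ≢ε (trans (∙-↑ᶜ x₀∈ (⟪↑⟫⊆ (⟪↑⟫⊆ k∈)) _)
            (trans (cong₂ _∙_ (↑-∣ x₀s (n∣m*n (p ^ e))) (k^ k∈)) (identityˡ ε)))
          where
          k^ : ∀ {k} → Mem ⟪ w ↑ p ⟫ k → k ↑ (p ^ e * s) ≡ ε
          k^ (i , refl) = ↑-∣ {o = p ^ e} (trans (↑-swap (w ↑ p) (toℕ i) _) (trans (cong (_↑ toℕ i)
            (trans (↑-* w p _) (proj₁ w-order))) (ε↑ (toℕ i)))) (m∣m*n s)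
        from : ∀ {y} → Related x y × ¬ Layer y → Mem ⟪ w ↑ p ⟫ (x₀ ⁻¹ ∙ y)
        from {y} (xy , ¬ly) = ∈⟪w↑p⟫ k∈ (k^e k^1 k^2)
          where
          k = x₀ ⁻¹ ∙ y
          k∈ : Mem ⟪ w ⟫ k
          k∈ = subst (Mem ⟪ w ⟫) (trans (sym (assoc _ _ _)) (cong (_∙ y) (sym (⁻¹-anti-homo-∙ x k₀))))
                 (K.∙∈ (K.⁻¹∈ k₀∈) xy)
          y∈ = related⇒∈⟪⟫ xy
          y1 : y ↑ (p ^ e * s) ≡ ε
          y1 with y ↑ (p ^ e * s) ≟ᶠ ε
          ... | yes eq = eq
          ... | no ≢ε = contradiction (y2 , ≢ε) ¬ly
            where
            y2 : y ↑ (p ^ suc e * s) ≡ ε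
            y2 with ∈⟪⟫ y∈
            ... | i , refl = trans (↑-swap x i _) (trans (cong (_↑ i) (proj₁ lx)) (ε↑ i))
          k^1 : k ↑ (p ^ e * s) ≡ ε
          k^1 = trans (∙-↑ᶜ (Subgroup.⁻¹∈ ⟪ x ⟫ x₀∈) y∈ _) (trans (cong₂ _∙_
            (trans (sym (identityʳ _)) (trans (cong ((x₀ ⁻¹) ↑ (p ^ e * s) ∙_) (sym (↑-∣ x₀s (n∣m*n (p ^ e)))))
              (trans (sym (∙-↑ (sym (commute-⁻¹ refl)) _)) (trans (cong (_↑ (p ^ e * s)) (inverseˡ x₀)) (ε↑ (p ^ e * s))))))
            y1) (identityˡ ε))
          k^2 = kills k∈
          k^e : k ↑ (p ^ e * s) ≡ ε → k ↑ (p ^ suc e) ≡ ε → k ↑ (p ^ e) ≡ ε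
          -- `k ↑ (p ^ e)` is killed both by `s` and by `p`, which are coprime.
          k^e a b = coprime-kill (s⊥p^ 1)
            (trans (↑-* k _ s) a)
            (trans (↑-* k _ _) (trans (cong (k ↑_) (trans (cong (p ^ e *_) (*-identityʳ p)) (*-comm (p ^ e) p))) b))
          ∈⟪w↑p⟫ : ∀ {k} → Mem ⟪ w ⟫ k → k ↑ (p ^ e) ≡ ε → Mem ⟪ w ↑ p ⟫ k
          ∈⟪w↑p⟫ k∈ k1 with ∈⟪⟫ k∈
          ... | i , refl with *-cancelʳ-∣ {m = p} {n = i} (p ^ e) {{>-nonZero (1≤p^ e)}} (proj₂ w-order (i * p ^ e) (trans (sym (↑-* w i _)) k1))
          ...   | divides q refl = subst (Mem ⟪ w ↑ p ⟫) (trans (↑-swap w p q) (↑-* w q p)) (↑∈⟪⟫ (w ↑ p) q)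

      -- The coset has `p ^ suc e` points, and `class-outside` removes `p ^ e` of them.
      class-size : ∀ {x} → Layer x → count (λ y → layer? y ×-dec related? x y) ≡ p ^ e * pred p
      class-size {x} lx = +-cancelʳ-≡ (p ^ e) _ _ (begin
        count (λ y → layer? y ×-dec related? x y) + p ^ e
          ≡⟨ cong₂ _+_ (count-cong _ (λ y → related? x y ×-dec layer? y) (λ _ (a , b) → b , a) (λ _ (a , b) → b , a))
                       (sym (class-outside lx)) ⟩
        count (λ y → related? x y ×-dec layer? y) + count (λ y → related? x y ×-dec ¬? (layer? y))
          ≡⟨ count-split (related? x) layer? ⟨
        count (related? x)
          ≡⟨ coset-count ⟪ x ↑ s ⟫ (related? x) x (subst (Mem ⟪ x ↑ s ⟫) (sym (\\-leftDividesʳ x _))) id ⟩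
        size ⟪ x ↑ s ⟫
          ≡⟨ size-⟪⟫ (p-part-order lx) ⟩
        p * p ^ e
          ≡⟨ cong (_* p ^ e) (suc-pred p {{prime⇒nonZero pr}}) ⟨
        suc (pred p) * p ^ e
          ≡⟨ arith (pred p) (p ^ e) ⟩
        p ^ e * pred p + p ^ e ∎)
        where
        arith : ∀ a b → suc a * b ≡ b * a + b
        arith = solve-∀

    totient-∣-layer : p ^ e * pred p ∣ count layer?
    totient-∣-layer = partition-∣ layer? related? _
      (λ x _ → coset-refl ⟪ x ↑ s ⟫ x)
      (λ x y lx ly h → same⊆ lx ly h (coset-sym ⟪ x ↑ s ⟫ h))
      (λ x y z lx ly lz h k → coset-trans ⟪ x ↑ s ⟫ h (same⊇ h k))
      λ x lx → ∣-reflexive (sym (class-size lx))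

-- Frobenius' theorem

Frobenius : ℕ → Set
Frobenius n = (G : FinGroup n) → ∀ d → d ∣ n → d ∣ Torsion.torsion G d

module _ {n : ℕ} (G : FinGroup n) {p : ℕ} (pr : Prime p) (e s : ℕ) (p∤s : ¬ p ∣ s)
         (frobenius : ∀ {m} → m < n → Frobenius m) (q∣n : p ^ suc e * s ∣ n) where
  open GroupTheory G
  open Torsion G
  open PrimeLayer pr e s p∤s
  open ≡-Reasoning

  private
    q = p ^ suc e

    module RootCount {y : Fin n} (y-order : HasOrder y q) where
      D = centralizer y
      K = ⟪ y ⟫
      K⊆D : ∀ {x} → Mem K x → Mem D x
      K⊆D x∈ = ⟪⟫-commute (self∈⟪⟫ y) x∈
      commute-K : ∀ {x g} → Mem D x → Mem K g → Commute x g
      commute-K x∈ (i , refl) = commute-↑ (sym x∈) (toℕ i)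
      open SectionProperties G (section G D K K⊆D
        (λ c∈ x∈ → subst (Mem K) (sym (commute⇒◃ (commute-K c∈ x∈))) x∈)) K⊆D
      open Torsion H using () renaming (torsion to torsionᴴ)
      module ᴴ = GroupTheory H
      module D = Subgroup D

      kills : ∀ {g} → Mem K g → g ↑ q ≡ ε
      kills (i , refl) = trans (↑-swap y (toℕ i) _) (trans (cong (_↑ toℕ i) (proj₁ y-order)) (ε↑ (toℕ i)))

      root∈D : ∀ {x} → x ↑ s ≡ y → Mem D x
      root∈D refl = sym (commute-↑ refl s)

      size-D : size D ≡ index * q
      size-D = trans size-section (cong (index *_) (size-⟪⟫ y-order))

      index<n : index < n
      index<n = <-≤-trans (m<m*n index q {{>-nonZero ᴴ.1≤n}} (*-mono-≤ {2} {p} {1} (prime≥2 pr) (1≤p^ e)))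
        (subst (_≤ n) size-D (∣⇒≤ {{>-nonZero 1≤n}} (lagrange-whole D)))

      -- A root of `y` commutes with `y`, so it lies in `D` and its image in `D / K` is killed by
      -- `s`. Conversely, `s` is prime to the order of `K`, so every coset killed by `s` contains
      -- exactly one root.
      root-count : count (λ x → x ↑ s ≟ᶠ y) ≡ torsionᴴ s
      root-count = trans (sym (*-identityʳ _)) (trans (double-count _ _
          (λ x h → (x ↑ s ≟ᶠ y) ×-dec (π x ≟ᶠ h))
          (λ { x h (eq , refl) → eq , torsion-image eq })
          (λ x eq → count-unique _ (eq , refl) λ _ → proj₂)
          unique-root) (*-identityʳ _))
        where
        torsion-image : ∀ {x} → x ↑ s ≡ y → π x ↑ᴴ s ≡ εᴴ
        torsion-image {x} eq = trans (sym (π-↑ (root∈D eq) s)) (trans (cong π eq) (kernel⇐ (self∈⟪⟫ y)))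
        unique-root : ∀ h → h ↑ᴴ s ≡ εᴴ → count (λ x → (x ↑ s ≟ᶠ y) ×-dec (π x ≟ᶠ h)) ≡ 1
        unique-root h hs = count-unique _ {z ∙ k} (zk-root , zk-image) unique
          where
          r = root (1≤p^ (suc e)) (s⊥p^ (suc e))
          z = ι h
          zs∈ : Mem K (z ↑ s)
          zs∈ = kernel⇒ (D.↑∈ (ι∈ h) s) (trans (π-↑ (ι∈ h) s) (trans (cong (_↑ᴴ s) (π-ι h)) hs))
          v = (z ↑ s) ⁻¹ ∙ y
          v∈ : Mem K v
          v∈ = Subgroup.∙∈ K (Subgroup.⁻¹∈ K zs∈) (self∈⟪⟫ y)
          -- The correction inside `K` whose `s`-th power is `v`, the factor by which `z ↑ s` misses
          -- `y`.
          k = v ↑ proj₁ r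
          k∈ : Mem K k
          k∈ = Subgroup.↑∈ K v∈ _
          zk-root : (z ∙ k) ↑ s ≡ y
          zk-root = trans (∙-↑ (commute-K (ι∈ h) k∈) s)
            (trans (cong (z ↑ s ∙_) (proj₂ r v (kills v∈))) (\\-leftDividesˡ (z ↑ s) y))
          zk-image : π (z ∙ k) ≡ h
          zk-image = trans (π-∙ (ι∈ h) (K⊆D k∈)) (trans (cong₂ _∙ᴴ_ (π-ι h) (kernel⇐ k∈)) (ᴴ.identityʳ h))
          same : ∀ {x} → x ↑ s ≡ y → (∃ λ u → Mem K u × x ≡ z ∙ k ∙ u) → z ∙ k ≡ x
          same xs (u , u∈ , refl) =
            trans (sym (identityʳ _)) (cong (z ∙ k ∙_) (sym (coprime-kill (s⊥p^ (suc e)) us (kills u∈))))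
            where
            us : u ↑ s ≡ ε
            us = ∙-cancelˡ y _ _ (begin
              y ∙ u ↑ s             ≡⟨ cong (_∙ u ↑ s) zk-root ⟨
              (z ∙ k) ↑ s ∙ u ↑ s   ≡⟨ ∙-↑ (commute-K (root∈D zk-root) u∈) s ⟨
              (z ∙ k ∙ u) ↑ s       ≡⟨ xs ⟩
              y                     ≡⟨ identityʳ y ⟨
              y ∙ ε                 ∎)
          unique : ∀ x → x ↑ s ≡ y × π x ≡ h → z ∙ k ≡ x
          unique x (xs , πx) = same xs (lift (root∈D zk-root) (root∈D xs) (trans zk-image (sym πx)))

      -- The class has `m * torsionᴴ s` elements, `m` being the index of `D`. As `s` divides `n` and
      -- is prime to `q`, it divides `m * index`, hence `m * gcd s index`; the induction hypothesis
      -- in the smaller group `D / K` shows that `gcd s index` divides `torsionᴴ s`.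
      class-∣ : s ∣ count (λ x → any? λ c → c ◃ y ≟ᶠ x ↑ s)
      class-∣ with lagrange-whole D
      ... | divides m n≡ = subst (s ∣_) (sym class≡) (∣-trans s∣m*gcd (*-monoʳ-∣ m gcd∣torsion))
        where
        class≡ : count (λ x → any? λ c → c ◃ y ≟ᶠ x ↑ s) ≡ m * torsionᴴ s
        class≡ = *-cancelʳ-≡ _ _ (size D) {{>-nonZero (Subgroup.1≤size D)}} (begin
          count (λ x → any? λ c → c ◃ y ≟ᶠ x ↑ s) * size D ≡⟨ conjugate-root-count y s ⟩
          n * count (λ x → x ↑ s ≟ᶠ y)                     ≡⟨ cong₂ _*_ n≡ root-count ⟩
          m * size D * torsionᴴ s                          ≡⟨ swap m (size D) _ ⟩
          m * torsionᴴ s * size D                          ∎)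
          where
          swap : ∀ a b c → a * b * c ≡ a * c * b
          swap = solve-∀
        s∣m*gcd : s ∣ m * gcd s index
        s∣m*gcd = subst (s ∣_) (sym (c*gcd[m,n]≡gcd[cm,cn] m s index)) (gcd-greatest (n∣m*n m)
          (coprime-divisor (s⊥p^ (suc e)) (subst (s ∣_)
            (trans n≡ (trans (cong (m *_) size-D) (rotate m index q))) (∣-trans (n∣m*n q) q∣n))))
          where
          rotate : ∀ a b c → a * (b * c) ≡ c * (a * b)
          rotate = solve-∀
        gcd∣torsion : gcd s index ∣ torsionᴴ s
        -- `s` itself need not divide `index`, but in a group of order `index` the exponents `s` and
        -- `gcd s index` kill the same elements, and the induction hypothesis covers the latter.
        gcd∣torsion = subst (gcd s index ∣_)
          (count-cong _ _ (λ h eq → ᴴ.↑-∣ eq (gcd[m,n]∣m s index)) (λ h eq → ᴴ.↑-gcd s index eq (ᴴ.↑-n h)))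
          (frobenius index<n H (gcd s index) (gcd[m,n]∣n s index))

  -- The layer is cut into blocks by the conjugacy class of `x ↑ s`.
  cofactor-∣-layer : s ∣ count layer?
  cofactor-∣-layer = partition-∣ layer? (λ x x′ → any? λ c → c ◃ (x ↑ s) ≟ᶠ x′ ↑ s) s
    (λ x _ → ε , ε-◃ _)
    (λ x x′ _ _ (c , eq) → c ⁻¹ , ⁻¹-◃ c eq)
    (λ x x′ x″ _ _ _ (c , eq) (d , eq′) → d ∙ c , trans (sym (◃-◃ d c _)) (trans (cong (d ◃_) eq) eq′))
    λ x lx → subst (s ∣_) (count-cong _ _ (λ x′ (c , eq) → conjugate-layer lx eq , c , eq) (λ _ → proj₂))
      (RootCount.class-∣ (p-part-order lx))
    where
    conjugate-layer : ∀ {x x′ c} → Layer x → c ◃ (x ↑ s) ≡ x′ ↑ s → Layer x′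
    conjugate-layer {x} {x′} {c} (x1 , x≢) eq =
      trans (power (p ^ suc e)) (trans (cong (c ◃_) x1) (◃-ε c)) ,
      λ x′1 → x≢ (trans (sym (⁻¹-◃ c (trans (sym (power (p ^ e))) x′1))) (◃-ε (c ⁻¹)))
      where
      power : ∀ k → x′ ↑ (k * s) ≡ c ◃ (x ↑ (k * s))
      power k = begin
        x′ ↑ (k * s)          ≡⟨ ↑s↑ x′ k ⟨
        (x′ ↑ s) ↑ k          ≡⟨ cong (_↑ k) eq ⟨
        (c ◃ (x ↑ s)) ↑ k     ≡⟨ ◃-↑ c (x ↑ s) k ⟩
        c ◃ ((x ↑ s) ↑ k)     ≡⟨ cong (c ◃_) (↑s↑ x k) ⟩
        c ◃ (x ↑ (k * s))     ∎

module _ {n : ℕ} (G : FinGroup n) {p : ℕ} (pr : Prime p) (e s : ℕ) (p∤s : ¬ p ∣ s) where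
  open GroupTheory G
  open Torsion G
  open PrimeLayer pr e s p∤s

  torsion-split : torsion (p ^ suc e * s) ≡ torsion (p ^ e * s) + count layer?
  torsion-split = trans (count-split (λ x → x ↑ (p ^ suc e * s) ≟ᶠ ε) (λ x → x ↑ (p ^ e * s) ≟ᶠ ε))
    (cong (_+ count layer?) (count-cong _ _ (λ _ → proj₂)
      λ x eq → ↑-∣ eq (*-monoˡ-∣ s (^-mono-∣ p (n≤1+n e))) , eq))

-- Induction on the group order and, inside it, on the codivisor `c`, descending from `d = n`, where
-- every element is a solution. Passing from `p * d` to `d = p ^ e * s` removes a layer whose size
-- is divisible by `p ^ e` and by `s`, two coprime numbers.
frobenius : ∀ {n} → Frobenius n
frobenius {n} = <-rec Frobenius by-order n
  where
  by-order : ∀ n → (∀ {m} → m < n → Frobenius m) → Frobenius n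
  by-order n smaller G d (divides c n≡) = <-rec (λ c → ∀ d → n ≡ c * d → d ∣ torsion d) by-codivisor c d n≡
    where
    open GroupTheory G
    open Torsion G
    by-codivisor : ∀ c → (∀ {b} → b < c → ∀ d → n ≡ b * d → d ∣ torsion d) → ∀ d → n ≡ c * d → d ∣ torsion d
    by-codivisor zero rec d n≡ = contradiction n≡ (m<n⇒n≢0 1≤n)
    by-codivisor (suc zero) rec d n≡ = ∣-reflexive (trans (sym (trans n≡ (*-identityˡ d)))
      (sym (count-all _ λ x → ↑-∣ (↑-n x) (∣-reflexive (trans n≡ (*-identityˡ d))))))
    by-codivisor c@(suc (suc _)) rec d n≡ with prime-divisor {c} (s≤s (s≤s z≤n))
    ... | p , pr , divides b c≡ with prime-power-part pr (*-pos⁻¹ʳ {d} c (subst (1 ≤_) n≡ 1≤n))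
    ...   | e , s , refl , p∤s = ∣m+n∣m⇒∣n
        (subst (d ∣_) (trans (torsion-split G pr e s p∤s) (+-comm (torsion (p ^ e * s)) (count layer?)))
          (∣-trans (*-monoˡ-∣ s (^-mono-∣ p (n≤1+n e))) (rec b<c (p ^ suc e * s) n≡bdp)))
        (coprime-*-∣ (prime^-coprime pr p∤s e) (∣-trans (m∣m*n (pred p)) totient-∣-layer)
          (cofactor-∣-layer G pr e s p∤s smaller (divides b n≡bdp)))
      where
      open PrimeLayer pr e s p∤s
      b<c : b < c
      b<c = subst (b <_) (sym c≡) (m<m*n b p {{>-nonZero (*-pos⁻¹ˡ {b} {p} (subst (1 ≤_) c≡ (s≤s z≤n)))}} (prime≥2 pr))
      n≡bdp : n ≡ b * (p ^ suc e * s)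
      n≡bdp = trans n≡ (trans (cong (_* d) c≡) (rotate b p (p ^ e) s))
        where
        rotate : ∀ b p x s → b * p * (x * s) ≡ b * (p * x * s)
        rotate = solve-∀

-- Exact solution counts under cyclic Sylow subgroups

-- An element of order p ^ k with p ∤ n / p ^ k generates a Sylow p-subgroup.
CyclicSylows : {n : ℕ} → FinGroup n → Set
CyclicSylows {n} G = ∀ p → Prime p →
  ∃ λ h → ∃₂ λ k r → GroupTheory.HasOrder G h (p ^ k) × n ≡ p ^ k * r × ¬ p ∣ r

prime-∣-prime : ∀ {l p} → Prime l → Prime p → l ∣ p → l ≡ p
prime-∣-prime prl pr l∣p with prime⇒irreducible pr l∣p
... | inj₁ refl = contradiction prl ¬prime[1]
... | inj₂ l≡p = l≡p

module _ {n : ℕ} (G : FinGroup n) (cyclic : CyclicSylows G) where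
  open GroupTheory G
  open Torsion G

  private
    -- For `q ≥ 2` the last summand alone reaches `p * d`, leaving no room for the positive `T`;
    -- hence `q` is 1.
    torsion-arithmetic : ∀ p d T q → 2 ≤ p → 1 ≤ T → 1 ≤ q → p * d ≡ T + q * (pred p * d) → T ≡ d
    torsion-arithmetic (suc p) d T (suc zero) _ _ _ eq =
      +-cancelʳ-≡ (p * d) T d (sym (trans eq (cong (T +_) (*-identityˡ (p * d)))))
    torsion-arithmetic (suc p) d T (suc (suc q)) (s≤s 1≤p) 1≤T _ eq = contradiction (≤-reflexive (sym eq))
      (<⇒≱ (begin-strict
        d + p * d                      ≤⟨ +-monoˡ-≤ (p * d) (≤-trans (≤-reflexive (sym (*-identityˡ d))) (*-monoˡ-≤ d 1≤p)) ⟩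
        p * d + p * d                  ≤⟨ +-monoʳ-≤ (p * d) (m≤m+n (p * d) (q * (p * d))) ⟩
        p * d + (p * d + q * (p * d))  <⟨ m<n+m _ 1≤T ⟩
        T + (p * d + (p * d + q * (p * d))) ∎))
      where open ≤-Reasoning

  prime-power-element : ∀ {p} → Prime p → ∀ e → p ^ e ∣ n → ∃ λ x → HasOrder x (p ^ e)
  prime-power-element {p} pr e p^e∣n with cyclic p pr
  ... | h , k , r , h-order , n≡ , p∤r = h ↑ (p ^ (k ∸ e)) ,
      order-↑ (p ^ (k ∸ e)) (p ^ e) (^-pos (≤-trans (s≤s z≤n) (prime≥2 pr)) (k ∸ e))
        (subst (HasOrder h) (trans (cong (p ^_) (sym (m∸n+n≡m e≤k))) (^-distribˡ-+-* p (k ∸ e) e)) h-order)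
    where
    e≤k : e ≤ k
    e≤k = ^-∣-exponent {e = e} {k = k} pr p∤r (subst (p ^ e ∣_) n≡ p^e∣n)

  -- An element of order `p ^ suc e` qualifies, since `p ^ suc e` does not divide `p ^ e * s`.
  layer-inhabited : ∀ {p} (pr : Prime p) e s (p∤s : ¬ p ∣ s) → p ^ suc e * s ∣ n → ∃ (PrimeLayer.Layer pr e s p∤s)
  layer-inhabited {p} pr e s p∤s d∣n with prime-power-element pr (suc e) (∣-trans (m∣m*n s) d∣n)
  ... | x , x-order = x , ↑-∣ (proj₁ x-order) (m∣m*n s) ,
        λ eq → 1+n≰n (^-∣-exponent {e = suc e} {k = e} pr p∤s (proj₂ x-order _ eq))

  -- For the largest prime `p` of `r`, the ordering of the primes makes `pred p` coprime to `s`, so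
  -- the layer is a multiple of `pred p * d`. It is nonempty, and the count for `p * d` is exact by
  -- induction, so the layer must be that multiple taken once.
  torsion-exact : ∀ r d → n ≡ r * d → (∀ q l → Prime q → q ∣ r → Prime l → l ∣ d → q ≤ l) → torsion d ≡ d
  torsion-exact = <-rec (λ r → ∀ d → n ≡ r * d → (∀ q l → Prime q → q ∣ r → Prime l → l ∣ d → q ≤ l) → torsion d ≡ d) go
    where
    go : ∀ r → (∀ {b} → b < r → ∀ d → n ≡ b * d → (∀ q l → Prime q → q ∣ b → Prime l → l ∣ d → q ≤ l) → torsion d ≡ d) →
         ∀ d → n ≡ r * d → (∀ q l → Prime q → q ∣ r → Prime l → l ∣ d → q ≤ l) → torsion d ≡ d
    go zero rec d n≡ _ = contradiction n≡ (m<n⇒n≢0 1≤n)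
    go (suc zero) rec d n≡ _ = trans (count-all _ λ x → ↑-∣ (↑-n x) (∣-reflexive n≡d)) n≡d
      where n≡d = trans n≡ (*-identityˡ d)
    go r@(suc (suc _)) rec d n≡ small with greatest-prime-divisor {r} (s≤s (s≤s z≤n))
    ... | p , (pr , p∣r@(divides b r≡)) , maximal with prime-power-part pr (*-pos⁻¹ʳ {d} r (subst (1 ≤_) n≡ 1≤n))
    ...   | e , s , refl , p∤s = conclude (coprime-*-∣ totient⊥s totient-∣-layer
                                   (cofactor-∣-layer G pr e s p∤s (λ _ → frobenius) (divides b n≡bdp)))
      where
      open PrimeLayer pr e s p∤s
      b<r : b < r
      b<r = subst (b <_) (sym r≡) (m<m*n b p {{>-nonZero (*-pos⁻¹ˡ {b} {p} (subst (1 ≤_) r≡ (s≤s z≤n)))}} (prime≥2 pr))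
      n≡bdp : n ≡ b * (p ^ suc e * s)
      n≡bdp = trans n≡ (trans (cong (_* d) r≡) (rotate b p (p ^ e) s))
        where
        rotate : ∀ b p x s → b * p * (x * s) ≡ b * (p * x * s)
        rotate = solve-∀
      1≤s : 1 ≤ s
      1≤s = *-pos⁻¹ʳ {s} (r * p ^ e) (subst (1 ≤_) (trans n≡ (sym (*-assoc r (p ^ e) s))) 1≤n)
      totient⊥s : Coprime (p ^ e * pred p) s
      totient⊥s = coprime-* (prime^-coprime pr p∤s e)
        (pred-coprime pr (λ l prl l∣s → small p l pr p∣r prl (∣n⇒∣m*n (p ^ e) l∣s)) 1≤s)
      larger : torsion (p ^ suc e * s) ≡ p ^ suc e * s
      larger = rec b<r (p ^ suc e * s) n≡bdp bounds
        where
        bounds : ∀ q l → Prime q → q ∣ b → Prime l → l ∣ p ^ suc e * s → q ≤ l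
        bounds q l prq q∣b prl l∣ with euclidsLemma p d prl (subst (l ∣_) (*-assoc p (p ^ e) s) l∣)
        ... | inj₁ l∣p = subst (q ≤_) (sym (prime-∣-prime prl pr l∣p)) (maximal q (prq , q∣r))
          where q∣r = subst (q ∣_) (sym r≡) (∣m⇒∣m*n p q∣b)
        ... | inj₂ l∣d = small q l prq (subst (q ∣_) (sym r≡) (∣m⇒∣m*n p q∣b)) prl l∣d
      conclude : p ^ e * pred p * s ∣ count layer? → torsion d ≡ d
      conclude (divides q layer≡) = torsion-arithmetic p d (torsion d) q (prime≥2 pr)
        (count-pos _ (ε↑ d)) 1≤q (begin
          p * d                               ≡⟨ *-assoc p (p ^ e) s ⟨
          p ^ suc e * s                       ≡⟨ larger ⟨
          torsion (p ^ suc e * s)             ≡⟨ torsion-split G pr e s p∤s ⟩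
          torsion d + count layer?            ≡⟨ cong (torsion d +_) layer≡ ⟩
          torsion d + q * (p ^ e * pred p * s) ≡⟨ cong (λ z → torsion d + q * z) (swap (p ^ e) (pred p) s) ⟩
          torsion d + q * (pred p * d)        ∎)
        where
        open ≡-Reasoning
        swap : ∀ x y s → x * y * s ≡ y * (x * s)
        swap = solve-∀
        1≤q : 1 ≤ q
        1≤q = *-pos⁻¹ˡ (subst (1 ≤_) layer≡ (count-pos layer? (proj₂ (layer-inhabited pr e s p∤s (divides b n≡bdp)))))

-- Existence of Sylow subgroups

HasSylow : ℕ → ℕ → Set₁
HasSylow p n = (G : FinGroup n) → Σ (GroupTheory.Subgroup G) λ P → ∃₂ λ a r →
  GroupTheory.size P ≡ p ^ a × n ≡ p ^ a * r × ¬ p ∣ r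

module _ {n : ℕ} (G : FinGroup n) where
  open GroupTheory G

  -- Dividing by the trivial subgroup merely renumbers the elements of `C`, which turns a subgroup
  -- into a group to which theorems about groups apply.
  module TrivialSection (C : Subgroup) where
    ε∈C : ∀ {x} → Mem trivial x → Mem C x
    ε∈C refl = Subgroup.ε∈ C
    trivial-normal : ∀ g {x} → Mem trivial x → Mem trivial (g ◃ x)
    trivial-normal g refl = ◃-ε g
    open SectionProperties G (section G C trivial ε∈C λ {c} _ → trivial-normal c) ε∈C public

    index≡size : index ≡ size C
    index≡size = sym (trans size-section (trans (cong (index *_) size-trivial) (*-identityʳ index)))

module _ {n : ℕ} (G : FinGroup n) {p : ℕ} (pr : Prime p) where
  open GroupTheory G
  open Torsion G

  -- Without a nontrivial solution of `x ↑ p ≡ ε` there would be a single one, and Frobenius'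
  -- theorem would give `p ∣ 1`.
  cauchy : p ∣ n → ∃ λ x → HasOrder x p
  cauchy p∣n with any? (λ x → (x ↑ p ≟ᶠ ε) ×-dec ¬? (x ≟ᶠ ε))
  ... | yes (x , xp , x≢ε) = x , subst (HasOrder x) (*-identityʳ p)
        (order-prime-power {e = 0} pr (trans (cong (x ↑_) (*-identityʳ p)) xp) λ eq → x≢ε (trans (sym (↑-1 x)) eq))
  ... | no none = contradiction (∣1⇒≡1 (subst (p ∣_) torsion≡1 (frobenius G p p∣n))) (m<n⇒n≢m (prime≥2 pr))
    where
    m<n⇒n≢m : ∀ {m n} → m < n → n ≢ m
    m<n⇒n≢m m<n eq = <⇒≢ m<n (sym eq)
    only-ε : ∀ x → x ↑ p ≡ ε → ε ≡ x
    only-ε x xp with x ≟ᶠ ε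
    ... | yes eq = sym eq
    ... | no x≢ε = contradiction (x , xp , x≢ε) none
    torsion≡1 : torsion p ≡ 1
    torsion≡1 = count-unique _ (ε↑ p) only-ε

module _ {n : ℕ} (G : FinGroup n) {p : ℕ} (pr : Prime p) where
  open GroupTheory G
  open Torsion G

  -- Conjugacy, written with `x′ ↑ 1` so that `conjugate-root-count` at `s = 1` becomes the class
  -- equation.
  class? : ∀ x x′ → Dec (∃ λ c → c ◃ x ≡ x′ ↑ 1)
  class? x x′ = any? λ c → c ◃ x ≟ᶠ x′ ↑ 1

  class-equation : ∀ x → count (class? x) * size (centralizer x) ≡ n
  class-equation x = trans (conjugate-root-count x 1) (trans (cong (n *_)
    (count-unique (λ x′ → x′ ↑ 1 ≟ᶠ x) (↑-1 x) λ y eq → trans (sym eq) (↑-1 y))) (*-identityʳ n))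

  Central : Fin n → Set
  Central x = ∀ c → Commute x c

  central? : Decidable Central
  central? x = all? λ c → x ∙ c ≟ᶠ c ∙ x

  centre : Subgroup
  centre = record
    { Mem  = Central
    ; mem? = central?
    ; ε∈   = λ c → sym commute-ε
    ; ∙∈   = λ x∈ y∈ c → sym (commute-∙ (sym (x∈ c)) (sym (y∈ c)))
    ; ⁻¹∈  = λ x∈ c → sym (commute-⁻¹ (sym (x∈ c))) }

  private
    sylow-via-centralizer : (∀ {m} → m < n → HasSylow p m) → ∀ x → ¬ Central x → ¬ p ∣ count (class? x) →
      Σ Subgroup λ P → ∃₂ λ a r → size P ≡ p ^ a × n ≡ p ^ a * r × ¬ p ∣ r
    sylow-via-centralizer smaller x ¬central p∤class =
      from-section (smaller (subst (_< n) (sym index≡size) C<n) H)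
      where
      C = centralizer x
      open TrivialSection G C
      C<n : size C < n
      C<n = ≤∧≢⇒< (∣⇒≤ {{>-nonZero 1≤n}} (lagrange-whole C))
        λ eq → ¬central λ c → count-⊆-≡ (mem? C) (mem? whole) (λ _ _ → tt) (≤-reflexive (trans size-whole (sym eq))) c tt
      from-section : (Σ Subgroupᴴ λ P → ∃₂ λ a r → Subgroupᴴ.size P ≡ p ^ a × index ≡ p ^ a * r × ¬ p ∣ r) →
        Σ Subgroup λ P → ∃₂ λ a r → size P ≡ p ^ a × n ≡ p ^ a * r × ¬ p ∣ r
      from-section (P , a , r , size≡ , index≡ , p∤r) = pullback P , a , cl * r ,
        trans (size-pullback P) (trans (cong₂ _*_ size≡ size-trivial) (*-identityʳ (p ^ a))) ,
        trans (sym (class-equation x)) (trans (cong (cl *_) (trans (sym index≡size) index≡)) (swap cl (p ^ a) r)) ,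
        λ p∣ → case (euclidsLemma cl r pr p∣)
        where
        cl = count (class? x)
        swap : ∀ a b c → a * (b * c) ≡ b * (a * c)
        swap = solve-∀
        case : ¬ (p ∣ cl ⊎ p ∣ r)
        case (inj₁ p∣cl) = p∤class p∣cl
        case (inj₂ p∣r) = p∤r p∣r

    sylow-via-quotient : (∀ {m} → m < n → HasSylow p m) → ∀ z → Central z → HasOrder z p →
      Σ Subgroup λ P → ∃₂ λ a r → size P ≡ p ^ a × n ≡ p ^ a * r × ¬ p ∣ r
    sylow-via-quotient smaller z central z-order = from-section (smaller index<n H)
      where
      K = ⟪ z ⟫
      K-central : ∀ {c x} → Mem K x → Commute c x
      K-central {c} (i , refl) = commute-↑ (sym (central c)) (toℕ i)
      open SectionProperties G (section G whole K (λ _ → tt)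
        λ _ x∈ → subst (Mem K) (sym (commute⇒◃ (K-central x∈))) x∈) (λ _ → tt)
      n≡ : n ≡ index * p
      n≡ = trans (sym size-whole) (trans size-section (cong (index *_) (size-⟪⟫ z-order)))
      index<n : index < n
      index<n = subst (index <_) (sym n≡) (m<m*n index p {{>-nonZero (GroupTheory.1≤n H)}} (prime≥2 pr))
      from-section : (Σ Subgroupᴴ λ P → ∃₂ λ a r → Subgroupᴴ.size P ≡ p ^ a × index ≡ p ^ a * r × ¬ p ∣ r) →
        Σ Subgroup λ P → ∃₂ λ a r → size P ≡ p ^ a × n ≡ p ^ a * r × ¬ p ∣ r
      from-section (P , a , r , size≡ , index≡ , p∤r) = pullback P , suc a , r ,
        trans (size-pullback P) (trans (cong₂ _*_ size≡ (size-⟪⟫ z-order)) (*-comm (p ^ a) p)) ,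
        trans n≡ (trans (cong (_* p) index≡) (rotate (p ^ a) r p)) , p∤r
        where
        rotate : ∀ a b c → a * b * c ≡ c * a * b
        rotate = solve-∀

  -- If some noncentral class has size prime to `p`, the centralizer carries the full power of `p`
  -- and has smaller order. Otherwise the class equation makes `p` divide the order of the centre,
  -- and a central subgroup of order `p` can be factored out.
  sylow-step : (∀ {m} → m < n → HasSylow p m) →
    Σ Subgroup λ P → ∃₂ λ a r → size P ≡ p ^ a × n ≡ p ^ a * r × ¬ p ∣ r
  sylow-step smaller with p ∣? n | any? (λ x → ¬? (central? x) ×-dec ¬? (p ∣? count (class? x)))
  ... | no p∤n | _ = trivial , 0 , n , size-trivial , sym (+-identityʳ n) , p∤n
  ... | yes p∣n | yes (x , ¬central , p∤class) = sylow-via-centralizer smaller x ¬central p∤class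
  ... | yes p∣n | no none = from-centre (cauchyᶻ p∣centre)
    where
    p∣noncentral : p ∣ count (λ x → ¬? (central? x))
    p∣noncentral = partition-∣ _ class? p
      (λ x _ → ε , trans (ε-◃ x) (sym (↑-1 x)))
      (λ x y _ _ (c , eq) → c ⁻¹ , trans (⁻¹-◃ c (trans eq (↑-1 y))) (sym (↑-1 x)))
      (λ x y z _ _ _ (c , eq) (d , eq′) → d ∙ c ,
        trans (sym (◃-◃ d c x)) (trans (cong (d ◃_) (trans eq (↑-1 y))) eq′))
      λ x ¬cx → subst (p ∣_) (count-cong (class? x) _ (λ y xy → noncentral-class ¬cx xy , xy) λ _ → proj₂)
                  (p∣class x ¬cx)
      where
      p∣class : ∀ x → ¬ Central x → p ∣ count (class? x)
      p∣class x ¬cx with p ∣? count (class? x)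
      ... | yes p∣ = p∣
      ... | no p∤ = contradiction (x , ¬cx , p∤) none
      noncentral-class : ∀ {x y} → ¬ Central x → (∃ λ c → c ◃ x ≡ y ↑ 1) → ¬ Central y
      noncentral-class {x} {y} ¬cx (c , eq) cy = ¬cx (subst Central (trans (sym (commute⇒◃ (sym (cy (c ⁻¹)))))
        (⁻¹-◃ c (trans eq (↑-1 y)))) cy)
    p∣centre : p ∣ size centre
    p∣centre = ∣m+n∣m⇒∣n (subst (p ∣_) n≡ p∣n) p∣noncentral
      where
      n≡ : n ≡ count (λ x → ¬? (central? x)) + size centre
      n≡ = trans (sym size-whole) (trans (count-split (mem? whole) central?) (trans (+-comm (count (λ x → mem? whole x ×-dec central? x)) _)
        (cong₂ _+_ (count-cong _ _ (λ _ → proj₂) (λ _ → tt ,_)) (count-cong _ _ (λ _ → proj₂) (λ _ → tt ,_)))))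
    cauchyᶻ : p ∣ size centre → ∃ λ z → Central z × z ↑ p ≡ ε × z ≢ ε
    cauchyᶻ p∣ = lift-order (cauchy H pr (subst (p ∣_) (sym index≡size) p∣))
      where
      open TrivialSection G centre
      lift-order : (∃ λ h → HasOrderᴴ h p) → ∃ λ z → Central z × z ↑ p ≡ ε × z ≢ ε
      lift-order (h , hp , minimal) = ι h , ι∈ h ,
        kernel⇒ (Subgroup.↑∈ centre (ι∈ h) p) (trans (π-↑ (ι∈ h) p) (trans (cong (_↑ᴴ p) (π-ι h)) hp)) ,
        λ eq → <⇒≢ (prime≥2 pr) (sym (∣1⇒≡1 (minimal 1 (trans (GroupTheory.↑-1 H h) (trans (sym (π-ι h)) (kernel⇐ eq))))))
    from-centre : (∃ λ z → Central z × z ↑ p ≡ ε × z ≢ ε) →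
      Σ Subgroup λ P → ∃₂ λ a r → size P ≡ p ^ a × n ≡ p ^ a * r × ¬ p ∣ r
    from-centre (z , central , zp , z≢ε) = sylow-via-quotient smaller z central (subst (HasOrder z) (*-identityʳ p)
      (order-prime-power {e = 0} pr (trans (cong (z ↑_) (*-identityʳ p)) zp) λ eq → z≢ε (trans (sym (↑-1 z)) eq)))

sylow : ∀ {p n} → Prime p → HasSylow p n
sylow {p} {n} pr = <-rec (HasSylow p) (λ n smaller G → sylow-step G pr smaller) n

-- Metacyclicity

module _ {n : ℕ} (G : FinGroup n) where
  open GroupTheory G

  order-∣-prime-power : ∀ {p x k} → Prime p → x ↑ (p ^ k) ≡ ε → ∃ λ j → j ≤ k × HasOrder x (p ^ j)
  order-∣-prime-power {p} {x} {k} pr eq with ∣-^ {k = k} pr (proj₂ (ord-order x) _ eq)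
  ... | j , ord≡ , j≤k = j , j≤k , subst (HasOrder x) ord≡ (ord-order x)

module _ {n : ℕ} (G : FinGroup n) where
  open GroupTheory G

  Normal : Subgroup → Set
  Normal A = ∀ g {x} → Mem A x → Mem A (g ◃ x)

  -- With g a p-element generating a Sylow subgroup and p ^ j its order modulo
  -- C, the index of the image of ⟪ g ↑ p ^ j ⟫ in C / N divides that of ⟪ g ⟫ in G.
  section-cyclicSylows : CyclicSylows G → (C N : Subgroup) → Normal C → (N-normal : Normal N) →
    (N⊆C : ∀ {x} → Mem N x → Mem C x) → CyclicSylows (Section.H (section G C N N⊆C λ {c} _ → N-normal c))
  section-cyclicSylows cyclic C N C-normal N-normal N⊆C p pr with cyclic p pr
  ... | g , k , r , g-order , n≡ , p∤r = π u , l , proj₁ cofactor , h-order , proj₂ cofactor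
    where
    module B = SectionProperties G (section G whole C (λ _ → tt) λ {c} _ → C-normal c) (λ _ → tt)
    module ᴮ = GroupTheory B.H
    open SectionProperties G (section G C N N⊆C λ {c} _ → N-normal c) N⊆C
    module ᴴ = GroupTheory H
    image : ∃ λ j → j ≤ k × ᴮ.HasOrder (B.π g) (p ^ j)
    image = order-∣-prime-power B.H pr (trans (sym (B.π-↑ tt _)) (trans (cong B.π (proj₁ g-order)) B.π-ε))
    j = proj₁ image
    j≤k = proj₁ (proj₂ image)
    p^k≡ : p ^ k ≡ p ^ j * p ^ (k ∸ j)
    p^k≡ = trans (cong (p ^_) (sym (m+[n∸m]≡n j≤k))) (^-distribˡ-+-* p j (k ∸ j))
    u = g ↑ (p ^ j)
    u∈C : Mem C u
    u∈C = B.kernel⇒ tt (trans (B.π-↑ tt _) (proj₁ (proj₂ (proj₂ image))))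
    u-order : HasOrder u (p ^ (k ∸ j))
    u-order = order-↑ (p ^ j) _ (^-pos (≤-trans (s≤s z≤n) (prime≥2 pr)) j) (subst (HasOrder g) p^k≡ g-order)
    p^j*C∣n : p ^ j * size C ∣ n
    p^j*C∣n = subst (_∣ n) (trans (B.size-pullback ᴮ.⟪ B.π g ⟫) (cong (_* size C) (ᴮ.size-⟪⟫ (proj₂ (proj₂ image)))))
      (lagrange-whole (B.pullback ᴮ.⟪ B.π g ⟫))
    h-image : ∃ λ l → l ≤ k ∸ j × ᴴ.HasOrder (π u) (p ^ l)
    h-image = order-∣-prime-power H pr (trans (sym (π-↑ u∈C _)) (trans (cong π (proj₁ u-order)) π-ε))
    l = proj₁ h-image
    h-order = proj₂ (proj₂ h-image)
    p^∣l*N : p ^ (k ∸ j) ∣ p ^ l * size N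
    p^∣l*N = subst₂ _∣_ (size-⟪⟫ u-order) (trans (size-pullback ᴴ.⟪ π u ⟫) (cong (_* size N) (ᴴ.size-⟪⟫ h-order)))
      (lagrange ⟪ u ⟫ (pullback ᴴ.⟪ π u ⟫) λ { {x} (i , refl) → Subgroup.↑∈ C u∈C (toℕ i) ,
        subst (ᴴ.Mem ᴴ.⟪ π u ⟫) (sym (π-↑ u∈C (toℕ i))) (ᴴ.↑∈⟪⟫ (π u) (toℕ i)) })
    cofactor : ∃ λ r′ → index ≡ p ^ l * r′ × ¬ p ∣ r′
    cofactor = from-∣ (ᴴ.order-∣ h-order)
      where
      from-∣ : p ^ l ∣ index → ∃ λ r′ → index ≡ p ^ l * r′ × ¬ p ∣ r′
      from-∣ (divides r′ index≡) = r′ , trans index≡ (*-comm r′ (p ^ l)) , λ p∣r′ → p∤r (∣-trans p∣r′ r′∣r)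
        where
        open ≡-Reasoning
        p^*r′∣C : p ^ (k ∸ j) * r′ ∣ size C
        p^*r′∣C = subst (p ^ (k ∸ j) * r′ ∣_) (begin
          p ^ l * size N * r′   ≡⟨ rotate (p ^ l) (size N) r′ ⟩
          r′ * p ^ l * size N   ≡⟨ cong (_* size N) index≡ ⟨
          index * size N        ≡⟨ size-section ⟨
          size C                ∎) (*-monoˡ-∣ r′ p^∣l*N)
          where
          rotate : ∀ a b c → a * b * c ≡ c * a * b
          rotate = solve-∀
        -- Combining `p ^ (k ∸ j) * r′ ∣ size C` with `p ^ j * size C ∣ n` gives
        -- `p ^ k * r′ ∣ p ^ k * r`, so `r′` inherits from `r` that `p` does not divide it.
        r′∣r : r′ ∣ r
        r′∣r = *-cancelˡ-∣ (p ^ k) {{>-nonZero (^-pos (≤-trans (s≤s z≤n) (prime≥2 pr)) k)}}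
          (subst₂ _∣_ (trans (sym (*-assoc (p ^ j) (p ^ (k ∸ j)) r′)) (cong (_* r′) (sym p^k≡))) n≡
            (∣-trans (*-monoʳ-∣ (p ^ j) p^*r′∣C) p^j*C∣n))

  -- Split off from `d` its full power of a prime `p`: a power of the Sylow generator has that
  -- order, induction supplies the cofactor, and commuting elements of coprime orders multiply.
  abelian⇒cyclic : CyclicSylows G → (∀ x y → Commute x y) → ∀ d → d ∣ n → ∃ λ x → HasOrder x d
  abelian⇒cyclic cyclic commutative = <-rec (λ d → d ∣ n → ∃ λ x → HasOrder x d) go
    where
    go : ∀ d → (∀ {c} → c < d → c ∣ n → ∃ λ x → HasOrder x c) → d ∣ n → ∃ λ x → HasOrder x d
    go zero rec 0∣n = contradiction (0∣⇒≡0 0∣n) (m<n⇒n≢0 1≤n)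
    go (suc zero) rec _ = ε , ε↑ 1 , λ k _ → 1∣ k
    go d@(suc (suc _)) rec d∣n with prime-divisor {d} (s≤s (s≤s z≤n))
    ... | p , pr , p∣d with prime-power-part {p} {d} pr (s≤s z≤n)
    ...   | zero , s , d≡ , p∤s = contradiction (subst (p ∣_) (trans d≡ (*-identityˡ s)) p∣d) p∤s
    ...   | suc e , s , d≡ , p∤s
      with prime-power-element G cyclic pr (suc e) (∣-trans (subst (p ^ suc e ∣_) (sym d≡) (m∣m*n s)) d∣n)
         | rec {s} s<d (∣-trans (subst (s ∣_) (sym d≡) (n∣m*n (p ^ suc e))) d∣n)
      where
      1≤s : 1 ≤ s
      1≤s = *-pos⁻¹ʳ {s} (p ^ suc e) (subst (1 ≤_) d≡ (s≤s z≤n))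
      s<d : s < d
      s<d = subst (s <_) (trans (*-comm s (p ^ suc e)) (sym d≡)) (m<m*n s (p ^ suc e) {{>-nonZero 1≤s}}
              (*-mono-≤ (prime≥2 pr) (^-pos (≤-trans (s≤s z≤n) (prime≥2 pr)) e)))
    ...     | x , x-order | y , y-order = x ∙ y , subst (HasOrder (x ∙ y)) (sym d≡)
                (order-∙ (commutative x y) (prime^-coprime pr p∤s (suc e)) x-order y-order)

  full-order⇒generates : ∀ {x} (A : Subgroup) → Mem A x → HasOrder x (size A) → ∀ {g} → Mem A g → Mem ⟪ x ⟫ g
  full-order⇒generates {x} A x∈ x-order {g} = count-⊆-≡ (mem? ⟪ x ⟫) (mem? A) (λ _ → ⟪⟫-⊆ A x∈)
    (≤-reflexive (sym (size-⟪⟫ x-order))) g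

  record AbelianNormal : Set₁ where
    field
      F       : Subgroup
      normal  : Normal F
      abelian : ∀ {x y} → Mem F x → Mem F y → Commute x y

  module _ (cyclic : CyclicSylows G) where

    module Enlarge (A : AbelianNormal) where
      open AbelianNormal A

      -- The centralizer of `F`.
      C : Subgroup
      C = record
        { Mem  = λ c → ∀ x → Mem F x → Commute c x
        ; mem? = λ c → all? λ x → mem? F x →-dec (c ∙ x ≟ᶠ x ∙ c)
        ; ε∈   = λ x _ → sym commute-ε
        ; ∙∈   = λ c∈ d∈ x x∈ → sym (commute-∙ (sym (c∈ x x∈)) (sym (d∈ x x∈)))
        ; ⁻¹∈  = λ c∈ x x∈ → sym (commute-⁻¹ (sym (c∈ x x∈))) }

      C-normal : Normal C
      C-normal g {c} c∈ x x∈ = ◃⇒commute (begin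
        (g ◃ c) ◃ x           ≡⟨ ◃-◃ (g ∙ c) (g ⁻¹) x ⟨
        (g ∙ c) ◃ (g ⁻¹ ◃ x)  ≡⟨ ◃-◃ g c _ ⟨
        g ◃ (c ◃ (g ⁻¹ ◃ x))  ≡⟨ cong (g ◃_) (commute⇒◃ (c∈ _ (normal (g ⁻¹) x∈))) ⟩
        g ◃ (g ⁻¹ ◃ x)        ≡⟨ ◃-⁻¹ g x ⟩
        x                     ∎)
        where open ≡-Reasoning

      F⊆C : ∀ {x} → Mem F x → Mem C x
      F⊆C x∈ y y∈ = abelian x∈ y∈

      open SectionProperties G (section G C F F⊆C λ {c} _ → normal c) F⊆C
      module ᴴ = GroupTheory H
      module C = Subgroup C

      cyclicᴴ : CyclicSylows H
      cyclicᴴ = section-cyclicSylows cyclic C F C-normal normal F⊆C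

      self-centralizing : index ≡ 1 → ∀ c → Mem C c → Mem F c
      self-centralizing index≡1 c c∈ = kernel⇒ c∈ (unique index≡1 (π c) εᴴ)
        where
        unique : ∀ {k} → k ≡ 1 → (i j : Fin k) → i ≡ j
        unique refl zero zero = refl

      -- For the largest prime `q` of the order of `C / F` the count is exact, so a subgroup of
      -- order `q` contains everything killed by `q`. Its preimage in `C` is thus the set where
      -- `x ↑ q` lies in `F`, which conjugation preserves, and it is abelian because it is generated
      -- by `F` and one element centralizing `F`.
      enlarge : index ≢ 1 → Σ AbelianNormal λ A′ → size F < size (AbelianNormal.F A′)
      enlarge index≢1 with greatest-prime-divisor {index} (≤∧≢⇒< ᴴ.1≤n (index≢1 ∘ sym))
      ... | q , (prq , q∣index@(divides r index≡)) , maximal with cauchy H prq q∣index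
      ...   | h , h-order = record { F = F′ ; normal = normal′ ; abelian = abelian′ } ,
          subst (size F <_) (sym size-F′) (m<n*m (prime≥2 prq) (Subgroup.1≤size F))
        where
        F′ = pullback ᴴ.⟪ h ⟫
        size-F′ : size F′ ≡ q * size F
        size-F′ = trans (size-pullback ᴴ.⟪ h ⟫) (cong (_* size F) (ᴴ.size-⟪⟫ h-order))
        m<n*m : ∀ {m n} → 2 ≤ n → 1 ≤ m → m < n * m
        m<n*m {m} {n} 2≤n 1≤m = subst (m <_) (*-comm m n) (m<m*n m n {{>-nonZero 1≤m}} 2≤n)
        torsion≡ : Torsion.torsion H q ≡ q
        torsion≡ = torsion-exact H cyclicᴴ r q index≡ λ p l prp p∣r prl l∣q →
          subst (p ≤_) (sym (prime-∣-prime prl prq l∣q)) (maximal p (prp , subst (p ∣_) (sym index≡) (∣m⇒∣m*n q p∣r)))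
        killed : ∀ {y} → ᴴ.Mem ᴴ.⟪ h ⟫ y → y ↑ᴴ q ≡ εᴴ
        killed y∈ with ᴴ.∈⟪⟫ y∈
        ... | i , refl = trans (ᴴ.↑-* h i q) (ᴴ.↑-∣ (proj₁ h-order) (n∣m*n i))
        killed⁻¹ : ∀ {y} → y ↑ᴴ q ≡ εᴴ → ᴴ.Mem ᴴ.⟪ h ⟫ y
        killed⁻¹ {y} = count-⊆-≡ (ᴴ.mem? ᴴ.⟪ h ⟫) (λ y → y ↑ᴴ q ≟ᶠ εᴴ) (λ _ → killed)
          (≤-reflexive (trans torsion≡ (sym (ᴴ.size-⟪⟫ h-order)))) y
        normal′ : Normal F′
        normal′ g {x} (x∈ , πx) = gx∈ , killed⁻¹ (trans (sym (π-↑ gx∈ q)) (kernel⇐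
          (subst (Mem F) (sym (◃-↑ g x q)) (normal g (kernel⇒ (C.↑∈ x∈ q) (trans (π-↑ x∈ q) (killed πx)))))))
          where
          gx∈ = C-normal g x∈
        z = ι h
        decompose : ∀ {x} → Mem F′ x → ∃₂ λ i f → Mem F f × x ≡ z ↑ i ∙ f
        decompose (x∈ , πx) with ᴴ.∈⟪⟫ πx
        ... | i , πx≡ with lift (C.↑∈ (ι∈ h) i) x∈ (trans (π-↑ (ι∈ h) i) (trans (cong (_↑ᴴ i) (π-ι h)) (sym πx≡)))
        ...   | f , f∈ , x≡ = i , f , f∈ , x≡
        abelian′ : ∀ {x y} → Mem F′ x → Mem F′ y → Commute x y
        abelian′ x∈ y∈ with decompose x∈ | decompose y∈
        ... | i , f , f∈ , refl | j , f′ , f′∈ , refl = commute-∙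
          (sym (commute-∙ (commute-↑↑ z j i) (C.↑∈ (ι∈ h) j f f∈)))
          (sym (commute-∙ (sym (C.↑∈ (ι∈ h) i f′ f′∈)) (abelian f′∈ f∈)))

      opaque
        progress : (∀ c → Mem C c → Mem F c) ⊎ Σ AbelianNormal λ A′ → size F < size (AbelianNormal.F A′)
        progress = decide (index ≟ⁿ 1)
          where
          decide : Dec (index ≡ 1) → (∀ c → Mem C c → Mem F c) ⊎ Σ AbelianNormal λ A′ → size F < size (AbelianNormal.F A′)
          decide (yes index≡1) = inj₁ (self-centralizing index≡1)
          decide (no index≢1) = inj₂ (enlarge index≢1)

    SelfCentralizing : Set₁
    SelfCentralizing = Σ AbelianNormal λ A → ∀ c → Mem (Enlarge.C A) c → Mem (AbelianNormal.F A) c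

    self-centralizing-abelianNormal : SelfCentralizing
    self-centralizing-abelianNormal = <-rec Goal go _ trivial-abelianNormal refl
      where
      Goal : ℕ → Set₁
      Goal k = ∀ A → n ∸ size (AbelianNormal.F A) ≡ k → SelfCentralizing
      go : ∀ k → (∀ {j} → j < k → Goal j) → Goal k
      go k rec A eq = resume (Enlarge.progress A)
        where
        resume : (∀ c → Mem (Enlarge.C A) c → Mem (AbelianNormal.F A) c) ⊎
                   (Σ AbelianNormal λ A′ → size (AbelianNormal.F A) < size (AbelianNormal.F A′)) → SelfCentralizing
        resume (inj₁ F-self-centralizing) = A , F-self-centralizing
        resume (inj₂ (A′ , F<F′)) = rec (subst (n ∸ size (AbelianNormal.F A′) <_) eq
          (∸-monoʳ-< F<F′ (∣⇒≤ {{>-nonZero 1≤n}} (lagrange-whole (AbelianNormal.F A′))))) A′ refl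
      trivial-abelianNormal : AbelianNormal
      trivial-abelianNormal = record
        { F = trivial ; normal = λ { g refl → ◃-ε g } ; abelian = λ { refl refl → refl } }

module _ {n : ℕ} (G : FinGroup n) where
  open GroupTheory G

  -- `independent` makes `t` the exact order of `b` modulo `⟪ a ⟫`. `thin` reserves the spare bit
  -- needed for sums of two residues modulo `m` and for the error of the approximate quotient.
  record Metacyclic : Set where
    field
      a b          : Fin n
      m t r s      : ℕ
      a-order      : HasOrder a m
      n≡t*m        : n ≡ t * m
      b◃a          : b ◃ a ≡ a ↑ r
      b↑t          : b ↑ t ≡ a ↑ s
      generating   : ∀ x → ∃₂ λ i j → x ≡ a ↑ i ∙ b ↑ j
      independent  : ∀ i j → b ↑ j ≡ a ↑ i → t ∣ j
      thin         : m ≡ 1 ⊎ 2 * m ≤ n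

  -- Here `⟪ a ⟫` is chosen trivial, because taking it to be the whole group would in general
  -- violate `thin`.
  cyclic⇒metacyclic : ∀ b → HasOrder b n → Metacyclic
  cyclic⇒metacyclic b b-order = record
    { a = ε ; b = b ; m = 1 ; t = n ; r = 0 ; s = 0
    ; a-order = ε↑ 1 , λ k _ → 1∣ k
    ; n≡t*m = sym (*-identityʳ n)
    ; b◃a = trans (◃-ε b) (sym (ε↑ 0))
    ; b↑t = trans (proj₁ b-order) (sym (ε↑ 0))
    ; generating = λ x → from-power (∈⟪⟫ (full-order⇒generates G whole tt (subst (HasOrder b) (sym size-whole) b-order) {x} tt))
    ; independent = λ i j eq → proj₂ b-order j (trans eq (ε↑ i))
    ; thin = inj₁ refl }
    where
    from-power : ∀ {x} → (∃ λ k → x ≡ b ↑ k) → ∃₂ λ i j → x ≡ ε ↑ i ∙ b ↑ j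
    from-power (k , x≡) = 0 , k , trans x≡ (sym (trans (cong (_∙ b ↑ k) (ε↑ 0)) (identityˡ _)))

  module _ (cyclic : CyclicSylows G) where
    private
      -- F is a maximal abelian normal subgroup. It is cyclic, being abelian
      -- with cyclic Sylow subgroups; G / F embeds in the abelian group Aut F,
      -- hence is cyclic for the same reason.
      module Structure (A : AbelianNormal G) (F-self-centralizing : ∀ c → Mem (Enlarge.C G cyclic A) c → Mem (AbelianNormal.F A) c) where
        open AbelianNormal A

        F-generator : ∃ λ a → Mem F a × HasOrder a (size F)
        F-generator = ι (proj₁ h) , ι∈ (proj₁ h) , ↑size , λ k eq → subst (_∣ k) index≡size
            (proj₂ (proj₂ h) k (trans (sym (power-image k)) (trans (cong π eq) π-ε)))
          where
          open TrivialSection G F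
          abelianᴴ : ∀ x y → x ∙ᴴ y ≡ y ∙ᴴ x
          abelianᴴ x y = begin
            x ∙ᴴ y                 ≡⟨ cong₂ _∙ᴴ_ (π-ι x) (π-ι y) ⟨
            π (ι x) ∙ᴴ π (ι y)     ≡⟨ π-∙ (ι∈ x) (ι∈ y) ⟨
            π (ι x ∙ ι y)          ≡⟨ cong π (abelian (ι∈ x) (ι∈ y)) ⟩
            π (ι y ∙ ι x)          ≡⟨ π-∙ (ι∈ y) (ι∈ x) ⟩
            π (ι y) ∙ᴴ π (ι x)     ≡⟨ cong₂ _∙ᴴ_ (π-ι y) (π-ι x) ⟩
            y ∙ᴴ x                 ∎
            where open ≡-Reasoning
          h : ∃ λ h → HasOrderᴴ h index
          h = abelian⇒cyclic H (section-cyclicSylows G cyclic F trivial normal trivial-normal ε∈C) abelianᴴ index ∣-refl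
          power-image : ∀ k → π (ι (proj₁ h) ↑ k) ≡ proj₁ h ↑ᴴ k
          power-image k = trans (π-↑ (ι∈ _) k) (cong (_↑ᴴ k) (π-ι _))
          ↑size : ι (proj₁ h) ↑ size F ≡ ε
          ↑size = subst (λ k → ι (proj₁ h) ↑ k ≡ ε) index≡size
            (kernel⇒ (Subgroup.↑∈ F (ι∈ _) index) (trans (power-image index) (proj₁ (proj₂ h))))

        a = proj₁ F-generator
        a∈ = proj₁ (proj₂ F-generator)
        a-order = proj₂ (proj₂ F-generator)

        F⇒power : ∀ {x} → Mem F x → ∃ λ k → x ≡ a ↑ k
        F⇒power x∈ = ∈⟪⟫ (full-order⇒generates G F a∈ a-order x∈)

        ◃-power : ∀ g → ∃ λ k → g ◃ a ≡ a ↑ k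
        ◃-power g = F⇒power (normal g a∈)

        -- Conjugations act on `⟪ a ⟫` as power maps, and exponents multiply commutatively.
        ◃-commute : ∀ x y → x ◃ (y ◃ a) ≡ y ◃ (x ◃ a)
        ◃-commute x y = trans (once x y) (trans (cong (a ↑_) (*-comm (κ x) (κ y))) (sym (once y x)))
          where
          κ : Fin n → ℕ
          κ g = proj₁ (◃-power g)
          once : ∀ x y → x ◃ (y ◃ a) ≡ a ↑ (κ x * κ y)
          once x y = begin
            x ◃ (y ◃ a)        ≡⟨ cong (x ◃_) (proj₂ (◃-power y)) ⟩
            x ◃ (a ↑ κ y)      ≡⟨ ◃-↑ x a (κ y) ⟨
            (x ◃ a) ↑ κ y      ≡⟨ cong (_↑ κ y) (proj₂ (◃-power x)) ⟩
            (a ↑ κ x) ↑ κ y    ≡⟨ ↑-* a (κ x) (κ y) ⟩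
            a ↑ (κ x * κ y)    ∎
            where open ≡-Reasoning

        -- The two products act alike on `a`, so their quotient centralizes `a`, hence all of `F`,
        -- and therefore lies in `F`.
        commutator∈F : ∀ x y → Mem F ((y ∙ x) ⁻¹ ∙ (x ∙ y))
        commutator∈F x y = F-self-centralizing c central
          where
          c = (y ∙ x) ⁻¹ ∙ (x ∙ y)
          c-a : Commute c a
          c-a = ◃⇒commute (trans (sym (◃-◃ ((y ∙ x) ⁻¹) (x ∙ y) a))
            (⁻¹-◃ (y ∙ x) (trans (sym (◃-◃ y x a)) (trans (◃-commute y x) (◃-◃ x y a)))))
          central : ∀ f → Mem F f → Commute c f
          central f f∈ = subst (Commute c) (sym (proj₂ (F⇒power f∈))) (commute-↑ c-a (proj₁ (F⇒power f∈)))

        open SectionProperties G (section G whole F (λ _ → tt) λ {c} _ → normal c) (λ _ → tt)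

        abelianᴴ : ∀ x y → x ∙ᴴ y ≡ y ∙ᴴ x
        abelianᴴ x y = begin
          x ∙ᴴ y                 ≡⟨ cong₂ _∙ᴴ_ (π-ι x) (π-ι y) ⟨
          π (ι x) ∙ᴴ π (ι y)     ≡⟨ π-∙ tt tt ⟨
          π (ι x ∙ ι y)          ≡⟨ π-≡⇐ tt tt (commutator∈F (ι x) (ι y)) ⟨
          π (ι y ∙ ι x)          ≡⟨ π-∙ tt tt ⟩
          π (ι y) ∙ᴴ π (ι x)     ≡⟨ cong₂ _∙ᴴ_ (π-ι y) (π-ι x) ⟩
          y ∙ᴴ x                 ∎
          where open ≡-Reasoning

        generator : ∃ λ h → HasOrderᴴ h index
        generator = abelian⇒cyclic H (section-cyclicSylows G cyclic whole F (λ _ _ → tt) normal (λ _ → tt)) abelianᴴ index ∣-refl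

        h = proj₁ generator
        h-order = proj₂ generator
        b = ι h

        power-image : ∀ k → π (b ↑ k) ≡ h ↑ᴴ k
        power-image k = trans (π-↑ tt k) (cong (_↑ᴴ k) (π-ι h))

        n≡ : n ≡ index * size F
        n≡ = trans (sym size-whole) size-section

        generating : ∀ x → ∃₂ λ i j → x ≡ a ↑ i ∙ b ↑ j
        generating x = from-power (GroupTheory.∈⟪⟫ H (full-order⇒generates H ᴴ.whole tt
            (subst (HasOrderᴴ h) (sym ᴴ.size-whole) h-order) {π x} tt))
          where
          module ᴴ = GroupTheory H
          from-power : (∃ λ j → π x ≡ h ↑ᴴ j) → ∃₂ λ i j → x ≡ a ↑ i ∙ b ↑ j
          from-power (j , πx≡) = proj₁ i , j , trans (sym (//-rightDividesˡ (b ↑ j) x)) (cong (_∙ b ↑ j) (proj₂ i))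
            where
            i : ∃ λ i → x ∙ (b ↑ j) ⁻¹ ≡ a ↑ i
            i = F⇒power (kernel⇒ tt (begin
              π (x ∙ (b ↑ j) ⁻¹)            ≡⟨ π-∙ tt tt ⟩
              π x ∙ᴴ π ((b ↑ j) ⁻¹)         ≡⟨ cong₂ _∙ᴴ_ πx≡ (trans (π-⁻¹ tt) (cong _⁻¹ᴴ (power-image j))) ⟩
              (h ↑ᴴ j) ∙ᴴ (h ↑ᴴ j) ⁻¹ᴴ      ≡⟨ ᴴ.inverseʳ _ ⟩
              εᴴ                            ∎))
              where open ≡-Reasoning

        metacyclic : index ≢ 1 → Metacyclic
        metacyclic index≢1 = record
          { a = a ; b = b ; m = size F ; t = index ; r = proj₁ (◃-power b) ; s = proj₁ b↑t
          ; a-order = a-order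
          ; n≡t*m = n≡
          ; b◃a = proj₂ (◃-power b)
          ; b↑t = proj₂ b↑t
          ; generating = generating
          ; independent = λ i j eq → proj₂ h-order j
              (trans (sym (power-image j)) (trans (cong π eq) (kernel⇐ (Subgroup.↑∈ F a∈ i))))
          ; thin = inj₂ (subst (2 * size F ≤_) (sym n≡) (*-monoˡ-≤ (size F) (≤∧≢⇒< (GroupTheory.1≤n H) (index≢1 ∘ sym)))) }
          where
          b↑t : ∃ λ k → b ↑ index ≡ a ↑ k
          b↑t = F⇒power (kernel⇒ tt (trans (power-image index) (proj₁ h-order)))

        cyclic-case : index ≡ 1 → HasOrder a n
        cyclic-case index≡1 = subst (HasOrder a) (sym (trans n≡ (trans (cong (_* size F) index≡1) (*-identityˡ _)))) a-order

        decide : Dec (index ≡ 1) → Metacyclic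
        decide (yes index≡1) = cyclic⇒metacyclic a (cyclic-case index≡1)
        decide (no index≢1) = metacyclic index≢1

    opaque
      metacyclic : Metacyclic
      metacyclic = Structure.decide (proj₁ (self-centralizing-abelianNormal G cyclic))
        (proj₂ (self-centralizing-abelianNormal G cyclic)) (_ ≟ⁿ 1)

-- Passage from the given group to one on an initial segment

subset : ∀ {n} {P : Fin n → Set} → Decidable P → Subset n
subset P? = tabulate (does ∘ P?)

∈-subset : ∀ {n} {P : Fin n → Set} (P? : Decidable P) {i} → P i → i ∈ˢ subset P?
∈-subset P? {i} pi = lookup⇒[]= i _ (trans (lookup∘tabulate (does ∘ P?) i) (does-true (P? i)))
  where
  does-true : (d : Dec _) → does d ≡ true
  does-true (yes _) = refl
  does-true (no ¬p) = contradiction pi ¬p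

subset-∈ : ∀ {n} {P : Fin n → Set} (P? : Decidable P) {i} → i ∈ˢ subset P? → P i
subset-∈ P? {i} i∈ = from-does (P? i) (trans (sym (lookup∘tabulate (does ∘ P?) i)) ([]=⇒lookup i∈))
  where
  from-does : (d : Dec _) → does d ≡ true → _
  from-does (yes p) _ = p

opaque
  unfolding count

  ∣subset∣ : ∀ {n} {P : Fin n → Set} (P? : Decidable P) → ∣ subset P? ∣ˢ ≡ count P?
  ∣subset∣ {zero} P? = refl
  ∣subset∣ {suc n} P? with P? zero
  ... | yes _ = cong suc (∣subset∣ (P? ∘ suc))
  ... | no  _ = ∣subset∣ (P? ∘ suc)

module Renumber {c ℓ : Level} (G : FiniteGroup c ℓ) where
  open FiniteGroup G using (Carrier; order; index; power; enumeration; IsCyclic)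
  private module 𝔾 = FiniteGroup G
  open Inverse enumeration using (from; strictlyInverseˡ; strictlyInverseʳ; to-cong)

  infixl 7 _∙ˢ_
  _∙ˢ_ : Fin order → Fin order → Fin order
  i ∙ˢ j = index (from i 𝔾.∙ from j)

  index-∙ : ∀ x y → index (x 𝔾.∙ y) ≡ index x ∙ˢ index y
  index-∙ x y = to-cong (𝔾.∙-cong (𝔾.sym (strictlyInverseʳ x)) (𝔾.sym (strictlyInverseʳ y)))

  index-⁻¹ : ∀ x → index (x 𝔾.⁻¹) ≡ index (from (index x) 𝔾.⁻¹)
  index-⁻¹ x = to-cong (𝔾.⁻¹-cong (𝔾.sym (strictlyInverseʳ x)))

  numbered : FinGroup order
  numbered = record
    { _∙_ = _∙ˢ_ ; ε = index 𝔾.ε ; _⁻¹ = λ i → index (from i 𝔾.⁻¹)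
    ; isGroup = record
      { isMonoid = record
        { isSemigroup = record
          { isMagma = record { isEquivalence = isEquivalence ; ∙-cong = cong₂ _∙ˢ_ }
          ; assoc = λ i j k → to-cong (𝔾.trans (𝔾.∙-congʳ (strictlyInverseʳ _))
              (𝔾.trans (𝔾.assoc _ _ _) (𝔾.∙-congˡ (𝔾.sym (strictlyInverseʳ _))))) }
        ; identity = (λ i → trans (to-cong (𝔾.trans (𝔾.∙-congʳ (strictlyInverseʳ _)) (𝔾.identityˡ _))) (strictlyInverseˡ i))
                   , (λ i → trans (to-cong (𝔾.trans (𝔾.∙-congˡ (strictlyInverseʳ _)) (𝔾.identityʳ _))) (strictlyInverseˡ i)) }
      ; inverse = (λ i → to-cong (𝔾.trans (𝔾.∙-congʳ (strictlyInverseʳ _)) (𝔾.inverseˡ _)))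
                , (λ i → to-cong (𝔾.trans (𝔾.∙-congˡ (strictlyInverseʳ _)) (𝔾.inverseʳ _)))
      ; ⁻¹-cong = cong (λ i → index (from i 𝔾.⁻¹)) } }

  open GroupTheory numbered hiding (order)

  opaque
    unfolding _↑_
    index-times : ∀ x n → index (power x (nonneg n)) ≡ index x ↑ n
    index-times x zero = refl
    index-times x (suc n) = trans (index-∙ x _) (cong (index x ∙ˢ_) (index-times x n))

  power∈⟪⟫ : ∀ x k → Mem ⟪ index x ⟫ (index (power x k))
  power∈⟪⟫ x (nonneg n) = subst (Mem ⟪ index x ⟫) (sym (index-times x n)) (↑∈⟪⟫ (index x) n)
  power∈⟪⟫ x -[1+ n ] = subst (Mem ⟪ index x ⟫) (sym (index-⁻¹ _)) (Subgroup.⁻¹∈ ⟪ index x ⟫ (power∈⟪⟫ x (nonneg (suc n))))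

  -- The Sylow subgroup from `sylow` becomes a subset of the enumeration, to which the Z-group
  -- hypothesis applies; the generator it yields has the size of the subgroup as its order.
  cyclicSylows : IsZGroup G → CyclicSylows numbered
  cyclicSylows zgroup p pr = from-sylow (sylow pr numbered)
    where
    from-sylow : (Σ Subgroup λ P → ∃₂ λ a r → size P ≡ p ^ a × order ≡ p ^ a * r × ¬ p ∣ r) →
      ∃ λ h → ∃₂ λ k r → HasOrder h (p ^ k) × order ≡ p ^ k * r × ¬ p ∣ r
    from-sylow (P , a , r , size≡ , order≡ , p∤r) = from-cyclic (zgroup p pr (subset (mem? P)) record
        { isSubgroup = record
          { ε-closed  = ∈-subset (mem? P) P.ε∈
          ; ∙-closed  = λ x y x∈ y∈ → ∈-subset (mem? P) (subst (Mem P) (sym (index-∙ x y))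
                          (P.∙∈ (subset-∈ (mem? P) x∈) (subset-∈ (mem? P) y∈)))
          ; ⁻¹-closed = λ x x∈ → ∈-subset (mem? P) (subst (Mem P) (sym (index-⁻¹ x)) (P.⁻¹∈ (subset-∈ (mem? P) x∈))) }
        ; exponent = a
        ; card = trans (∣subset∣ (mem? P)) size≡
        ; divides = subst (p ^ a ∣_) (sym order≡) (m∣m*n r)
        ; maximal = λ p^∣ → p∤r (*-cancelˡ-∣ (p ^ a) {{m^n≢0 p a {{prime⇒nonZero pr}}}}
            (subst₂ _∣_ (*-comm p (p ^ a)) order≡ p^∣)) })
      where
      module P = Subgroup P
      from-cyclic : IsCyclic (subset (mem? P)) → _
      from-cyclic (g , g∈ , generates) = index g , a , r ,
        subst (HasOrder (index g)) (trans (sym (size-⟪⟫ (ord-order (index g)))) (trans ⟪g⟫≡P size≡)) (ord-order (index g)) ,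
        order≡ , p∤r
        where
        P⊆⟪g⟫ : ∀ i → Mem P i → Mem ⟪ index g ⟫ i
        P⊆⟪g⟫ i i∈ with generates (from i) (∈-subset (mem? P) (subst (Mem P) (sym (strictlyInverseˡ i)) i∈))
        ... | k , eq = subst (Mem ⟪ index g ⟫) (trans (sym (to-cong eq)) (strictlyInverseˡ i)) (power∈⟪⟫ g k)
        ⟪g⟫≡P : size ⟪ index g ⟫ ≡ size P
        ⟪g⟫≡P = count-cong _ _ (λ i → ⟪⟫-⊆ P (subset-∈ (mem? P) g∈)) P⊆⟪g⟫

-- Word arithmetic and straight-line programs

module _ {n : ℕ} .{{_ : NonZero n}} where

  divmod-unique : ∀ q r q′ r′ → r < n → r′ < n → q * n + r ≡ q′ * n + r′ → q ≡ q′ × r ≡ r′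
  divmod-unique q r q′ r′ r<n r′<n eq = q≡q′ , r≡r′
    where
    open ≡-Reasoning
    residue : ∀ q r → r < n → (q * n + r) % n ≡ r
    residue q r r<n = begin
      (q * n + r) % n ≡⟨ cong (_% n) (+-comm (q * n) r) ⟩
      (r + q * n) % n ≡⟨ [m+kn]%n≡m%n r q n ⟩
      r % n           ≡⟨ m<n⇒m%n≡m r<n ⟩
      r               ∎
    r≡r′ = trans (sym (residue q r r<n)) (trans (cong (_% n) eq) (residue q′ r′ r′<n))
    q≡q′ = *-cancelʳ-≡ q q′ n (+-cancelʳ-≡ r (q * n) (q′ * n) (trans eq (cong (q′ * n +_) (sym r≡r′))))

  divmod : ∀ a → a ≡ a / n * n + a % n
  divmod a = trans (m≡m%n+[m/n]*n a n) (+-comm (a % n) _)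

  divmod-∃! : ∀ {a} q r → r < n → a ≡ q * n + r → q ≡ a / n × r ≡ a % n
  divmod-∃! {a} q r r<n a≡ = divmod-unique q r _ _ r<n (m%n<n a n) (trans (sym a≡) (divmod a))

module Words (w : ℕ) where
  W : ℕ
  W = 2 ^ w

  instance
    W-nonZero : NonZero W
    W-nonZero = m^n≢0 2 w

  ⌜_⌝ : ℕ → Word w
  ⌜ n ⌝ = wrap w n

  ⟦⌜⌝⟧ : ∀ n → ⟦ ⌜ n ⌝ ⟧ ≡ n % W
  ⟦⌜⌝⟧ n = toℕ-fromℕ< (m%n<n n W)

  ⟦⌜⌝⟧-small : ∀ {n} → n < W → ⟦ ⌜ n ⌝ ⟧ ≡ n
  ⟦⌜⌝⟧-small {n} n<W = trans (⟦⌜⌝⟧ n) (m<n⇒m%n≡m n<W)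

  ⌜⌝-cong : ∀ {a b} → a % W ≡ b % W → ⌜ a ⌝ ≡ ⌜ b ⌝
  ⌜⌝-cong {a} {b} eq = cong word (toℕ-injective (trans (⟦⌜⌝⟧ a) (trans eq (sym (⟦⌜⌝⟧ b)))))

  ⌜⌝-injective : ∀ {a b} → a < W → b < W → ⌜ a ⌝ ≡ ⌜ b ⌝ → a ≡ b
  ⌜⌝-injective a<W b<W eq = trans (sym (⟦⌜⌝⟧-small a<W)) (trans (cong ⟦_⟧ eq) (⟦⌜⌝⟧-small b<W))

  add-⌜⌝ : ∀ a b → evalBin add ⌜ a ⌝ ⌜ b ⌝ ≡ ⌜ a + b ⌝
  add-⌜⌝ a b = ⌜⌝-cong (trans (cong (_% W) (cong₂ _+_ (⟦⌜⌝⟧ a) (⟦⌜⌝⟧ b))) (sym (%-distribˡ-+ a b W)))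

  mul-⌜⌝ : ∀ a b → evalBin mul ⌜ a ⌝ ⌜ b ⌝ ≡ ⌜ a * b ⌝
  mul-⌜⌝ a b = ⌜⌝-cong (trans (cong (_% W) (cong₂ _*_ (⟦⌜⌝⟧ a) (⟦⌜⌝⟧ b))) (sym (%-distribˡ-* a b W)))

  -- Neither `a` nor `b` has to fit into a word: wrapping respects differences, so `e` is obtained
  -- exactly whenever `e` itself fits.
  sub-⌜⌝ : ∀ {a b e} → e + b ≡ a → evalBin sub ⌜ a ⌝ ⌜ b ⌝ ≡ ⌜ e ⌝
  sub-⌜⌝ {_} {b} {e} refl = ⌜⌝-cong (begin
    (⟦ ⌜ e + b ⌝ ⟧ + (W ∸ ⟦ ⌜ b ⌝ ⟧)) % W ≡⟨ cong₂ (λ x y → (x + (W ∸ y)) % W) (⟦⌜⌝⟧ (e + b)) (⟦⌜⌝⟧ b) ⟩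
    ((e + b) % W + (W ∸ b % W)) % W       ≡⟨ %-distribˡ-+ ((e + b) % W) _ W ⟩
    ((e + b) % W % W + (W ∸ b % W) % W) % W ≡⟨ cong (λ x → (x + (W ∸ b % W) % W) % W) (m%n%n≡m%n (e + b) W) ⟩
    ((e + b) % W + (W ∸ b % W) % W) % W   ≡⟨ %-distribˡ-+ (e + b) _ W ⟨
    (e + b + (W ∸ b % W)) % W             ≡⟨ cong (_% W) total ⟩
    (e + suc (b / W) * W) % W             ≡⟨ [m+kn]%n≡m%n e (suc (b / W)) W ⟩
    e % W                                 ∎)
    where
    open ≡-Reasoning
    arith : ∀ e x y z → e + (x + y) + z ≡ e + ((y + z) + x)
    arith = solve-∀
    total : e + b + (W ∸ b % W) ≡ e + suc (b / W) * W
    total = begin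
      e + b + (W ∸ b % W)                       ≡⟨ cong (λ x → e + x + (W ∸ b % W)) (divmod b) ⟩
      e + (b / W * W + b % W) + (W ∸ b % W)     ≡⟨ arith e (b / W * W) (b % W) (W ∸ b % W) ⟩
      e + ((b % W + (W ∸ b % W)) + b / W * W)   ≡⟨ cong (λ x → e + (x + b / W * W)) (m+[n∸m]≡n (m%n≤n b W)) ⟩
      e + suc (b / W) * W                       ∎

  div-⌜⌝ : ∀ {a b} .{{_ : NonZero b}} → a < W → b < W → evalBin div ⌜ a ⌝ ⌜ b ⌝ ≡ ⌜ a / b ⌝
  div-⌜⌝ {a} {b@(suc _)} a<W b<W = cong (wrap w) (cong₂ Defs.quotient (⟦⌜⌝⟧-small a<W) (⟦⌜⌝⟧-small b<W))

  rem-⌜⌝ : ∀ {a b} .{{_ : NonZero b}} → a < W → b < W → evalBin rem ⌜ a ⌝ ⌜ b ⌝ ≡ ⌜ a % b ⌝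
  rem-⌜⌝ {a} {b@(suc _)} a<W b<W = cong (wrap w) (cong₂ Defs.remainder (⟦⌜⌝⟧-small a<W) (⟦⌜⌝⟧-small b<W))

  less-⌜⌝ : ∀ {a b} → a < W → b < W → evalBin less ⌜ a ⌝ ⌜ b ⌝ ≡ ⌜ if a <ᵇ b then 1 else 0 ⌝
  less-⌜⌝ a<W b<W = cong₂ (λ x y → wrap w (if x <ᵇ y then 1 else 0)) (⟦⌜⌝⟧-small a<W) (⟦⌜⌝⟧-small b<W)

module _ {s : ℕ} where

  calc : BinOp → Fin s → Fin s → Fin s → Instruction
  calc op k i j = binary op (direct (toℕ k)) (at (direct (toℕ i))) (at (direct (toℕ j)))

  copy : Fin s → Fin s → Instruction
  copy k i = move (direct (toℕ k)) (at (direct (toℕ i)))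

  cell-toℕ : ∀ (k : Fin s) → cell (toℕ k) ≡ just k
  cell-toℕ k with toℕ k <? s
  ... | yes k<s = cong just (fromℕ<-toℕ k k<s)
  ... | no k≮s = contradiction (toℕ<n k) k≮s

  module _ {w : ℕ} where

    -- Each instruction must act alike at every program counter, so blocks can be placed anywhere;
    -- with no jumps the running time is the length of the code.
    data Straight : List Instruction → Memory w s → Memory w s → Set where
      done : ∀ {mem} → Straight [] mem mem
      then : ∀ {i is mem mem′ mem″} → (∀ pc → execute i (pc , mem) ≡ just (continue (suc pc , mem′))) →
             Straight is mem′ mem″ → Straight (i ∷ is) mem mem″

    execute-calc : ∀ op k i j (mem : Memory w s) {v} → evalBin op (lookup mem i) (lookup mem j) ≡ v →
                   ∀ pc → execute (calc op k i j) (pc , mem) ≡ just (continue (suc pc , mem [ k ]≔ v))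
    execute-calc op k i j mem refl pc rewrite cell-toℕ i | cell-toℕ j | cell-toℕ k = refl

    execute-copy : ∀ k i (mem : Memory w s) → ∀ pc → execute (copy k i) (pc , mem) ≡ just (continue (suc pc , mem [ k ]≔ lookup mem i))
    execute-copy k i mem pc rewrite cell-toℕ i | cell-toℕ k = refl

    straight-halts : ∀ {P is} {mem mem′ : Memory w s} pc → drop pc P ≡ is ++ˡ (halt ∷ []) → Straight is mem mem′ →
                     P ⊢ (pc , mem) ⇓[ suc (length is) ] mem′
    straight-halts {P} pc rest done = stop (fetch-instruction P pc rest)
      where
      fetch-instruction : ∀ P pc → drop pc P ≡ halt ∷ [] → ∀ {mem : Memory w s} → step P (pc , mem) ≡ just (halted mem)
      fetch-instruction P pc eq rewrite eq = refl
    straight-halts {P} pc rest (then {i} ex is) = next (fetched P pc rest (ex pc)) (straight-halts (suc pc) (drop-suc P pc rest) is)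
      where
      fetched : ∀ P pc {is mem o} → drop pc P ≡ i ∷ is → execute i (pc , mem) ≡ just o → step {w} {s} P (pc , mem) ≡ just o
      fetched P pc eq ex rewrite eq = ex
      drop-suc : ∀ (P : Program) pc {is} → drop pc P ≡ i ∷ is → drop (suc pc) P ≡ is
      drop-suc (_ ∷ P) zero refl = refl
      drop-suc (_ ∷ P) (suc pc) eq = drop-suc P pc eq
      drop-suc [] zero ()
      drop-suc [] (suc pc) ()

-- Modular multiplication by a stored reciprocal

-- For x < m and Q = ⌊ρ B² / m⌋, the high half of Q x in base B² misses the
-- quotient of ρ x by m by at most one.
module Reciprocal (m B ρ Q S : ℕ) .{{_ : NonZero m}} .{{_ : NonZero B}}
  (S<m : S < m) (ρ<m : ρ < m) (m≤B² : m ≤ B * B) (Q-spec : Q * m + S ≡ ρ * (B * B)) where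

  Q<B² : Q < B * B
  Q<B² = *-cancelʳ-< m Q (B * B) (begin-strict
    Q * m          ≤⟨ m≤m+n (Q * m) S ⟩
    Q * m + S      ≡⟨ Q-spec ⟩
    ρ * (B * B)    <⟨ *-monoˡ-< (B * B) {{>-nonZero (≤-trans (≤-<-trans z≤n S<m) m≤B²)}} ρ<m ⟩
    m * (B * B)    ≡⟨ *-comm m (B * B) ⟩
    B * B * m      ∎)
    where open ≤-Reasoning

  a₁ = Q / B
  a₀ = Q % B

  module _ (x : ℕ) (x<m : x < m) where
    b₁ = x / B
    b₀ = x % B
    -- Schoolbook multiplication of `Q` by `x` in base `B`. The carries are added one at a time so
    -- that `u` and `v` stay below `B * B` and can be split by a word division.
    t  = a₀ * b₀ / B
    u  = a₁ * b₀ + t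
    v  = a₀ * b₁ + u % B
    hi = a₁ * b₁ + u / B + v / B
    lo = v % B * B + a₀ * b₀ % B

    x<B² : x < B * B
    x<B² = <-≤-trans x<m m≤B²

    a₁<B : a₁ < B
    a₁<B = m<n*o⇒m/o<n Q<B²

    b₁<B : b₁ < B
    b₁<B = m<n*o⇒m/o<n x<B²

    a₀<B = m%n<n Q B
    b₀<B = m%n<n x B

    product<B² : ∀ {x y} → x < B → y < B → x * y < B * B
    product<B² {x} {y} x<B y<B = ≤-<-trans (*-monoʳ-≤ x (<⇒≤ y<B)) (*-monoˡ-< B x<B)

    multiply-add<B² : ∀ {x y z} → x < B → y < B → z < B → x * y + z < B * B
    multiply-add<B² {x} {y} {z} x<B y<B z<B = begin-strict
      x * y + z   <⟨ +-mono-≤-< (*-monoʳ-≤ x (<⇒≤ y<B)) z<B ⟩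
      x * B + B   ≡⟨ +-comm (x * B) B ⟩
      suc x * B   ≤⟨ *-monoˡ-≤ B x<B ⟩
      B * B       ∎
      where open ≤-Reasoning

    a₀b₀<B² = product<B² a₀<B b₀<B

    t<B : t < B
    t<B = m<n*o⇒m/o<n a₀b₀<B²

    u<B² : u < B * B
    u<B² = multiply-add<B² a₁<B b₀<B t<B

    v<B² : v < B * B
    v<B² = multiply-add<B² a₀<B b₁<B (m%n<n u B)

    lo<B² : lo < B * B
    lo<B² = ≤-trans (+-monoʳ-< (v % B * B) (m%n<n (a₀ * b₀) B))
      (≤-trans (≤-reflexive (+-comm (v % B * B) B)) (*-monoˡ-≤ B (m%n<n v B)))

    high-low : Q * x ≡ hi * (B * B) + lo
    high-low = begin
      Q * x
        ≡⟨ cong₂ _*_ (divmod Q) (divmod x) ⟩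
      (a₁ * B + a₀) * (b₁ * B + b₀)
        ≡⟨ expand a₁ a₀ b₁ b₀ B ⟩
      a₁ * b₁ * (B * B) + (a₁ * b₀ + a₀ * b₁) * B + a₀ * b₀
        ≡⟨ cong (a₁ * b₁ * (B * B) + (a₁ * b₀ + a₀ * b₁) * B +_) (divmod (a₀ * b₀)) ⟩
      a₁ * b₁ * (B * B) + (a₁ * b₀ + a₀ * b₁) * B + (t * B + l)
        ≡⟨ gather₁ (a₁ * b₁) (a₁ * b₀) (a₀ * b₁) t B l ⟩
      a₁ * b₁ * (B * B) + (a₀ * b₁ + u) * B + l
        ≡⟨ cong (λ z → a₁ * b₁ * (B * B) + (a₀ * b₁ + z) * B + l) (divmod u) ⟩
      a₁ * b₁ * (B * B) + (a₀ * b₁ + (u / B * B + u % B)) * B + l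
        ≡⟨ gather₂ (a₁ * b₁) (a₀ * b₁) (u / B) (u % B) B l ⟩
      (a₁ * b₁ + u / B) * (B * B) + v * B + l
        ≡⟨ cong (λ z → (a₁ * b₁ + u / B) * (B * B) + z * B + l) (divmod v) ⟩
      (a₁ * b₁ + u / B) * (B * B) + (v / B * B + v % B) * B + l
        ≡⟨ gather₃ (a₁ * b₁ + u / B) (v / B) (v % B) B l ⟩
      hi * (B * B) + lo ∎
      where
      open ≡-Reasoning
      l = a₀ * b₀ % B
      expand : ∀ a c b d B → (a * B + c) * (b * B + d) ≡ a * b * (B * B) + (a * d + c * b) * B + c * d
      expand = solve-∀
      gather₁ : ∀ x y z t B l → x * (B * B) + (y + z) * B + (t * B + l) ≡ x * (B * B) + (z + (y + t)) * B + l
      gather₁ = solve-∀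
      gather₂ : ∀ x y h r B l → x * (B * B) + (y + (h * B + r)) * B + l ≡ (x + h) * (B * B) + (y + r) * B + l
      gather₂ = solve-∀
      gather₃ : ∀ x h r B l → x * (B * B) + (h * B + r) * B + l ≡ (x + h) * (B * B) + (r * B + l)
      gather₃ = solve-∀

    scaled : ρ * x * (B * B) ≡ hi * m * (B * B) + (lo * m + S * x)
    scaled = begin
      ρ * x * (B * B)               ≡⟨ swap ρ x (B * B) ⟩
      ρ * (B * B) * x               ≡⟨ cong (_* x) Q-spec ⟨
      (Q * m + S) * x               ≡⟨ distribute Q m S x ⟩
      Q * x * m + S * x             ≡⟨ cong (λ z → z * m + S * x) high-low ⟩
      (hi * (B * B) + lo) * m + S * x ≡⟨ collect hi (B * B) lo m (S * x) ⟩
      hi * m * (B * B) + (lo * m + S * x) ∎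
      where
      open ≡-Reasoning
      swap : ∀ a b c → a * b * c ≡ a * c * b
      swap = solve-∀
      distribute : ∀ Q m S x → (Q * m + S) * x ≡ Q * x * m + S * x
      distribute = solve-∀
      collect : ∀ h R l m y → (h * R + l) * m + y ≡ h * m * R + (l * m + y)
      collect = solve-∀

    private
      instance
        B²-nonZero : NonZero (B * B)
        B²-nonZero = m*n≢0 B B

    hi*m≤ρx : hi * m ≤ ρ * x
    hi*m≤ρx = *-cancelʳ-≤ (hi * m) (ρ * x) (B * B) (≤-trans (m≤m+n _ _) (≤-reflexive (sym scaled)))

    err : ℕ
    err = ρ * x ∸ hi * m

    err-spec : err + hi * m ≡ ρ * x
    err-spec = m∸n+n≡m hi*m≤ρx

    -- Scaled by `B * B`, the error is `lo * m + S * x`: the discarded low half of `Q * x`, and the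
    -- rounding in `Q`. Each contributes at most `m * (B * B)`, the first strictly less.
    err<2m : err < 2 * m
    err<2m = *-cancelʳ-< (B * B) err (2 * m) (begin-strict
      err * (B * B)          ≡⟨ +-cancelˡ-≡ (hi * m * (B * B)) _ _ (trans (trans (+-comm _ (err * (B * B)))
                                  (trans (sym (*-distribʳ-+ (B * B) err (hi * m))) (cong (_* (B * B)) err-spec))) scaled) ⟩
      lo * m + S * x         <⟨ +-mono-<-≤ (*-monoˡ-< m lo<B²) (*-mono-≤ (<⇒≤ S<m) (<⇒≤ x<B²)) ⟩
      B * B * m + m * (B * B) ≡⟨ twice (B * B) m ⟩
      2 * m * (B * B)        ∎)
      where
      open ≤-Reasoning
      twice : ∀ b m → b * m + m * b ≡ 2 * m * b
      twice = solve-∀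

    quotient-remainder : hi + err / m ≡ ρ * x / m × err % m ≡ ρ * x % m
    quotient-remainder = divmod-∃! (hi + err / m) (err % m) (m%n<n err m) (begin
      ρ * x                                  ≡⟨ err-spec ⟨
      err + hi * m                           ≡⟨ cong (_+ hi * m) (divmod err) ⟩
      err / m * m + err % m + hi * m         ≡⟨ shuffle (err / m) m (err % m) hi ⟩
      (hi + err / m) * m + err % m           ∎)
      where
      open ≡-Reasoning
      shuffle : ∀ q m r h → q * m + r + h * m ≡ (h + q) * m + r
      shuffle = solve-∀

-- The query program and its execution

-- Cells: 0–3 hold m, t, s, B; 4–7 and 8–11 hold the labels (i, j, ρ, Q) of the
-- factors; 12 and 13 hold the half-words of Q.  The block leaves the quotient
-- and the remainder of ρ x by m, for x in cell 14, in cells 15 and 16.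
multiply-mod : List Instruction
multiply-mod =
  calc {27} div (# 17) (# 14) (# 3) ∷
  calc {27} rem (# 18) (# 14) (# 3) ∷
  calc {27} mul (# 19) (# 13) (# 18) ∷
  calc {27} div (# 19) (# 19) (# 3) ∷
  calc {27} mul (# 20) (# 12) (# 18) ∷
  calc {27} add (# 20) (# 20) (# 19) ∷
  calc {27} mul (# 21) (# 13) (# 17) ∷
  calc {27} rem (# 19) (# 20) (# 3) ∷
  calc {27} add (# 21) (# 21) (# 19) ∷
  calc {27} div (# 20) (# 20) (# 3) ∷
  calc {27} div (# 21) (# 21) (# 3) ∷
  calc {27} mul (# 15) (# 12) (# 17) ∷
  calc {27} add (# 15) (# 15) (# 20) ∷
  calc {27} add (# 15) (# 15) (# 21) ∷
  -- This product and the next may both wrap, yet their difference is below `2 * m` and thus exact;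
  -- one division by `m` then corrects the quotient by 0 or 1.
  calc {27} mul (# 16) (# 6) (# 14) ∷
  calc {27} mul (# 19) (# 15) (# 0) ∷
  calc {27} sub (# 16) (# 16) (# 19) ∷
  calc {27} div (# 19) (# 16) (# 0) ∷
  calc {27} add (# 15) (# 15) (# 19) ∷
  calc {27} rem (# 16) (# 16) (# 0) ∷ []

-- Branch-free: the outcome of the carry test enters as a factor 0 or 1, so every query executes the
-- same instructions.
product-code : List Instruction
product-code =
  calc {27} div (# 12) (# 7) (# 3) ∷
  calc {27} rem (# 13) (# 7) (# 3) ∷
  copy {27} (# 14) (# 8) ∷ multiply-mod ++ˡ
  (copy {27} (# 22) (# 16) ∷
  copy {27} (# 14) (# 10) ∷ multiply-mod ++ˡ
  (copy {27} (# 23) (# 15) ∷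
  copy {27} (# 24) (# 16) ∷
  -- The residue of `ρ₂ * (B * B)` modulo `m` is recovered as a difference of wrapped numbers, its
  -- quotient `Q₂` being stored.
  calc {27} mul (# 14) (# 10) (# 3) ∷
  calc {27} mul (# 14) (# 14) (# 3) ∷
  calc {27} mul (# 15) (# 11) (# 0) ∷
  calc {27} sub (# 14) (# 14) (# 15) ∷ multiply-mod ++ˡ
  -- The updated reciprocal, by the identity of `scaled-quotient-product`; only its final value has
  -- to fit into a word.
  (calc {27} mul (# 7) (# 6) (# 11) ∷
  calc {27} add (# 7) (# 7) (# 15) ∷
  calc {27} mul (# 23) (# 23) (# 3) ∷
  calc {27} mul (# 23) (# 23) (# 3) ∷
  calc {27} sub (# 7) (# 7) (# 23) ∷
  copy {27} (# 6) (# 24) ∷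
  calc {27} add (# 4) (# 4) (# 22) ∷
  calc {27} rem (# 4) (# 4) (# 0) ∷
  -- `j₁` is compared with `t - j₂` because `j₁ + j₂` might exceed a word. Cell 26 receives 1
  -- exactly when nothing is carried.
  calc {27} sub (# 25) (# 1) (# 9) ∷
  calc {27} less (# 26) (# 5) (# 25) ∷
  calc {27} mul (# 14) (# 26) (# 1) ∷
  calc {27} add (# 5) (# 5) (# 14) ∷
  calc {27} sub (# 5) (# 5) (# 25) ∷
  calc {27} mul (# 14) (# 26) (# 2) ∷
  calc {27} sub (# 14) (# 2) (# 14) ∷
  calc {27} add (# 4) (# 4) (# 14) ∷
  calc {27} rem (# 4) (# 4) (# 0) ∷ [])))

product-program : Program
product-program = product-code ++ˡ (halt ∷ [])

module Execution (w : ℕ) (final : Vec (Word w) 8) where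
  open Words w

  Runs : List Instruction → Memory w 27 → Set
  Runs is mem = ∃ λ (rest : Vec (Word w) 19) → Straight is mem (final ++ rest)

  infixr 1 _▸_
  _▸_ : ∀ {op k i j is} {mem : Memory w 27} {v} → evalBin op (lookup mem i) (lookup mem j) ≡ v →
        Runs is (mem [ k ]≔ v) → Runs (calc op k i j ∷ is) mem
  _▸_ {op} {k} {i} {j} {mem = mem} eq (rest , s) = rest , then (execute-calc op k i j mem eq) s

  copied : ∀ {k i is} {mem : Memory w 27} → Runs is (mem [ k ]≔ lookup mem i) → Runs (copy k i ∷ is) mem
  copied {k} {i} {mem = mem} (rest , s) = rest , then (execute-copy k i mem) s

  module Block (m B ρ Q S : ℕ) .{{_ : NonZero m}} .{{_ : NonZero B}}
    (S<m : S < m) (ρ<m : ρ < m) (m≤B² : m ≤ B * B) (Q-spec : Q * m + S ≡ ρ * (B * B))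
    (B<W : B < W) (B²≤W : B * B ≤ W) (2m≤W : 2 * m ≤ W) where
    open Reciprocal m B ρ Q S S<m ρ<m m≤B² Q-spec

    m<W : m < W
    m<W = <-≤-trans (m<m+n m (≤-trans (≤-<-trans z≤n ρ<m) (m≤m+n m 0))) 2m≤W

    -- The remaining run is a continuation, valid for arbitrary contents of the working cells, so
    -- that the block can be entered three times.
    multiply-mod-runs : ∀ x → x < m → ∀ {c1 c2 c4 c5 c7 c8 c9 c10 c11 c15 c16 c17 c18 c19 c20 c21 : Word w} {rest is} →
      (∀ {c17 c18 c19 c20 c21 : Word w} →
        Runs is (⌜ m ⌝ ∷ c1 ∷ c2 ∷ ⌜ B ⌝ ∷ c4 ∷ c5 ∷ ⌜ ρ ⌝ ∷ c7 ∷ c8 ∷ c9 ∷ c10 ∷ c11 ∷ ⌜ a₁ ⌝ ∷ ⌜ a₀ ⌝ ∷ ⌜ x ⌝ ∷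
                 ⌜ ρ * x / m ⌝ ∷ ⌜ ρ * x % m ⌝ ∷ c17 ∷ c18 ∷ c19 ∷ c20 ∷ c21 ∷ rest)) →
      Runs (multiply-mod ++ˡ is)
           (⌜ m ⌝ ∷ c1 ∷ c2 ∷ ⌜ B ⌝ ∷ c4 ∷ c5 ∷ ⌜ ρ ⌝ ∷ c7 ∷ c8 ∷ c9 ∷ c10 ∷ c11 ∷ ⌜ a₁ ⌝ ∷ ⌜ a₀ ⌝ ∷ ⌜ x ⌝ ∷
                 c15 ∷ c16 ∷ c17 ∷ c18 ∷ c19 ∷ c20 ∷ c21 ∷ rest)
    multiply-mod-runs x x<m k =
      div-⌜⌝ x<W B<W ▸
      rem-⌜⌝ x<W B<W ▸
      mul-⌜⌝ a₀ (b₀ x x<m) ▸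
      div-⌜⌝ (<-≤-trans (a₀b₀<B² x x<m) B²≤W) B<W ▸
      mul-⌜⌝ a₁ (b₀ x x<m) ▸
      add-⌜⌝ (a₁ * b₀ x x<m) (t x x<m) ▸
      mul-⌜⌝ a₀ (b₁ x x<m) ▸
      rem-⌜⌝ (<-≤-trans (u<B² x x<m) B²≤W) B<W ▸
      add-⌜⌝ (a₀ * b₁ x x<m) (u x x<m % B) ▸
      div-⌜⌝ (<-≤-trans (u<B² x x<m) B²≤W) B<W ▸
      div-⌜⌝ (<-≤-trans (v<B² x x<m) B²≤W) B<W ▸
      mul-⌜⌝ a₁ (b₁ x x<m) ▸
      add-⌜⌝ (a₁ * b₁ x x<m) (u x x<m / B) ▸
      add-⌜⌝ (a₁ * b₁ x x<m + u x x<m / B) (v x x<m / B) ▸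
      mul-⌜⌝ ρ x ▸
      mul-⌜⌝ (hi x x<m) m ▸
      sub-⌜⌝ (err-spec x x<m) ▸
      div-⌜⌝ (<-≤-trans (err<2m x x<m) 2m≤W) m<W ▸
      trans (add-⌜⌝ (hi x x<m) (err x x<m / m)) (cong ⌜_⌝ (proj₁ (quotient-remainder x x<m))) ▸
      trans (rem-⌜⌝ (<-≤-trans (err<2m x x<m) 2m≤W) m<W) (cong ⌜_⌝ (proj₂ (quotient-remainder x x<m))) ▸
      k
      where
      x<W : x < W
      x<W = <-trans x<m m<W

module Product (w : ℕ) (m t s B : ℕ) .{{_ : NonZero m}} .{{_ : NonZero B}}
  (m≤B² : m ≤ B * B) (B<W : B < 2 ^ w) (B²≤W : B * B ≤ 2 ^ w) (2m≤W : 2 * m ≤ 2 ^ w)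
  (t<W : t < 2 ^ w) (s<m : s < m)
  {i₁ j₁ ρ₁ Q₁ S₁ i₂ j₂ ρ₂ Q₂ S₂ : ℕ}
  (i₁<m : i₁ < m) (i₂<m : i₂ < m) (j₁<t : j₁ < t) (ρ₁<m : ρ₁ < m) (ρ₂<m : ρ₂ < m) (S₁<m : S₁ < m) (S₂<m : S₂ < m)
  (Q₁-spec : Q₁ * m + S₁ ≡ ρ₁ * (B * B)) (Q₂-spec : Q₂ * m + S₂ ≡ ρ₂ * (B * B))
  {d c e j′ Q′ : ℕ}
  (d-spec : d + j₂ ≡ t) (c-spec : (if j₁ <ᵇ d then 1 else 0) ≡ c) (e-spec : e + c * s ≡ s)
  (j′-spec : j′ + d ≡ j₁ + c * t)
  (Q′-spec : Q′ + ρ₁ * ρ₂ / m * B * B ≡ ρ₁ * Q₂ + ρ₁ * S₂ / m) where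
  open Words w

  i′ : ℕ
  i′ = ((i₁ + ρ₁ * i₂ % m) % m + e) % m

  open Execution w (⌜ m ⌝ ∷ ⌜ t ⌝ ∷ ⌜ s ⌝ ∷ ⌜ B ⌝ ∷ ⌜ i′ ⌝ ∷ ⌜ j′ ⌝ ∷ ⌜ ρ₁ * ρ₂ % m ⌝ ∷ ⌜ Q′ ⌝ ∷ [])
  open Block m B ρ₁ Q₁ S₁ S₁<m ρ₁<m m≤B² Q₁-spec B<W B²≤W 2m≤W

  private
    sum<W : ∀ {x y} → x < m → y < m → x + y < W
    sum<W {x} {y} x<m y<m = <-≤-trans (subst (x + y <_) (cong (m +_) (sym (+-identityʳ m))) (+-mono-< x<m y<m)) 2m≤W

    Q₁<W : Q₁ < W
    Q₁<W = <-≤-trans (Reciprocal.Q<B² m B ρ₁ Q₁ S₁ S₁<m ρ₁<m m≤B² Q₁-spec) B²≤W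

    d≤t : d ≤ t
    d≤t = subst (d ≤_) d-spec (m≤m+n d j₂)

    e<m : e < m
    e<m = ≤-<-trans (subst (e ≤_) e-spec (m≤m+n e (c * s))) s<m

    S₂-spec : S₂ + Q₂ * m ≡ ρ₂ * B * B
    S₂-spec = trans (+-comm S₂ _) (trans Q₂-spec (sym (*-assoc ρ₂ B B)))

  product-runs : ∀ (scratch : Vec (Word w) 15) → Runs product-code
    (⌜ m ⌝ ∷ ⌜ t ⌝ ∷ ⌜ s ⌝ ∷ ⌜ B ⌝ ∷ ⌜ i₁ ⌝ ∷ ⌜ j₁ ⌝ ∷ ⌜ ρ₁ ⌝ ∷ ⌜ Q₁ ⌝ ∷ ⌜ i₂ ⌝ ∷ ⌜ j₂ ⌝ ∷ ⌜ ρ₂ ⌝ ∷ ⌜ Q₂ ⌝ ∷ scratch)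
  product-runs (_ ∷ _ ∷ _ ∷ _ ∷ _ ∷ _ ∷ _ ∷ _ ∷ _ ∷ _ ∷ _ ∷ _ ∷ _ ∷ _ ∷ _ ∷ []) =
    div-⌜⌝ Q₁<W B<W ▸
    rem-⌜⌝ Q₁<W B<W ▸
    copied (multiply-mod-runs i₂ i₂<m
    (copied
    (copied (multiply-mod-runs ρ₂ ρ₂<m
    (copied
    (copied
    (mul-⌜⌝ ρ₂ B ▸
    mul-⌜⌝ (ρ₂ * B) B ▸
    mul-⌜⌝ Q₂ m ▸
    sub-⌜⌝ S₂-spec ▸
    multiply-mod-runs S₂ S₂<m
    (mul-⌜⌝ ρ₁ Q₂ ▸
    add-⌜⌝ (ρ₁ * Q₂) (ρ₁ * S₂ / m) ▸
    mul-⌜⌝ (ρ₁ * ρ₂ / m) B ▸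
    mul-⌜⌝ (ρ₁ * ρ₂ / m * B) B ▸
    sub-⌜⌝ Q′-spec ▸
    copied
    (add-⌜⌝ i₁ (ρ₁ * i₂ % m) ▸
    rem-⌜⌝ (sum<W i₁<m (m%n<n (ρ₁ * i₂) m)) m<W ▸
    sub-⌜⌝ d-spec ▸
    trans (less-⌜⌝ (<-trans j₁<t t<W) (≤-<-trans d≤t t<W)) (cong ⌜_⌝ c-spec) ▸
    mul-⌜⌝ c t ▸
    add-⌜⌝ j₁ (c * t) ▸
    sub-⌜⌝ j′-spec ▸
    mul-⌜⌝ c s ▸
    sub-⌜⌝ e-spec ▸
    add-⌜⌝ ((i₁ + ρ₁ * i₂ % m) % m) e ▸
    rem-⌜⌝ (sum<W (m%n<n (i₁ + ρ₁ * i₂ % m) m) e<m) m<W ▸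
    (_ , done))))))))))

-- Labels

module Coordinates {n : ℕ} (G : FinGroup n) (M : Metacyclic G) where
  open GroupTheory G
  open Metacyclic M
  open ≡-Reasoning

  1≤m : 1 ≤ m
  1≤m = *-pos⁻¹ʳ t (subst (1 ≤_) n≡t*m 1≤n)

  1≤t : 1 ≤ t
  1≤t = *-pos⁻¹ˡ (subst (1 ≤_) n≡t*m 1≤n)

  instance
    m-nonZero : NonZero m
    m-nonZero = >-nonZero 1≤m

    t-nonZero : NonZero t
    t-nonZero = >-nonZero 1≤t

  a↑% : ∀ k → a ↑ (k % m) ≡ a ↑ k
  a↑% = ↑-% (proj₁ a-order)

  Coordinates : Fin n → ℕ → ℕ → Set
  Coordinates x i j = i < m × j < t × x ≡ a ↑ i ∙ b ↑ j

  opaque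
    coordinates : ∀ x → ∃₂ (Coordinates x)
    coordinates x = reduce (generating x)
      where
      reduce : (∃₂ λ i j → x ≡ a ↑ i ∙ b ↑ j) → ∃₂ (Coordinates x)
      -- Each full `t` in the exponent of `b` is traded for a factor `a ↑ s`.
      reduce (i , j , x≡) = (i + s * (j / t)) % m , j % t , m%n<n _ m , m%n<n j t , (begin
        x                                               ≡⟨ x≡ ⟩
        a ↑ i ∙ b ↑ j                                   ≡⟨ cong (λ k → a ↑ i ∙ b ↑ k) (trans (divmod j) (cong (_+ j % t) (*-comm (j / t) t))) ⟩
        a ↑ i ∙ b ↑ (t * (j / t) + j % t)               ≡⟨ cong (a ↑ i ∙_) (↑-+ b _ _) ⟩
        a ↑ i ∙ (b ↑ (t * (j / t)) ∙ b ↑ (j % t))       ≡⟨ cong (λ y → a ↑ i ∙ (y ∙ b ↑ (j % t))) (↑-* b t (j / t)) ⟨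
        a ↑ i ∙ ((b ↑ t) ↑ (j / t) ∙ b ↑ (j % t))       ≡⟨ cong (λ y → a ↑ i ∙ (y ↑ (j / t) ∙ b ↑ (j % t))) b↑t ⟩
        a ↑ i ∙ ((a ↑ s) ↑ (j / t) ∙ b ↑ (j % t))       ≡⟨ assoc _ _ _ ⟨
        a ↑ i ∙ (a ↑ s) ↑ (j / t) ∙ b ↑ (j % t)         ≡⟨ cong (λ y → a ↑ i ∙ y ∙ b ↑ (j % t)) (↑-* a s (j / t)) ⟩
        a ↑ i ∙ a ↑ (s * (j / t)) ∙ b ↑ (j % t)         ≡⟨ cong (_∙ b ↑ (j % t)) (↑-+ a i _) ⟨
        a ↑ (i + s * (j / t)) ∙ b ↑ (j % t)             ≡⟨ cong (_∙ b ↑ (j % t)) (a↑% _) ⟨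
        a ↑ ((i + s * (j / t)) % m) ∙ b ↑ (j % t)       ∎)

  -- Comparing the two expressions puts `b ↑ (j′ ∸ j)` into `⟪ a ⟫`, so `t` divides a difference
  -- smaller than `t`; the exponents of `a` are then compared below its order.
  coordinates-unique : ∀ {x i j i′ j′} → Coordinates x i j → Coordinates x i′ j′ → i ≡ i′ × j ≡ j′
  coordinates-unique {x} {i} {j} {i′} {j′} (i<m , j<t , x≡) (i′<m , j′<t , x≡′) =
      order-injective a-order i<m i′<m (∙-cancelʳ (b ↑ j) _ _ (trans eq (cong (λ k → a ↑ i′ ∙ b ↑ k) (sym j≡j′)))) , j≡j′
    where
    eq = trans (sym x≡) x≡′
    ordered : ∀ {i j i′ j′} → j ≤ j′ → j′ < t → a ↑ i ∙ b ↑ j ≡ a ↑ i′ ∙ b ↑ j′ → j ≡ j′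
    ordered {i} {j} {i′} {j′} j≤j′ j′<t eq = small (j′ ∸ j) refl (independent _ (j′ ∸ j) (begin
      b ↑ (j′ ∸ j)                              ≡⟨ \\-leftDividesʳ (a ↑ i′) _ ⟨
      (a ↑ i′) ⁻¹ ∙ (a ↑ i′ ∙ b ↑ (j′ ∸ j))     ≡⟨ cong ((a ↑ i′) ⁻¹ ∙_) (∙-cancelʳ (b ↑ j) _ _ (begin
        a ↑ i′ ∙ b ↑ (j′ ∸ j) ∙ b ↑ j             ≡⟨ assoc _ _ _ ⟩
        a ↑ i′ ∙ (b ↑ (j′ ∸ j) ∙ b ↑ j)           ≡⟨ cong (a ↑ i′ ∙_) (↑-+ b _ j) ⟨
        a ↑ i′ ∙ b ↑ (j′ ∸ j + j)                 ≡⟨ cong (λ k → a ↑ i′ ∙ b ↑ k) (m∸n+n≡m j≤j′) ⟩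
        a ↑ i′ ∙ b ↑ j′                           ≡⟨ eq ⟨
        a ↑ i ∙ b ↑ j                             ∎)) ⟩
      (a ↑ i′) ⁻¹ ∙ a ↑ i                       ≡⟨ proj₂ (∈⟪⟫ quotient∈) ⟩
      a ↑ proj₁ (∈⟪⟫ quotient∈)                 ∎))
      where
      quotient∈ : Mem ⟪ a ⟫ ((a ↑ i′) ⁻¹ ∙ a ↑ i)
      quotient∈ = Subgroup.∙∈ ⟪ a ⟫ (Subgroup.⁻¹∈ ⟪ a ⟫ (↑∈⟪⟫ a i′)) (↑∈⟪⟫ a i)
      small : ∀ k → j′ ∸ j ≡ k → t ∣ k → j ≡ j′
      small zero eq _ = ≤-antisym j≤j′ (m∸n≡0⇒m≤n eq)
      small (suc k) eq t∣ = contradiction (≤-trans (∣⇒≤ t∣) (subst (_≤ j′) eq (m∸n≤m j′ j))) (<⇒≱ j′<t)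
    by-cases : j ≤ j′ ⊎ j′ ≤ j → j ≡ j′
    by-cases (inj₁ j≤j′) = ordered j≤j′ j′<t eq
    by-cases (inj₂ j′≤j) = sym (ordered j′≤j j<t (sym eq))
    j≡j′ = by-cases (≤-total j j′)

  ρ : ℕ → ℕ
  ρ j = r ^ j % m

  ◃-ρ : ∀ j → (b ↑ j) ◃ a ≡ a ↑ ρ j
  ◃-ρ j = trans (unreduced j) (sym (a↑% (r ^ j)))
    where
    unreduced : ∀ j → (b ↑ j) ◃ a ≡ a ↑ (r ^ j)
    unreduced zero = trans (cong (_◃ a) (↑-zero b)) (trans (ε-◃ a) (sym (↑-1 a)))
    unreduced (suc j) = begin
      (b ↑ suc j) ◃ a        ≡⟨ cong (_◃ a) (↑-suc b j) ⟩
      (b ∙ b ↑ j) ◃ a        ≡⟨ ◃-◃ b (b ↑ j) a ⟨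
      b ◃ ((b ↑ j) ◃ a)      ≡⟨ cong (b ◃_) (unreduced j) ⟩
      b ◃ (a ↑ (r ^ j))      ≡⟨ ◃-↑ b a (r ^ j) ⟨
      (b ◃ a) ↑ (r ^ j)      ≡⟨ cong (_↑ (r ^ j)) b◃a ⟩
      (a ↑ r) ↑ (r ^ j)      ≡⟨ ↑-* a r (r ^ j) ⟩
      a ↑ (r * r ^ j)        ∎

  ρ<m : ∀ j → ρ j < m
  ρ<m j = m%n<n (r ^ j) m

  -- The exponent j₁ + j₂ of b exceeds its range when c = 0, and then b ↑ t = a ↑ s is carried.
  record Carry (j₁ j₂ : ℕ) : Set where
    field
      c e j′  : ℕ
      c-spec  : (if j₁ <ᵇ (t ∸ j₂) then 1 else 0) ≡ c
      e-spec  : e + c * (s % m) ≡ s % m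
      j′-spec : j′ + (t ∸ j₂) ≡ j₁ + c * t
      j′<t    : j′ < t
      b↑      : b ↑ (j₁ + j₂) ≡ a ↑ e ∙ b ↑ j′

  opaque
    carry : ∀ {j₁ j₂} → j₁ < t → j₂ < t → Carry j₁ j₂
    carry {j₁} {j₂} j₁<t j₂<t with j₁ <ᵇ (t ∸ j₂) in j₁<d
    ... | true = record
      { c = 1 ; e = 0 ; j′ = j₁ + j₂ ; c-spec = cong (if_then 1 else 0) j₁<d ; e-spec = *-identityˡ (s % m)
      ; j′-spec = trans (+-assoc j₁ j₂ _) (cong (j₁ +_) (trans (m+[n∸m]≡n (<⇒≤ j₂<t)) (sym (*-identityˡ t))))
      ; j′<t = subst (j₁ + j₂ <_) (m∸n+n≡m (<⇒≤ j₂<t)) (+-monoˡ-< j₂ (<ᵇ⇒< j₁ (t ∸ j₂) (subst T (sym j₁<d) tt)))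
      ; b↑ = sym (trans (cong (_∙ b ↑ (j₁ + j₂)) (↑-zero a)) (identityˡ _)) }
    ... | false = record
      { c = 0 ; e = s % m ; j′ = j₁ ∸ (t ∸ j₂) ; c-spec = cong (if_then 1 else 0) j₁<d ; e-spec = +-identityʳ _
      ; j′-spec = trans (m∸n+n≡m d≤j₁) (sym (+-identityʳ j₁))
      ; j′<t = ≤-<-trans (m∸n≤m j₁ (t ∸ j₂)) j₁<t
      ; b↑ = begin
          b ↑ (j₁ + j₂)                           ≡⟨ cong (b ↑_) j₁+j₂≡ ⟩
          b ↑ (t + (j₁ ∸ (t ∸ j₂)))               ≡⟨ ↑-+ b t _ ⟩
          b ↑ t ∙ b ↑ (j₁ ∸ (t ∸ j₂))             ≡⟨ cong (_∙ b ↑ (j₁ ∸ (t ∸ j₂))) (trans b↑t (sym (a↑% s))) ⟩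
          a ↑ (s % m) ∙ b ↑ (j₁ ∸ (t ∸ j₂))       ∎ }
      where
      d≤j₁ : t ∸ j₂ ≤ j₁
      d≤j₁ = ≮⇒≥ λ j₁<d′ → subst T j₁<d (<⇒<ᵇ j₁<d′)
      shuffle : ∀ x y z → x + y + z ≡ y + z + x
      shuffle = solve-∀
      j₁+j₂≡ : j₁ + j₂ ≡ t + (j₁ ∸ (t ∸ j₂))
      j₁+j₂≡ = begin
        j₁ + j₂                               ≡⟨ cong (_+ j₂) (m∸n+n≡m d≤j₁) ⟨
        j₁ ∸ (t ∸ j₂) + (t ∸ j₂) + j₂         ≡⟨ shuffle (j₁ ∸ (t ∸ j₂)) (t ∸ j₂) j₂ ⟩
        t ∸ j₂ + j₂ + (j₁ ∸ (t ∸ j₂))         ≡⟨ cong (_+ (j₁ ∸ (t ∸ j₂))) (m∸n+n≡m (<⇒≤ j₂<t)) ⟩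
        t + (j₁ ∸ (t ∸ j₂))                   ∎

  module _ {j₁ j₂ : ℕ} (k : Carry j₁ j₂) where
    open Carry k

    -- Reducing the exponent of `b` splits off a power of `a`, which acts trivially on `a`, so `ρ`
    -- stays multiplicative across a carry.
    ρ-product : ρ j′ ≡ ρ j₁ * ρ j₂ % m
    ρ-product = order-injective a-order (ρ<m j′) (m%n<n _ m) (begin
      a ↑ ρ j′                          ≡⟨ ◃-ρ j′ ⟨
      (b ↑ j′) ◃ a                      ≡⟨ commute⇒◃ (a^e-commutes (◃-ρ j′)) ⟨
      (a ↑ e) ◃ ((b ↑ j′) ◃ a)          ≡⟨ ◃-◃ (a ↑ e) (b ↑ j′) a ⟩
      (a ↑ e ∙ b ↑ j′) ◃ a              ≡⟨ cong (_◃ a) b↑ ⟨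
      (b ↑ (j₁ + j₂)) ◃ a               ≡⟨ cong (_◃ a) (↑-+ b j₁ j₂) ⟩
      (b ↑ j₁ ∙ b ↑ j₂) ◃ a             ≡⟨ ◃-◃ (b ↑ j₁) (b ↑ j₂) a ⟨
      (b ↑ j₁) ◃ ((b ↑ j₂) ◃ a)         ≡⟨ cong ((b ↑ j₁) ◃_) (◃-ρ j₂) ⟩
      (b ↑ j₁) ◃ (a ↑ ρ j₂)             ≡⟨ ◃-↑ (b ↑ j₁) a (ρ j₂) ⟨
      ((b ↑ j₁) ◃ a) ↑ ρ j₂             ≡⟨ cong (_↑ ρ j₂) (◃-ρ j₁) ⟩
      (a ↑ ρ j₁) ↑ ρ j₂                 ≡⟨ ↑-* a (ρ j₁) (ρ j₂) ⟩
      a ↑ (ρ j₁ * ρ j₂)                 ≡⟨ a↑% _ ⟨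
      a ↑ (ρ j₁ * ρ j₂ % m)             ∎)
      where
      a^e-commutes : ∀ {y k} → y ≡ a ↑ k → Commute (a ↑ e) y
      a^e-commutes {k = k} refl = commute-↑↑ a e k

    coordinates-∙ : ∀ {x y i₁ i₂} → Coordinates x i₁ j₁ → Coordinates y i₂ j₂ →
                    Coordinates (x ∙ y) (((i₁ + ρ j₁ * i₂ % m) % m + e) % m) j′
    coordinates-∙ {x} {y} {i₁} {i₂} (_ , _ , refl) (_ , _ , refl) = m%n<n _ m , j′<t , (begin
      a ↑ i₁ ∙ b ↑ j₁ ∙ (a ↑ i₂ ∙ b ↑ j₂)                   ≡⟨ assoc _ (b ↑ j₁) _ ⟩
      a ↑ i₁ ∙ (b ↑ j₁ ∙ (a ↑ i₂ ∙ b ↑ j₂))                 ≡⟨ cong (a ↑ i₁ ∙_) (assoc (b ↑ j₁) _ _) ⟨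
      a ↑ i₁ ∙ (b ↑ j₁ ∙ a ↑ i₂ ∙ b ↑ j₂)                   ≡⟨ cong (λ z → a ↑ i₁ ∙ (z ∙ b ↑ j₂)) move-b ⟩
      a ↑ i₁ ∙ (a ↑ (ρ j₁ * i₂) ∙ b ↑ j₁ ∙ b ↑ j₂)          ≡⟨ cong (a ↑ i₁ ∙_) (assoc _ (b ↑ j₁) _) ⟩
      a ↑ i₁ ∙ (a ↑ (ρ j₁ * i₂) ∙ (b ↑ j₁ ∙ b ↑ j₂))        ≡⟨ assoc _ _ _ ⟨
      a ↑ i₁ ∙ a ↑ (ρ j₁ * i₂) ∙ (b ↑ j₁ ∙ b ↑ j₂)          ≡⟨ cong₂ _∙_ reduce (trans (sym (↑-+ b j₁ j₂)) b↑) ⟩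
      a ↑ ((i₁ + ρ j₁ * i₂ % m) % m) ∙ (a ↑ e ∙ b ↑ j′)     ≡⟨ assoc _ _ _ ⟨
      a ↑ ((i₁ + ρ j₁ * i₂ % m) % m) ∙ a ↑ e ∙ b ↑ j′       ≡⟨ cong (_∙ b ↑ j′) (trans (sym (↑-+ a _ e)) (sym (a↑% _))) ⟩
      a ↑ (((i₁ + ρ j₁ * i₂ % m) % m + e) % m) ∙ b ↑ j′     ∎)
      where
      move-b : b ↑ j₁ ∙ a ↑ i₂ ≡ a ↑ (ρ j₁ * i₂) ∙ b ↑ j₁
      move-b = begin
        b ↑ j₁ ∙ a ↑ i₂                  ≡⟨ //-rightDividesˡ (b ↑ j₁) _ ⟨
        (b ↑ j₁) ◃ (a ↑ i₂) ∙ b ↑ j₁     ≡⟨ cong (_∙ b ↑ j₁) (◃-↑ (b ↑ j₁) a i₂) ⟨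
        ((b ↑ j₁) ◃ a) ↑ i₂ ∙ b ↑ j₁     ≡⟨ cong (λ z → z ↑ i₂ ∙ b ↑ j₁) (◃-ρ j₁) ⟩
        (a ↑ ρ j₁) ↑ i₂ ∙ b ↑ j₁         ≡⟨ cong (_∙ b ↑ j₁) (↑-* a (ρ j₁) i₂) ⟩
        a ↑ (ρ j₁ * i₂) ∙ b ↑ j₁         ∎
      reduce : a ↑ i₁ ∙ a ↑ (ρ j₁ * i₂) ≡ a ↑ ((i₁ + ρ j₁ * i₂ % m) % m)
      reduce = begin
        a ↑ i₁ ∙ a ↑ (ρ j₁ * i₂)          ≡⟨ cong (a ↑ i₁ ∙_) (a↑% _) ⟨
        a ↑ i₁ ∙ a ↑ (ρ j₁ * i₂ % m)      ≡⟨ ↑-+ a i₁ _ ⟨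
        a ↑ (i₁ + ρ j₁ * i₂ % m)          ≡⟨ a↑% _ ⟨
        a ↑ ((i₁ + ρ j₁ * i₂ % m) % m)    ∎

-- Both sides are the quotient of `ρ₁ * ρ₂ * (B * B)` by `m`: one reduces `ρ₁ * ρ₂` first, the other
-- `ρ₂ * (B * B)`. The additive form avoids truncated subtraction.
scaled-quotient-product : ∀ m B ρ₁ ρ₂ ρ′ .{{_ : NonZero m}} → ρ′ ≡ ρ₁ * ρ₂ % m →
  ρ′ * (B * B) / m + ρ₁ * ρ₂ / m * B * B ≡ ρ₁ * (ρ₂ * (B * B) / m) + ρ₁ * (ρ₂ * (B * B) % m) / m
scaled-quotient-product m B ρ₁ ρ₂ ρ′ ρ′≡ = trans (cong (ρ′ * R / m +_) (*-assoc q′ B B)) (proj₁ (divmod-unique _ (ρ′ * R % m) _ (ρ₁ * S₂ % m) (m%n<n _ m) (m%n<n _ m) (begin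
  (ρ′ * R / m + q′ * R) * m + ρ′ * R % m          ≡⟨ regroup (ρ′ * R / m) (q′ * R) m (ρ′ * R % m) ⟩
  q′ * R * m + (ρ′ * R / m * m + ρ′ * R % m)      ≡⟨ cong (q′ * R * m +_) (divmod (ρ′ * R)) ⟨
  q′ * R * m + ρ′ * R                             ≡⟨ factor q′ R m ρ′ ⟩
  (q′ * m + ρ′) * R                               ≡⟨ cong (_* R) (trans (cong (q′ * m +_) ρ′≡) (sym (divmod (ρ₁ * ρ₂)))) ⟩
  ρ₁ * ρ₂ * R                                     ≡⟨ *-assoc ρ₁ ρ₂ R ⟩
  ρ₁ * (ρ₂ * R)                                   ≡⟨ cong (ρ₁ *_) (divmod (ρ₂ * R)) ⟩
  ρ₁ * (Q₂ * m + S₂)                              ≡⟨ expand ρ₁ Q₂ m S₂ ⟩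
  ρ₁ * Q₂ * m + ρ₁ * S₂                           ≡⟨ cong (ρ₁ * Q₂ * m +_) (divmod (ρ₁ * S₂)) ⟩
  ρ₁ * Q₂ * m + (ρ₁ * S₂ / m * m + ρ₁ * S₂ % m)   ≡⟨ collect (ρ₁ * Q₂) m (ρ₁ * S₂ / m) (ρ₁ * S₂ % m) ⟩
  (ρ₁ * Q₂ + ρ₁ * S₂ / m) * m + ρ₁ * S₂ % m       ∎)))
  where
  open ≡-Reasoning
  R  = B * B
  q′ = ρ₁ * ρ₂ / m
  Q₂ = ρ₂ * R / m
  S₂ = ρ₂ * R % m
  regroup : ∀ x y m z → (x + y) * m + z ≡ y * m + (x * m + z)
  regroup = solve-∀
  factor : ∀ q R m p → q * R * m + p * R ≡ (q * m + p) * R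
  factor = solve-∀
  expand : ∀ p Q m S → p * (Q * m + S) ≡ p * Q * m + p * S
  expand = solve-∀
  collect : ∀ x m y z → x * m + (y * m + z) ≡ (x + y) * m + z
  collect = solve-∀

module HalfWord (w : ℕ) (1≤w : 1 ≤ w) where
  B : ℕ
  B = 2 ^ ⌊ w /2⌋

  instance
    B-nonZero : NonZero B
    B-nonZero = m^n≢0 2 ⌊ w /2⌋

  B² : B * B ≡ 2 ^ (⌊ w /2⌋ + ⌊ w /2⌋)
  B² = sym (^-distribˡ-+-* 2 ⌊ w /2⌋ ⌊ w /2⌋)

  B<W : B < 2 ^ w
  B<W = ^-monoʳ-< 2 (s≤s (s≤s z≤n)) (half< 1≤w)
    where
    half< : ∀ {w} → 1 ≤ w → ⌊ w /2⌋ < w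
    half< {suc w} _ = ⌊n/2⌋<n w

  B²≤W : B * B ≤ 2 ^ w
  B²≤W = subst (_≤ 2 ^ w) (sym B²) (^-monoʳ-≤ 2
    (subst (⌊ w /2⌋ + ⌊ w /2⌋ ≤_) (⌊n/2⌋+⌈n/2⌉≡n w) (+-monoʳ-≤ ⌊ w /2⌋ (⌊n/2⌋≤⌈n/2⌉ w))))

  -- In the worst case `w` is odd and `B * B` is half of `2 ^ w`, which still bounds `m`.
  2m≤W⇒m≤B² : ∀ {m} → 2 * m ≤ 2 ^ w → m ≤ B * B
  2m≤W⇒m≤B² {m} 2m≤W = *-cancelˡ-≤ 2 (≤-trans 2m≤W (subst (2 ^ w ≤_) (cong (2 *_) (sym B²))
    (^-monoʳ-≤ 2 (subst (_≤ suc (⌊ w /2⌋ + ⌊ w /2⌋)) (⌊n/2⌋+⌈n/2⌉≡n w)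
      (≤-trans (+-monoʳ-≤ ⌊ w /2⌋ (⌈n/2⌉≤1+⌊n/2⌋ w)) (≤-reflexive (+-suc _ _)))))))
    where
    ⌈n/2⌉≤1+⌊n/2⌋ : ∀ n → ⌈ n /2⌉ ≤ suc ⌊ n /2⌋
    ⌈n/2⌉≤1+⌊n/2⌋ zero = z≤n
    ⌈n/2⌉≤1+⌊n/2⌋ (suc n) = s≤s (⌊n/2⌋-mono (n≤1+n n))

-- The encoding of a Z-group

module Representing {g ℓ : Level} (𝔾 : FiniteGroup g ℓ) (zgroup : IsZGroup 𝔾) (w : ℕ) (order<W : FiniteGroup.order 𝔾 < 2 ^ w) where
  open FiniteGroup 𝔾 using (Carrier; _≈_; index; enumeration) renaming (order to n; _∙_ to _∙ᴳ_)
  open Inverse enumeration using (to-cong; strictlyInverseʳ; from-cong)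
  private module 𝔾 = FiniteGroup 𝔾
  open Renumber 𝔾 using (numbered; index-∙; cyclicSylows)
  open GroupTheory numbered using (1≤n; _∙_; _↑_)

  M : Metacyclic numbered
  M = metacyclic numbered (cyclicSylows zgroup)

  open Metacyclic M
  open Coordinates numbered M
  open Words w using (⌜_⌝; ⌜⌝-injective)

  1≤w : 1 ≤ w
  1≤w = positive w (≤-<-trans 1≤n order<W)
    where
    positive : ∀ w → 1 < 2 ^ w → 1 ≤ w
    positive zero (s≤s ())
    positive (suc w) _ = s≤s z≤n

  open HalfWord w 1≤w

  t<W : t < 2 ^ w
  t<W = ≤-<-trans (subst (t ≤_) (sym n≡t*m) (m≤m*n t m)) order<W

  2m≤W : 2 * m ≤ 2 ^ w
  2m≤W = by-cases thin
    where
    by-cases : m ≡ 1 ⊎ 2 * m ≤ n → 2 * m ≤ 2 ^ w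
    by-cases (inj₁ m≡1) = subst (λ m → 2 * m ≤ 2 ^ w) (sym m≡1) (^-monoʳ-≤ 2 1≤w)
    by-cases (inj₂ 2m≤n) = ≤-trans 2m≤n (<⇒≤ order<W)

  m<W : m < 2 ^ w
  m<W = <-≤-trans (m<m+n m (≤-trans 1≤m (m≤m+n m 0))) 2m≤W

  Q : ℕ → ℕ
  Q j = ρ j * (B * B) / m

  compressed : Vec (Word w) 4
  compressed = ⌜ m ⌝ ∷ ⌜ t ⌝ ∷ ⌜ s % m ⌝ ∷ ⌜ B ⌝ ∷ []

  words : ℕ → ℕ → Vec (Word w) 4
  words i j = ⌜ i ⌝ ∷ ⌜ j ⌝ ∷ ⌜ ρ j ⌝ ∷ ⌜ Q j ⌝ ∷ []

  words-injective : ∀ {i j i′ j′} → i < m → j < t → i′ < m → j′ < t → words i j ≡ words i′ j′ → i ≡ i′ × j ≡ j′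
  words-injective i<m j<t i′<m j′<t eq =
    ⌜⌝-injective (<-trans i<m m<W) (<-trans i′<m m<W) (cong head eq) ,
    ⌜⌝-injective (<-trans j<t t<W) (<-trans j′<t t<W) (cong (head ∘ tail) eq)

  I J : Carrier → ℕ
  I x = proj₁ (coordinates (index x))
  J x = proj₁ (proj₂ (coordinates (index x)))

  IJ : ∀ x → Coordinates (index x) (I x) (J x)
  IJ x = proj₂ (proj₂ (coordinates (index x)))

  label : Carrier → Vec (Word w) 4
  label x = words (I x) (J x)

  label-cong : ∀ {x y} → x ≈ y → label x ≡ label y
  label-cong {x} {y} x≈y = cong (λ k → words (proj₁ (coordinates k)) (proj₁ (proj₂ (coordinates k)))) (to-cong x≈y)

  label-injective : ∀ {x y} → label x ≡ label y → x ≈ y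
  label-injective {x} {y} eq = 𝔾.trans (𝔾.sym (strictlyInverseʳ x)) (𝔾.trans (from-cong index≡) (strictlyInverseʳ y))
    where
    same : I x ≡ I y × J x ≡ J y
    same = words-injective (proj₁ (IJ x)) (proj₁ (proj₂ (IJ x))) (proj₁ (IJ y)) (proj₁ (proj₂ (IJ y))) eq
    index≡ : index x ≡ index y
    index≡ = trans (proj₂ (proj₂ (IJ x))) (trans (cong₂ (λ i j → a ↑ i ∙ b ↑ j) (proj₁ same) (proj₂ same))
      (sym (proj₂ (proj₂ (IJ y)))))

  queryTime : ℕ
  queryTime = suc (length product-code)

  module _ (x y : Carrier) where
    private
      k = carry (proj₁ (proj₂ (IJ x))) (proj₁ (proj₂ (IJ y)))
      open Carry k

      Q-spec : ∀ j → Q j * m + ρ j * (B * B) % m ≡ ρ j * (B * B)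
      Q-spec j = sym (divmod (ρ j * (B * B)))

      Q′-spec : Q j′ + ρ (J x) * ρ (J y) / m * B * B ≡ ρ (J x) * Q (J y) + ρ (J x) * (ρ (J y) * (B * B) % m) / m
      Q′-spec = scaled-quotient-product m B (ρ (J x)) (ρ (J y)) (ρ j′) (ρ-product k)

      open Product w m t (s % m) B (2m≤W⇒m≤B² 2m≤W) B<W B²≤W 2m≤W t<W (m%n<n s m)
        {I x} {J x} {ρ (J x)} {Q (J x)} {ρ (J x) * (B * B) % m} {I y} {J y} {ρ (J y)} {Q (J y)} {ρ (J y) * (B * B) % m}
        (proj₁ (IJ x)) (proj₁ (IJ y)) (proj₁ (proj₂ (IJ x))) (ρ<m (J x)) (ρ<m (J y))
        (m%n<n (ρ (J x) * (B * B)) m) (m%n<n (ρ (J y) * (B * B)) m) (Q-spec (J x)) (Q-spec (J y))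
        {t ∸ J y} {c} {e} {j′} {Q j′}
        (m∸n+n≡m (<⇒≤ (proj₁ (proj₂ (IJ y))))) c-spec e-spec j′-spec Q′-spec

      -- Uniqueness of coordinates identifies the computed pair with that of the product, and the
      -- remaining words depend on `j′` alone.
      label-∙ : label (x ∙ᴳ y) ≡ ⌜ i′ ⌝ ∷ ⌜ j′ ⌝ ∷ ⌜ ρ (J x) * ρ (J y) % m ⌝ ∷ ⌜ Q j′ ⌝ ∷ []
      label-∙ = trans (cong₂ words (proj₁ same) (proj₂ same)) (cong (λ r → ⌜ i′ ⌝ ∷ ⌜ j′ ⌝ ∷ ⌜ r ⌝ ∷ ⌜ Q j′ ⌝ ∷ []) (ρ-product k))
        where
        same : I (x ∙ᴳ y) ≡ i′ × J (x ∙ᴳ y) ≡ j′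
        same = coordinates-unique (IJ (x ∙ᴳ y)) (subst (λ z → Coordinates z i′ j′) (sym (index-∙ x y)) (coordinates-∙ k (IJ x) (IJ y)))

    query : ∀ (scratch : Vec (Word w) 15) → ∃ λ rest →
      product-program ⊢ (0 , (compressed ++ label x) ++ (label y ++ scratch)) ⇓[ queryTime ] ((compressed ++ label (x ∙ᴳ y)) ++ rest)
    query scratch = proj₁ (product-runs scratch) ,
      subst (λ l → product-program ⊢ (0 , (compressed ++ label x) ++ (label y ++ scratch)) ⇓[ queryTime ]
                     ((compressed ++ l) ++ proj₁ (product-runs scratch)))
        (sym label-∙) (straight-halts {is = product-code} 0 refl (proj₂ (product-runs scratch)))

  encoding : Encoding w product-program 𝔾
  encoding = record
    { compressedSize  = 4
    ; compressed      = compressed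
    ; labelSize       = 4
    ; label           = label
    ; label-cong      = label-cong
    ; label-injective = label-injective
    ; scratchSize     = 15
    ; multiply        = λ x y scratch → queryTime , query x y scratch }

theorem5 : {c ℓ : Level} →
    ∃₂ λ (spaceBound timeBound : ℕ) →
    (W : WordLength) →
    Σ[ R ∈ Representation {c} {ℓ} W IsZGroup ]
    (Representation.SpaceBoundedBy R spaceBound
    × Representation.QueryTimeBoundedBy R timeBound)
-- 27 is made up of 4 words of compressed form, two labels of 4 words and 15 scratch cells; the
-- successor in the time bound accounts for `halt`.
theorem5 = 27 , suc (length product-code) , λ W →
  record
    { program = product-program
    ; encode  = λ G zgroup → Representing.encoding G zgroup _ (WordLength.holds W (FiniteGroup.order G)) } ,
  (λ _ _ → ≤-refl) , (λ _ _ _ _ _ → ≤-refl)
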